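{- Let $b\ge1$ be an integer. (i) For every integer $r\ge2$ and every $b$-quasi-bipartite instance satisfying the standing assumptions below, the integrality gap of the linear program $(\mathrm P^{\emptyset}_{ST})$ is at most $\frac{2b+1}{b+1}$. (ii) There exist an integer $r\ge 2$ and a quasi-bipartite (hence $b$-quasi-bipartite) instance satisfying the standing assumptions for which the integrality gap of $(\mathrm P^{\emptyset}_{ST})$ is at least $\frac87$. Thus the worst-case integrality gap of $(\mathrm P^{\emptyset}_{ST})$ on $b$-quasi-bipartite instances lies between $\frac87$ and $\frac{2b+1}{b+1}$.
   Context: An instance of the Steiner tree problem consists of an undirected graph $G=(V,E)$, a terminal set $R\subseteq V$ and nonnegative edge costs $c_e$; vertices of $V\setminus R$ are Steiner vertices. A full component is a tree whose internal vertices are Steiner vertices and whose leaves are terminals. The Steiner neighborhood $S_v$ of a Steiner vertex $v$ is the vertex set of the connected component of $G\setminus R$ containing $v$; the instance is $b$-quasi-bipartite if every Steiner neighborhood has at most $b$ vertices, and quasi-bipartite means $1$-quasi-bipartite. Standing assumptions (preprocessing): (A1) $G[R]$ is complete and for terminals $u,v$, $c_{uv}$ is the cost of a shortest $u$-$v$ path in $G$; (A2) for each Steiner vertex $v$ and each $u\in S_v\cup R$, $uv\in E$ and $c_{uv}$ is the cost of a shortest $u$-$v$ path. Fix $r\ge2$. $\mathcal K_r$ is the family of terminal sets $K$ with $2\le|K|\le r$ that are the terminal set of some full component; each $K\in\mathcal K_r$ is identified with a fixed minimum-cost full component with terminal set $K$ of cost $c_K$ (for $|K|=2$ the edge joining the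 two terminals); Steiner vertices are cloned so that distinct members of $\mathcal K_r$ are edge-disjoint and share only terminals, and $G$ is replaced by the union of all members of $\mathcal K_r$. For a partition $\pi$ of $R$ and $K\in\mathcal K_r$, $\mathrm{rc}^\pi_K$ is the number of parts of $\pi$ containing a terminal of $K$, minus $1$, and $|\pi|$ is the number of parts. The LP $(\mathrm P^{\emptyset}_{ST})$ is: minimize $\sum_{K\in\mathcal K_r}c_Kx_K$ subject to $\sum_{K\in\mathcal K_r}\mathrm{rc}^\pi_Kx_K\ge|\pi|-1$ for every partition $\pi$ of $R$, and $x\ge0$. Its integrality gap on an instance is the ratio of the minimum cost of an integral feasible solution to the minimum cost of a feasible solution.
   Formalization: Edge costs and the values of the LP variables are taken to be rational numbers rather than arbitrary nonnegative reals, so the upper bound in (i) is stated for instances with rational edge costs. -}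

module Defs where

open import Data.Nat as ℕ using (ℕ; zero; suc; _∸_; _<ᵇ_)
open import Data.Fin using (Fin; zero; suc; toℕ; _≟_)
open import Data.Bool using (Bool; true; false; _∧_; _∨_; not; if_then_else_; T)
open import Data.Integer using (+_)
open import Data.Rational using (ℚ; 0ℚ; _+_; _*_; _/_; _≤_)
open import Data.List using (List; []; _∷_; _++_; [_]; length)
open import Data.List.Relation.Unary.Unique.Propositional using (Unique)
open import Data.List.Relation.Unary.Linked using (Linked)
open import Data.List.Relation.Unary.All using (All)
open import Data.Product using (Σ; ∃; _×_; _,_)
open import Data.Sum using (_⊎_)
open import Relation.Binary.PropositionalEquality using (_≡_; _≢_)
open import Relation.Nullary using (¬_; does)
open import Function.Definitions using (Injective)

sumFin : ∀ {n} → (Fin n → ℚ) → ℚ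
sumFin {zero}  f = 0ℚ
sumFin {suc n} f = f zero + sumFin (λ i → f (suc i))

countFin : ∀ {n} → (Fin n → Bool) → ℕ
countFin {zero}  f = 0
countFin {suc n} f = (if f zero then 1 else 0) ℕ.+ countFin (λ i → f (suc i))

anyFin : ∀ {n} → (Fin n → Bool) → Bool
anyFin {zero}  f = false
anyFin {suc n} f = f zero ∨ anyFin (λ i → f (suc i))

ℕ→ℚ : ℕ → ℚ
ℕ→ℚ k = + k / 1

record Graph (n : ℕ) : Set where
  field
    adj        : Fin n → Fin n → Bool
    c          : Fin n → Fin n → ℚ
    adj-sym    : ∀ u v → adj u v ≡ adj v u
    adj-irrefl : ∀ u → adj u u ≡ false
    c-sym      : ∀ u v → T (adj u v) → c u v ≡ c v u
    c-nonneg   : ∀ u v → T (adj u v) → 0ℚ ≤ c u v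
open Graph public

data Walk {n : ℕ} (E : Fin n → Fin n → Bool) : Fin n → Fin n → Set where
  nil  : ∀ {u} → Walk E u u
  cons : ∀ {u v w} → T (E u v) → Walk E v w → Walk E u w

walkCost : ∀ {n} {E : Fin n → Fin n → Bool} (c : Fin n → Fin n → ℚ) {u v : Fin n} →
           Walk E u v → ℚ
walkCost c nil = 0ℚ
walkCost c (cons {u} {v} _ P) = c u v + walkCost c P

-- uv is an edge whose cost is the cost of a shortest u-v path
-- (with nonnegative costs, shortest walk cost = shortest path cost)
ShortestEdge : ∀ {n} → Graph n → Fin n → Fin n → Set
ShortestEdge G u v = T (adj G u v) × (∀ (P : Walk (adj G) u v) → c G u v ≤ walkCost (c G) P)

Steiner : ∀ {n} → (Fin n → Bool) → Fin n → Set
Steiner R u = T (not (R u))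

steinerAdj : ∀ {n} → Graph n → (Fin n → Bool) → Fin n → Fin n → Bool
steinerAdj G R u v = adj G u v ∧ (not (R u) ∧ not (R v))

InNbhd : ∀ {n} → Graph n → (Fin n → Bool) → Fin n → Fin n → Set
InNbhd G R v u = Steiner R u × Walk (steinerAdj G R) v u

A1 : ∀ {n} → Graph n → (Fin n → Bool) → Set
A1 G R = ∀ u v → T (R u) → T (R v) → u ≢ v → ShortestEdge G u v

A2 : ∀ {n} → Graph n → (Fin n → Bool) → Set
A2 G R = ∀ v → Steiner R v → ∀ u → (InNbhd G R v u ⊎ T (R u)) → u ≢ v → ShortestEdge G u v

QuasiBipartite : ℕ → ∀ {n} → Graph n → (Fin n → Bool) → Set
QuasiBipartite b {n} G R =
  ∀ v → Steiner R v → ∀ (f : Fin (suc b) → Fin n) → Injective _≡_ _≡_ f →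
  ¬ (∀ i → InNbhd G R v (f i))

Subgraph : ℕ → Set
Subgraph n = Fin n → Fin n → Bool

deg : ∀ {n} → Subgraph n → Fin n → ℕ
deg H u = countFin (H u)

Cycle : ∀ {n} → Subgraph n → Set
Cycle {n} H = Σ (Fin n) λ a → Σ (List (Fin n)) λ ys →
  (2 ℕ.≤ length ys) × Unique (a ∷ ys) × Linked (λ x y → T (H x y)) (a ∷ ys ++ [ a ])

-- H is a tree in G; its vertex set is the set of vertices incident to an edge of H
IsTree : ∀ {n} → Graph n → Subgraph n → Set
IsTree G H =
  (∀ u v → T (H u v) → T (adj G u v)) ×
  (∀ u v → H u v ≡ H v u) ×
  (∀ u v → 1 ℕ.≤ deg H u → 1 ℕ.≤ deg H v → Walk H u v) ×
  ¬ Cycle H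

IsFullComponent : ∀ {n} → Graph n → (Fin n → Bool) → Subgraph n → Set
IsFullComponent G R H =
  IsTree G H ×
  (∀ u → 2 ℕ.≤ deg H u → Steiner R u) ×
  (∀ u → deg H u ≡ 1 → T (R u))

termSet : ∀ {n} → (Fin n → Bool) → Subgraph n → Fin n → Bool
termSet R H u = R u ∧ (0 <ᵇ deg H u)

subgraphCost : ∀ {n} → Graph n → Subgraph n → ℚ
subgraphCost G H = sumFin λ u → sumFin λ v →
  if H u v ∧ (toℕ u <ᵇ toℕ v) then c G u v else 0ℚ

-- H represents a member K of 𝒦_r: H is a full component with terminal set K,
-- 2 ≤ |K| ≤ r, and H has minimum cost among full components with terminal set K
-- (so subgraphCost G H = c_K).
InKr : ∀ {n} → Graph n → (Fin n → Bool) → ℕ → Subgraph n → Set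
InKr G R r H =
  IsFullComponent G R H ×
  2 ℕ.≤ countFin (termSet R H) ×
  countFin (termSet R H) ℕ.≤ r ×
  (∀ H' → IsFullComponent G R H' → (∀ u → termSet R H' u ≡ termSet R H u) →
     subgraphCost G H ≤ subgraphCost G H')

-- Partitions of R are given by labelings p : Fin n → Fin n (only the labels of
-- terminals matter): two terminals are in the same part iff they have the same label.

hits : ∀ {n} → (Fin n → Fin n) → (Fin n → Bool) → ℕ
hits p S = countFin (λ ℓ → anyFin (λ u → S u ∧ does (p u ≟ ℓ)))

numParts : ∀ {n} → (Fin n → Bool) → (Fin n → Fin n) → ℕ
numParts R p = hits p R

rc : ∀ {n} → (Fin n → Bool) → (Fin n → Fin n) → Subgraph n → ℕ
rc R p H = hits p (termSet R H) ∸ 1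

-- Solutions of (P^∅_ST).  A fractional solution is a finite list of members of 𝒦_r
-- (each represented by its min-cost full component) with nonnegative rational
-- weights x_K (repeated entries add up).  An integral solution is a list of members
-- of 𝒦_r with multiplicity (y_K = number of occurrences).

FracSol : ℕ → Set
FracSol n = List (Subgraph n × ℚ)

IntSol : ℕ → Set
IntSol n = List (Subgraph n)

fracLHS : ∀ {n} → (Fin n → Bool) → (Fin n → Fin n) → FracSol n → ℚ
fracLHS R p [] = 0ℚ
fracLHS R p ((H , w) ∷ xs) = w * ℕ→ℚ (rc R p H) + fracLHS R p xs

fracCost : ∀ {n} → Graph n → FracSol n → ℚ
fracCost G [] = 0ℚ
fracCost G ((H , w) ∷ xs) = w * subgraphCost G H + fracCost G xs

intLHS : ∀ {n} → (Fin n → Bool) → (Fin n → Fin n) → IntSol n → ℕ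
intLHS R p [] = 0
intLHS R p (H ∷ ys) = rc R p H ℕ.+ intLHS R p ys

intCost : ∀ {n} → Graph n → IntSol n → ℚ
intCost G [] = 0ℚ
intCost G (H ∷ ys) = subgraphCost G H + intCost G ys

FracFeasible : ∀ {n} → Graph n → (Fin n → Bool) → ℕ → FracSol n → Set
FracFeasible G R r xs =
  All (λ e → InKr G R r (Data.Product.proj₁ e) × 0ℚ ≤ Data.Product.proj₂ e) xs ×
  (∀ p → ℕ→ℚ (numParts R p ∸ 1) ≤ fracLHS R p xs)

IntFeasible : ∀ {n} → Graph n → (Fin n → Bool) → ℕ → IntSol n → Set
IntFeasible G R r ys =
  All (InKr G R r) ys ×
  (∀ p → numParts R p ∸ 1 ℕ.≤ intLHS R p ys)

GapAtMost : ∀ {n} → Graph n → (Fin n → Bool) → ℕ → ℚ → Set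
GapAtMost {n} G R r α =
  ∀ (xs : FracSol n) → FracFeasible G R r xs →
  ∃ λ (ys : IntSol n) → IntFeasible G R r ys × intCost G ys ≤ α * fracCost G xs

GapAtLeast : ∀ {n} → Graph n → (Fin n → Bool) → ℕ → ℚ → Set
GapAtLeast {n} G R r α =
  ∃ λ (xs : FracSol n) → FracFeasible G R r xs × 0ℚ Data.Rational.< fracCost G xs ×
  (∀ (ys : IntSol n) → IntFeasible G R r ys → α * fracCost G xs ≤ intCost G ys)

{-# OPTIONS --safe #-}

-- Upper bound.  Let Y be a cheapest integral solution and split each of its full components K at the
-- Steiner vertices of degree at least three.  Root K at a longest of the resulting paths, of length m,
-- and let every branching Steiner vertex be connected to the terminals below it by the shorter of two child
-- paths.  These loss paths cost at most b m and, together with m, at most c_K minus their own cost, hence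
-- at most b / (2b + 1) of c_K; contracting them turns the other paths into edges joining terminals,
-- which form a connected graph F on R of cost at least (b + 1) / (2b + 1) of c(Y).  If another full
-- component K' is added, the edges of F that become superfluous can be removed from Y, and what is left
-- still decomposes into full components, so by optimality of Y they cost at most c_K'.  Weighting
-- this with a fractional solution x and applying the partition inequalities to the partitions
-- arising in Kruskal's algorithm on F gives c(F) ≤ c(x).
--
-- Lower bound.  In Skutella's instance, built from the Fano plane, seven stars of weight 1/4 cost 35/4,
-- while any two stars miss a terminal, which forces every integral solution to cost at least 10.

module Submission where

open import Defs
import Algebra.Solver.CommutativeMonoid
open import Data.Bool as Bool using (Bool; true; false; _∧_; _∨_; not; if_then_else_; T)
open import Data.Bool.Properties using (∧-identityʳ)
open import Data.Empty using (⊥; ⊥-elim)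
open import Data.Fin using (Fin; zero; suc; _≟_; toℕ; inject≤; #_)
import Data.Fin.Properties as Finₚ
open import Data.Integer as ℤ using (ℤ; +_)
import Data.Integer.Properties as ℤₚ
open import Data.List using (List; []; _∷_; _++_; [_]; length; map; allFin; cartesianProduct; cartesianProductWith; filter; lookup)
import Data.List.Membership.DecPropositional as DecMembership
open import Data.List.Membership.Propositional using (_∈_; _∉_)
open import Data.List.Membership.Propositional.Properties using (∈-allFin; ∈-cartesianProduct⁺; ∈-cartesianProductWith⁺; ∈-lookup; ∈-filter⁺; ∈-map⁺; ∈-++⁺ˡ; ∈-++⁺ʳ; ∈-filter⁻; ∈-++⁻)
open import Data.List.Properties using (∷-injective; filter-accept)
open import Data.List.Relation.Binary.Permutation.Propositional using (_↭_; prep; swap; ↭-refl; ↭-sym; ↭-trans; ↭⇒↭ₛ; ↭-reflexive)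
open import Data.List.Relation.Binary.Permutation.Propositional.Properties using (All-resp-↭; ∈-resp-↭; ++⁺ˡ; ++⁺ʳ; shift; ++⁺; ++-commutativeMonoid; ↭-map-inv; ↭-empty-inv; map⁺)
import Data.List.Relation.Binary.Permutation.Setoid.Properties as Permutationₛ
open import Data.List.Relation.Binary.Sublist.Propositional using (_⊆_; []; _∷_; _∷ʳ_; minimum)
open import Data.List.Relation.Unary.All as All using (All; []; _∷_)
import Data.List.Relation.Unary.All.Properties as Allₚ
open import Data.List.Relation.Unary.AllPairs as AllPairs using (AllPairs; []; _∷_)
open import Data.List.Relation.Unary.Any using (here; there)
open import Data.List.Relation.Unary.Linked as Linked using (Linked; [-]; _∷_)
open import Data.List.Relation.Unary.Linked.Properties using (Linked⇒AllPairs)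
open import Data.List.Relation.Unary.Unique.DecPropositional using (unique?)
open import Data.List.Relation.Unary.Unique.Propositional using (Unique)
import Data.List.Relation.Unary.Unique.Propositional.Properties as Uniqueₚ
import Data.List.Sort as Sort
open import Data.Maybe using (Maybe; just; nothing)
open import Data.Nat using (ℕ; zero; suc; _≤_; _<_; _*_; _+_; _∸_; z≤n; s≤s; _<ᵇ_; _≤ᵇ_; _≡ᵇ_; _%_)
import Data.Nat.Properties as ℕₚ
open import Data.Product using (∃; ∃₂; _×_; _,_; proj₁; proj₂)
open import Data.Rational as ℚ using (ℚ; 0ℚ; 1ℚ; _/_) renaming (_+_ to _+ℚ_; _*_ to _*ℚ_; _≤_ to _≤ℚ_; _-_ to _-ℚ_; -_ to -ℚ_)
import Data.Rational.Properties as ℚₚ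
import Data.Rational.Unnormalised as ℚᵘ
import Data.Rational.Unnormalised.Properties as ℚᵘₚ
open import Data.Sum using (_⊎_; inj₁; inj₂)
open import Data.Unit using (⊤; tt)
import Data.Vec.Functional as Vector
open import Function using (id)
open import Level using (0ℓ)
import Relation.Binary.Construct.On as On
open import Relation.Binary.Definitions using (tri<; tri≈; tri>)
open import Relation.Binary.PropositionalEquality using (_≡_; _≢_; refl; sym; trans; cong; cong₂; subst; module ≡-Reasoning; subst₂; setoid)
open import Relation.Nullary using (¬_; Dec; yes; no; does)
open import Relation.Nullary.Decidable using (dec-true; dec-false; _×-dec_; _→-dec_; ¬?; map′)
open import Tactic.RingSolver using (solve-∀)
open import Tactic.RingSolver.Core.AlmostCommutativeRing using (AlmostCommutativeRing; fromCommutativeRing)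

-- Partitions are labelings, and connectivity is a statement about them: a list of components
-- connects `R` when every labeling that is constant on each terminal set is constant on `R`.
-- Joining two solutions then just conjoins constraints, and no hypergraph walks are needed. The
-- obstacle is the exchange step. Hence `Y` is taken optimal among all lists of full components with
-- 2 to `r` terminals, cheapest or not; each is exchanged for a cheapest one with the same terminals
-- only at the very end. Existence of `Y` needs finiteness, obtained by enumerating subgraphs up to
-- pointwise equality. `F` may contain cycles. Edges that close one are charged to an exchange in
-- which nothing is added, so optimality makes their total price at most 0. If `l` is the loss of a
-- component of cost `c`, adding `l ≤ b m` to `b` times `2 l + m ≤ c` gives `(2 b + 1) l ≤ b c`.

-- Booleans and counting over finite sets.

∧-intro : ∀ {x y} → T x → T y → T (x ∧ y)
∧-intro {true} {true} _ _ = tt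

∧-fst : ∀ {x y} → T (x ∧ y) → T x
∧-fst {true} _ = tt

∧-snd : ∀ {x y} → T (x ∧ y) → T y
∧-snd {true} {true} _ = tt

T⇒≡ : ∀ {x} → T x → x ≡ true
T⇒≡ {true} _ = refl

¬T⇒≡ : ∀ {x} → ¬ T x → x ≡ false
¬T⇒≡ {true} f = ⊥-elim (f tt)
¬T⇒≡ {false} _ = refl

T-ext : ∀ {x y} → (T x → T y) → (T y → T x) → x ≡ y
T-ext {true} {true} _ _ = refl
T-ext {true} {false} f _ = ⊥-elim (f tt)
T-ext {false} {true} _ g = ⊥-elim (g tt)
T-ext {false} {false} _ _ = refl

not-intro : ∀ {x} → ¬ T x → T (not x)
not-intro {true} f = ⊥-elim (f tt)
not-intro {false} _ = tt

not-elim : ∀ {x} → T (not x) → ¬ T x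
not-elim {false} _ ()

∨-left : ∀ {x y} → T x → T (x ∨ y)
∨-left {true} _ = tt

∨-right : ∀ {x y} → T y → T (x ∨ y)
∨-right {true} _ = tt
∨-right {false} t = t

∨-elim : ∀ {x y} → T (x ∨ y) → T x ⊎ T y
∨-elim {true} _ = inj₁ tt
∨-elim {false} t = inj₂ t

does-intro : ∀ {A : Set} (d : Dec A) → A → T (does d)
does-intro (yes _) _ = tt
does-intro (no n) a = ⊥-elim (n a)

does-elim : ∀ {A : Set} (d : Dec A) → T (does d) → A
does-elim (yes a) _ = a

T? : ∀ x → Dec (T x)
T? true = yes tt
T? false = no λ ()

anyFin-intro : ∀ {n} (f : Fin n → Bool) i → T (f i) → T (anyFin f)
anyFin-intro f zero t = ∨-left t
anyFin-intro f (suc i) t = ∨-right {f zero} (anyFin-intro (λ j → f (suc j)) i t)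

anyFin-elim : ∀ {n} (f : Fin n → Bool) → T (anyFin f) → ∃ λ i → T (f i)
anyFin-elim {suc n} f t with ∨-elim {f zero} t
... | inj₁ t₀ = zero , t₀
... | inj₂ ts with i , tᵢ ← anyFin-elim (λ j → f (suc j)) ts = suc i , tᵢ

bit : Bool → ℕ
bit x = if x then 1 else 0

bit-mono : ∀ {x y} → (T x → T y) → bit x ≤ bit y
bit-mono {false} _ = z≤n
bit-mono {true} {true} _ = s≤s z≤n
bit-mono {true} {false} f = ⊥-elim (f tt)

countFin-mono : ∀ {n} (f g : Fin n → Bool) → (∀ i → T (f i) → T (g i)) → countFin f ≤ countFin g
countFin-mono {zero} f g h = z≤n
countFin-mono {suc n} f g h = ℕₚ.+-mono-≤ (bit-mono (h zero)) (countFin-mono _ _ λ i → h (suc i))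

countFin-cong : ∀ {n} (f g : Fin n → Bool) → (∀ i → f i ≡ g i) → countFin f ≡ countFin g
countFin-cong {zero} f g h = refl
countFin-cong {suc n} f g h = cong₂ _+_ (cong bit (h zero)) (countFin-cong _ _ λ i → h (suc i))

countFin-pos : ∀ {n} (f : Fin n → Bool) i → T (f i) → 1 ≤ countFin f
countFin-pos f zero t rewrite T⇒≡ t = s≤s z≤n
countFin-pos f (suc i) t = ℕₚ.≤-trans (countFin-pos (λ j → f (suc j)) i t) (ℕₚ.m≤n+m _ _)

countFin-pos⁻ : ∀ {n} (f : Fin n → Bool) → 1 ≤ countFin f → ∃ λ i → T (f i)
countFin-pos⁻ {suc n} f p with f zero in eq
... | true = zero , subst T (sym eq) tt
... | false with i , t ← countFin-pos⁻ (λ j → f (suc j)) p = suc i , t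

countFin-two : ∀ {n} (f : Fin n → Bool) i j → i ≢ j → T (f i) → T (f j) → 2 ≤ countFin f
countFin-two f zero zero ne _ _ = ⊥-elim (ne refl)
countFin-two f zero (suc j) ne s t rewrite T⇒≡ s = s≤s (countFin-pos (λ k → f (suc k)) j t)
countFin-two f (suc i) zero ne s t rewrite T⇒≡ t = s≤s (countFin-pos (λ k → f (suc k)) i s)
countFin-two f (suc i) (suc j) ne s t =
  ℕₚ.≤-trans (countFin-two (λ k → f (suc k)) i j (λ e → ne (cong suc e)) s t) (ℕₚ.m≤n+m _ _)

countFin-two⁻ : ∀ {n} (f : Fin n → Bool) → 2 ≤ countFin f → ∃₂ λ i j → i ≢ j × T (f i) × T (f j)
countFin-two⁻ {suc n} f p with f zero in eq
... | true with s≤s q ← p with j , t ← countFin-pos⁻ (λ k → f (suc k)) q =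
      zero , suc j , (λ ()) , subst T (sym eq) tt , t
... | false with i , j , ne , s , t ← countFin-two⁻ (λ k → f (suc k)) p =
      suc i , suc j , (λ { refl → ne refl }) , s , t

countFin-split : ∀ {n} (f : Fin n → Bool) a →
  countFin f ≡ bit (f a) + countFin (λ i → f i ∧ not (does (i ≟ a)))
countFin-split {suc n} f zero with f zero
... | true = cong suc (countFin-cong (λ i → f (suc i)) _ λ i → sym (∧-identityʳ _))
... | false = countFin-cong (λ i → f (suc i)) _ λ i → sym (∧-identityʳ _)
countFin-split {suc n} f (suc a) = begin
    b₀ + countFin f′
      ≡⟨ cong (λ z → b₀ + z) (countFin-split f′ a) ⟩
    b₀ + (bit (f′ a) + r)
      ≡⟨ sym (ℕₚ.+-assoc b₀ _ _) ⟩
    b₀ + bit (f′ a) + r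
      ≡⟨ cong (_+ r) (ℕₚ.+-comm b₀ _) ⟩
    bit (f′ a) + b₀ + r
      ≡⟨ ℕₚ.+-assoc (bit (f′ a)) _ _ ⟩
    bit (f′ a) + (b₀ + r)
      ≡⟨ cong (λ z → bit (f′ a) + z) (cong₂ _+_ (cong bit (sym (∧-identityʳ (f zero)))) refl) ⟩
    bit (f′ a) + (bit (f zero ∧ true) + r) ∎
  where
  open ≡-Reasoning
  f′ = λ i → f (suc i)
  b₀ = bit (f zero)
  r = countFin (λ i → f′ i ∧ not (does (i ≟ a)))

-- Labelings as partitions: parts met by a set, and merging two parts.

hit : ∀ {n} → (Fin n → Fin n) → (Fin n → Bool) → Fin n → Bool
hit p S ℓ = anyFin (λ u → S u ∧ does (p u ≟ ℓ))

hit-intro : ∀ {n} (p : Fin n → Fin n) S {ℓ} u → T (S u) → p u ≡ ℓ → T (hit p S ℓ)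
hit-intro p S {ℓ} u s e = anyFin-intro _ u (∧-intro s (does-intro (p u ≟ ℓ) e))

hit-elim : ∀ {n} (p : Fin n → Fin n) S ℓ → T (hit p S ℓ) → ∃ λ u → T (S u) × p u ≡ ℓ
hit-elim p S ℓ t with u , h ← anyFin-elim _ t = u , ∧-fst h , does-elim (p u ≟ ℓ) (∧-snd {S u} h)

Constant : ∀ {n} → (Fin n → Bool) → (Fin n → Fin n) → Set
Constant S q = ∀ u v → T (S u) → T (S v) → q u ≡ q v

constant⇒hits≤1 : ∀ {n} (p : Fin n → Fin n) S → Constant S p → hits p S ≤ 1
constant⇒hits≤1 p S c with hits p S ℕₚ.≤? 1
... | yes h = h
... | no h with i , j , ne , s , t ← countFin-two⁻ (hit p S) (ℕₚ.≰⇒> h)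
           with u , su , refl ← hit-elim p S i s | v , sv , refl ← hit-elim p S j t =
      ⊥-elim (ne (c u v su sv))

hits≤1⇒constant : ∀ {n} (p : Fin n → Fin n) S → hits p S ≤ 1 → Constant S p
hits≤1⇒constant p S h u v su sv with p u ≟ p v
... | yes e = e
... | no ne = ⊥-elim (ℕₚ.<⇒≱ (countFin-two (hit p S) (p u) (p v) ne
                  (hit-intro p S u su refl) (hit-intro p S v sv refl)) h)

hits-mono : ∀ {n} (p : Fin n → Fin n) S S′ → (∀ u → T (S u) → T (S′ u)) → hits p S ≤ hits p S′
hits-mono p S S′ h = countFin-mono _ _ λ ℓ t → let u , s , e = hit-elim p S ℓ t in hit-intro p S′ u (h u s) e

merge : ∀ {n} → Fin n → Fin n → (Fin n → Fin n) → Fin n → Fin n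
merge a b p x = if does (p x ≟ a) then b else p x

merge-eq : ∀ {n} {a b : Fin n} {p x} → p x ≡ a → merge a b p x ≡ b
merge-eq {a = a} {b} {p} {x} e rewrite dec-true (p x ≟ a) e = refl

merge-ne : ∀ {n} {a b : Fin n} {p x} → p x ≢ a → merge a b p x ≡ p x
merge-ne {a = a} {b} {p} {x} e rewrite dec-false (p x ≟ a) e = refl

merge-coarsens : ∀ {n} (a b : Fin n) p {x y} → p x ≡ p y → merge a b p x ≡ merge a b p y
merge-coarsens a b p {x} {y} e rewrite e = refl

merge-joins : ∀ {n} (p : Fin n → Fin n) s t → merge (p s) (p t) p s ≡ merge (p s) (p t) p t
merge-joins p s t with p t ≟ p s
... | yes e = trans (merge-eq {p = p} {x = s} refl) refl
... | no e = merge-eq {p = p} {x = s} refl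

-- The only identifications made by merge are those generated by s ~ t.
merge-universal : ∀ {n} (_~_ : Fin n → Fin n → Set) → (∀ {x y} → x ~ y → y ~ x) → (∀ {x y z} → x ~ y → y ~ z → x ~ z) →
  ∀ (p : Fin n → Fin n) s t → (∀ {x y} → p x ≡ p y → x ~ y) → s ~ t →
  ∀ {x y} → merge (p s) (p t) p x ≡ merge (p s) (p t) p y → x ~ y
merge-universal _~_ sy tr p s t c e {x} {y} m with p x ≟ p s | p y ≟ p s
... | yes ex | yes ey = c (trans ex (sym ey))
... | yes ex | no ey = tr (c ex) (tr e (c m))
... | no ex | yes ey = tr (c m) (tr (sy e) (c (sym ey)))
... | no ex | no ey = c m

hits-merge : ∀ {n} (p : Fin n → Fin n) S a b → a ≢ b →
  hits (merge a b p) S + bit (hit p S a ∧ hit p S b) ≡ hits p S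
hits-merge {n} p S a b ne = begin
    hits p′ S + bit (h a ∧ h b)
      ≡⟨ cong (_+ bit (h a ∧ h b)) (split2 h′) ⟩
    bit (h′ a) + (bit (h′ b) + rest h′) + bit (h a ∧ h b)
      ≡⟨ cong₂ (λ x y → bit x + (bit y + rest h′) + bit (h a ∧ h b)) h′a h′b ⟩
    bit (h a ∨ h b) + rest h′ + bit (h a ∧ h b)
      ≡⟨ cong (λ z → bit (h a ∨ h b) + z + bit (h a ∧ h b)) rest-eq ⟩
    bit (h a ∨ h b) + rest h + bit (h a ∧ h b)
      ≡⟨ arith (h a) (h b) (rest h) ⟩
    bit (h a) + (bit (h b) + rest h)
      ≡⟨ sym (split2 h) ⟩
    hits p S ∎
  where
  open ≡-Reasoning
  p′ = merge a b p
  h = hit p S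
  h′ = hit p′ S
  rest : (Fin n → Bool) → ℕ
  rest f = countFin (λ i → (f i ∧ not (does (i ≟ a))) ∧ not (does (i ≟ b)))
  split2 : ∀ f → countFin f ≡ bit (f a) + (bit (f b) + rest f)
  split2 f = trans (countFin-split f a) (cong (λ z → bit (f a) + z)
    (trans (countFin-split (λ i → f i ∧ not (does (i ≟ a))) b)
      (cong (λ z → bit z + rest f) (T-ext ∧-fst
        (λ t → ∧-intro t (not-intro λ d → ne (sym (does-elim (b ≟ a) d))))))))
  h′a : h′ a ≡ false
  h′a = ¬T⇒≡ λ t → let u , s , e = hit-elim p′ S a t in go u e
    where
    go : ∀ u → p′ u ≡ a → ⊥
    go u e with p u ≟ a
    ... | yes eq = ne (sym e)
    ... | no nq = nq e
  h′b : h′ b ≡ h a ∨ h b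
  h′b = T-ext to from
    where
    to : T (h′ b) → T (h a ∨ h b)
    to t with u , s , e ← hit-elim p′ S b t with p u ≟ a
    ... | yes eq = ∨-left (hit-intro p S u s eq)
    ... | no nq = ∨-right {h a} (hit-intro p S u s e)
    from : T (h a ∨ h b) → T (h′ b)
    from t with ∨-elim {h a} t
    ... | inj₁ ta with u , s , e ← hit-elim p S a ta = hit-intro p′ S u s (merge-eq {p = p} e)
    ... | inj₂ tb with u , s , e ← hit-elim p S b tb =
      hit-intro p′ S u s (trans (merge-ne {p = p} λ eq → ne (trans (sym eq) e)) e)
  rest-eq : rest h′ ≡ rest h
  rest-eq = countFin-cong _ _ λ i → T-ext
    (λ t → ∧-intro (∧-intro (to i (∧-fst (∧-fst t)) (not-elim (∧-snd {h′ i ∧ _} t))) (∧-snd {h′ i} (∧-fst t))) (∧-snd {h′ i ∧ _} t))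
    (λ t → ∧-intro (∧-intro (from i (∧-fst (∧-fst t)) (not-elim (∧-snd {h i} (∧-fst t)))) (∧-snd {h i} (∧-fst t))) (∧-snd {h i ∧ _} t))
    where
    to : ∀ i → T (h′ i) → ¬ T (does (i ≟ b)) → T (h i)
    to i t nb with u , s , e ← hit-elim p′ S i t with p u ≟ a
    ... | yes eq = ⊥-elim (nb (does-intro (i ≟ b) (sym e)))
    ... | no nq = hit-intro p S u s e
    from : ∀ i → T (h i) → ¬ T (does (i ≟ a)) → T (h′ i)
    from i t na with u , s , e ← hit-elim p S i t =
      hit-intro p′ S u s (trans (merge-ne {p = p} λ eq → na (does-intro (i ≟ a) (trans (sym e) eq))) e)
  arith : ∀ x y r → bit (x ∨ y) + r + bit (x ∧ y) ≡ bit x + (bit y + r)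
  arith true true r = cong suc (ℕₚ.+-comm r 1)
  arith true false r = ℕₚ.+-identityʳ _
  arith false y r = ℕₚ.+-identityʳ _

countFin-strict : ∀ {n} (f g : Fin n → Bool) i → (∀ j → T (f j) → T (g j)) → T (g i) → ¬ T (f i) → countFin f < countFin g
countFin-strict f g i sub gi nf = subst (countFin f <_) (sym (trans (countFin-split g i) (cong (λ z → bit z + r) (T⇒≡ gi))))
  (s≤s (countFin-mono f _ λ j t → ∧-intro (sub j t) (not-intro λ d → nf (subst (λ k → T (f k)) (does-elim (j ≟ i) d) t))))
  where
  r = countFin (λ j → g j ∧ not (does (j ≟ i)))

T-<ᵇ : ∀ {m} → 1 ≤ m → T (0 <ᵇ m)
T-<ᵇ (s≤s _) = tt

T-<ᵇ⁻ : ∀ {m} → T (0 <ᵇ m) → 1 ≤ m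
T-<ᵇ⁻ {suc m} _ = s≤s z≤n

-- Rational arithmetic and weighted sums.

ℚ-ring : AlmostCommutativeRing 0ℓ 0ℓ
ℚ-ring = fromCommutativeRing ℚₚ.+-*-commutativeRing isZero
  where
  isZero : ∀ x → Maybe (0ℚ ≡ x)
  isZero x with 0ℚ ℚₚ.≟ x
  ... | yes e = just e
  ... | no _ = nothing

0≤-⇒≤ : ∀ {p q} → 0ℚ ≤ℚ q -ℚ p → p ≤ℚ q
0≤-⇒≤ {p} {q} h = begin
    p ≡⟨ sym (ℚₚ.+-identityʳ p) ⟩
    p +ℚ 0ℚ ≤⟨ ℚₚ.+-monoʳ-≤ p h ⟩
    p +ℚ (q -ℚ p) ≡⟨ lemma p q ⟩
    q ∎
  where
  open ℚₚ.≤-Reasoning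
  lemma : ∀ p q → p +ℚ (q -ℚ p) ≡ q
  lemma = solve-∀ ℚ-ring

≤⇒0≤- : ∀ {p q} → p ≤ℚ q → 0ℚ ≤ℚ q -ℚ p
≤⇒0≤- {p} {q} h = subst (_≤ℚ q -ℚ p) (ℚₚ.+-inverseʳ p) (ℚₚ.+-monoˡ-≤ (-ℚ p) h)

0≤+ : ∀ {p q} → 0ℚ ≤ℚ p → 0ℚ ≤ℚ q → 0ℚ ≤ℚ p +ℚ q
0≤+ hp hq = ℚₚ.+-mono-≤ hp hq

0≤* : ∀ {p q} → 0ℚ ≤ℚ p → 0ℚ ≤ℚ q → 0ℚ ≤ℚ p *ℚ q
0≤* {p} {q} hp hq = subst (_≤ℚ p *ℚ q) (ℚₚ.*-zeroʳ p) (ℚₚ.*-monoˡ-≤-nonNeg p {{ℚ.nonNegative hp}} hq)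

*-mono-≤ : ∀ {w p q} → 0ℚ ≤ℚ w → p ≤ℚ q → w *ℚ p ≤ℚ w *ℚ q
*-mono-≤ {w} hw h = ℚₚ.*-monoˡ-≤-nonNeg w {{ℚ.nonNegative hw}} h

-- The form of most linear estimates below: the difference is rewritten by the ring solver as a
-- combination of slacks known to be nonnegative.
certify : ∀ {p q e} → 0ℚ ≤ℚ e → q -ℚ p ≡ e → p ≤ℚ q
certify h eq = 0≤-⇒≤ (subst (0ℚ ≤ℚ_) (sym eq) h)

-- Normalised rationals divide by a gcd, which does not compute on variables, so facts about `ℕ→ℚ`
-- are transported through unnormalised ones.
toℚᵘ-ℕ→ℚ : ∀ k → ℚ.toℚᵘ (ℕ→ℚ k) ℚᵘ.≃ ℚᵘ.mkℚᵘ (+ k) 0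
toℚᵘ-ℕ→ℚ k = ℚₚ.toℚᵘ-fromℚᵘ (ℚᵘ.mkℚᵘ (+ k) 0)

ℕ→ℚ-+ : ∀ m n → ℕ→ℚ (m + n) ≡ ℕ→ℚ m +ℚ ℕ→ℚ n
ℕ→ℚ-+ m n = ℚₚ.toℚᵘ-injective (ℚᵘₚ.≃-trans (toℚᵘ-ℕ→ℚ (m + n)) (ℚᵘₚ.≃-sym
  (ℚᵘₚ.≃-trans (ℚₚ.toℚᵘ-homo-+ (ℕ→ℚ m) (ℕ→ℚ n))
  (ℚᵘₚ.≃-trans (ℚᵘₚ.+-cong (toℚᵘ-ℕ→ℚ m) (toℚᵘ-ℕ→ℚ n))
  (ℚᵘ.*≡* (cong (ℤ._* + 1) (cong₂ ℤ._+_ (ℤₚ.*-identityʳ (+ m)) (ℤₚ.*-identityʳ (+ n)))))))))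

ℕ→ℚ-* : ∀ m n → ℕ→ℚ (m * n) ≡ ℕ→ℚ m *ℚ ℕ→ℚ n
ℕ→ℚ-* m n = ℚₚ.toℚᵘ-injective (ℚᵘₚ.≃-trans (toℚᵘ-ℕ→ℚ (m * n)) (ℚᵘₚ.≃-sym
  (ℚᵘₚ.≃-trans (ℚₚ.toℚᵘ-homo-* (ℕ→ℚ m) (ℕ→ℚ n))
  (ℚᵘₚ.≃-trans (ℚᵘₚ.*-cong (toℚᵘ-ℕ→ℚ m) (toℚᵘ-ℕ→ℚ n))
  (ℚᵘ.*≡* (cong (ℤ._* + 1) (sym (ℤₚ.pos-* m n))))))))

ℕ→ℚ-mono : ∀ {m n} → m ≤ n → ℕ→ℚ m ≤ℚ ℕ→ℚ n
ℕ→ℚ-mono {m} {n} h = ℚₚ.toℚᵘ-cancel-≤ (ℚᵘₚ.≤-respˡ-≃ (ℚᵘₚ.≃-sym (toℚᵘ-ℕ→ℚ m)) (ℚᵘₚ.≤-respʳ-≃ (ℚᵘₚ.≃-sym (toℚᵘ-ℕ→ℚ n))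
  (ℚᵘ.*≤* (ℤₚ.*-monoʳ-≤-nonNeg (+ 1) (ℤ.+≤+ h)))))

ℕ→ℚ-cancel : ∀ {m n} → ℕ→ℚ m ≤ℚ ℕ→ℚ n → m ≤ n
ℕ→ℚ-cancel {m} {n} h with ℚᵘₚ.≤-respˡ-≃ (toℚᵘ-ℕ→ℚ m) (ℚᵘₚ.≤-respʳ-≃ (toℚᵘ-ℕ→ℚ n) (ℚₚ.toℚᵘ-mono-≤ h))
... | ℚᵘ.*≤* z = ℤₚ.drop‿+≤+ (ℤₚ.*-cancelʳ-≤-pos (+ m) (+ n) (+ 1) z)

0≤ℕ→ℚ : ∀ n → 0ℚ ≤ℚ ℕ→ℚ n
0≤ℕ→ℚ n = ℕ→ℚ-mono {0} {n} z≤n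

/-*-cancel : ∀ m d → (+ m / suc d) *ℚ ℕ→ℚ (suc d) ≡ ℕ→ℚ m
/-*-cancel m d = ℚₚ.toℚᵘ-injective (ℚᵘₚ.≃-trans (ℚₚ.toℚᵘ-homo-* (+ m / suc d) (ℕ→ℚ (suc d)))
  (ℚᵘₚ.≃-trans (ℚᵘₚ.*-cong (ℚₚ.toℚᵘ-fromℚᵘ (ℚᵘ.mkℚᵘ (+ m) d)) (toℚᵘ-ℕ→ℚ (suc d)))
  (ℚᵘₚ.≃-trans (ℚᵘ.*≡* (trans (ℤₚ.*-assoc (+ m) (+ suc d) (+ 1)) (cong (+ m ℤ.*_) (sym (ℤₚ.pos-* (suc d) 1)))))
  (ℚᵘₚ.≃-sym (toℚᵘ-ℕ→ℚ m)))))

wsum : ∀ {n} → FracSol n → (Subgraph n → ℚ) → ℚ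
wsum [] f = 0ℚ
wsum ((H , x) ∷ xs) f = x *ℚ f H +ℚ wsum xs f

NonnegWeights : ∀ {n} → FracSol n → Set
NonnegWeights = All (λ e → 0ℚ ≤ℚ proj₂ e)

wsum-mono : ∀ {n} (xs : FracSol n) {f g} → NonnegWeights xs → (∀ H → f H ≤ℚ g H) → wsum xs f ≤ℚ wsum xs g
wsum-mono [] [] h = ℚₚ.≤-refl
wsum-mono ((H , x) ∷ xs) (p ∷ ps) h = ℚₚ.+-mono-≤ (*-mono-≤ p (h H)) (wsum-mono xs ps h)

wsum-mono-All : ∀ {n} (xs : FracSol n) {f g} → NonnegWeights xs → All (λ e → f (proj₁ e) ≤ℚ g (proj₁ e)) xs → wsum xs f ≤ℚ wsum xs g
wsum-mono-All [] [] h = ℚₚ.≤-refl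
wsum-mono-All ((H , x) ∷ xs) (p ∷ ps) (h ∷ hs) = ℚₚ.+-mono-≤ (*-mono-≤ p h) (wsum-mono-All xs ps hs)

wsum-cong : ∀ {n} (xs : FracSol n) {f g} → (∀ H → f H ≡ g H) → wsum xs f ≡ wsum xs g
wsum-cong [] h = refl
wsum-cong ((H , x) ∷ xs) h = cong₂ _+ℚ_ (cong (x *ℚ_) (h H)) (wsum-cong xs h)

wsum-+ : ∀ {n} (xs : FracSol n) f g → wsum xs (λ H → f H +ℚ g H) ≡ wsum xs f +ℚ wsum xs g
wsum-+ [] f g = refl
wsum-+ ((H , x) ∷ xs) f g rewrite wsum-+ xs f g = lemma x (f H) (g H) (wsum xs f) (wsum xs g)
  where
  lemma : ∀ x a b c d → x *ℚ (a +ℚ b) +ℚ (c +ℚ d) ≡ (x *ℚ a +ℚ c) +ℚ (x *ℚ b +ℚ d)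
  lemma = solve-∀ ℚ-ring

wsum-scale : ∀ {n} (xs : FracSol n) k f → wsum xs (λ H → k *ℚ f H) ≡ k *ℚ wsum xs f
wsum-scale [] k f = sym (ℚₚ.*-zeroʳ k)
wsum-scale ((H , x) ∷ xs) k f rewrite wsum-scale xs k f = lemma x k (f H) (wsum xs f)
  where
  lemma : ∀ x k a b → x *ℚ (k *ℚ a) +ℚ k *ℚ b ≡ k *ℚ (x *ℚ a +ℚ b)
  lemma = solve-∀ ℚ-ring

wsum-zero : ∀ {n} (xs : FracSol n) {f} → (∀ H → f H ≡ 0ℚ) → wsum xs f ≡ 0ℚ
wsum-zero [] h = refl
wsum-zero ((H , x) ∷ xs) h rewrite h H | wsum-zero xs h | ℚₚ.*-zeroʳ x = refl

fracLHS-wsum : ∀ {n} R p (xs : FracSol n) → fracLHS R p xs ≡ wsum xs (λ H → ℕ→ℚ (rc R p H))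
fracLHS-wsum R p [] = refl
fracLHS-wsum R p ((H , x) ∷ xs) = cong (x *ℚ ℕ→ℚ (rc R p H) +ℚ_) (fracLHS-wsum R p xs)

fracCost-wsum : ∀ {n} (G : Graph n) xs → fracCost G xs ≡ wsum xs (subgraphCost G)
fracCost-wsum G [] = refl
fracCost-wsum G ((H , x) ∷ xs) = cong (x *ℚ subgraphCost G H +ℚ_) (fracCost-wsum G xs)

-- Connectivity and integral feasibility.

Connects : ∀ {n} → (Fin n → Bool) → IntSol n → Set
Connects R Zs = ∀ q → All (λ H → Constant (termSet R H) q) Zs → Constant R q

Coarser : ∀ {n} → (Fin n → Fin n) → (Fin n → Fin n) → Set
Coarser p q = ∀ {x y} → p x ≡ p y → q x ≡ q y

coarser-merge : ∀ {n} (p q : Fin n → Fin n) s t → Coarser (merge (p s) (p t) p) q → Coarser p q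
coarser-merge p q s t co e = co (merge-coarsens (p s) (p t) p e)

hits-merge-≤ : ∀ {n} (p : Fin n → Fin n) S s t → p s ≢ p t → hits (merge (p s) (p t) p) S ≤ hits p S
hits-merge-≤ p S s t ne = subst (hits (merge (p s) (p t) p) S ≤_) (hits-merge p S (p s) (p t) ne) (ℕₚ.m≤m+n _ _)

hits-merge-both : ∀ {n} (p : Fin n → Fin n) S s t → p s ≢ p t → T (hit p S (p s)) → T (hit p S (p t)) →
  hits p S ≡ suc (hits (merge (p s) (p t) p) S)
hits-merge-both p S s t ne hs ht = trans (sym (hits-merge p S (p s) (p t) ne))
  (trans (cong (λ z → hits (merge (p s) (p t) p) S + bit z) (T⇒≡ (∧-intro hs ht))) (ℕₚ.+-comm _ 1))

intLHS-merge-≤ : ∀ {n} (R : Fin n → Bool) (p : Fin n → Fin n) s t ys → p s ≢ p t →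
  intLHS R (merge (p s) (p t) p) ys ≤ intLHS R p ys
intLHS-merge-≤ R p s t [] ne = z≤n
intLHS-merge-≤ R p s t (H ∷ ys) ne =
  ℕₚ.+-mono-≤ (ℕₚ.∸-monoˡ-≤ 1 (hits-merge-≤ p (termSet R H) s t ne)) (intLHS-merge-≤ R p s t ys ne)

-- As long as some component meets two parts, these are merged. This lowers the number of parts and
-- the rank contribution of that component by one each and raises no other contribution. A component
-- inside one part can be discarded, because the hypothesis only concerns labelings coarser than the
-- current `p`; at the end it says that one part is left.
connects⇒feasible : ∀ {n} (R : Fin n → Bool) ys → Connects R ys → ∀ p → numParts R p ∸ 1 ≤ intLHS R p ys
connects⇒feasible {n} R ys co p = all ys p λ q _ → co q
  where
  all : ∀ ys p → (∀ q → Coarser p q → All (λ H → Constant (termSet R H) q) ys → Constant R q) →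
    numParts R p ∸ 1 ≤ intLHS R p ys
  mergeAll : ∀ k H ys p → hits p (termSet R H) ≤ k →
    (∀ q → Coarser p q → All (λ H → Constant (termSet R H) q) (H ∷ ys) → Constant R q) →
    numParts R p ∸ 1 ≤ rc R p H + intLHS R p ys
  all [] p h = ℕₚ.∸-monoˡ-≤ 1 (constant⇒hits≤1 p R (h p (λ e → e) []))
  all (H ∷ ys) p h = mergeAll (hits p (termSet R H)) H ys p ℕₚ.≤-refl h
  mergeAll k H ys p le h with hits p (termSet R H) ℕₚ.≤? 1
  ... | yes h≤1 = ℕₚ.≤-trans
        (all ys p λ q co cs → h q co ((λ u v su sv → co (hits≤1⇒constant p _ h≤1 u v su sv)) ∷ cs))
        (ℕₚ.m≤n+m _ _)
  ... | no h≰1 with countFin-two⁻ (hit p (termSet R H)) (ℕₚ.≰⇒> h≰1)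
  ...   | i , j , ne , hi , hj with hit-elim p (termSet R H) i hi | hit-elim p (termSet R H) j hj
  mergeAll zero H ys p le h | no h≰1 | _ | _ | _ = ⊥-elim (h≰1 (ℕₚ.≤-trans le z≤n))
  mergeAll (suc k) H ys p le h | no h≰1 | i , j , ne , hi , hj | s , ss , refl | t , st , refl = begin
      numParts R p ∸ 1
        ≡⟨ cong (_∸ 1) eqR ⟩
      numParts R p′
        ≤⟨ ℕₚ.m≤n+m∸n (numParts R p′) 1 ⟩
      1 + (numParts R p′ ∸ 1)
        ≤⟨ s≤s (mergeAll k H ys p′ (ℕₚ.≤-pred (subst (_≤ suc k) eqS le)) λ q co cs → h q (coarser-merge p q s t co) cs) ⟩
      1 + ((hits p′ S ∸ 1) + intLHS R p′ ys)
        ≤⟨ s≤s (ℕₚ.+-monoʳ-≤ (hits p′ S ∸ 1) (intLHS-merge-≤ R p s t ys ne)) ⟩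
      1 + (hits p′ S ∸ 1) + intLHS R p ys
        ≡⟨ cong (_+ intLHS R p ys) (ℕₚ.m+[n∸m]≡n pos) ⟩
      hits p′ S + intLHS R p ys
        ≡⟨ cong (λ z → (z ∸ 1) + intLHS R p ys) (sym eqS) ⟩
      rc R p H + intLHS R p ys ∎
    where
    open ℕₚ.≤-Reasoning
    S = termSet R H
    p′ = merge (p s) (p t) p
    eqS : hits p S ≡ suc (hits p′ S)
    eqS = hits-merge-both p S s t ne hi hj
    eqR : numParts R p ≡ suc (numParts R p′)
    eqR = hits-merge-both p R s t ne (hit-intro p R s (∧-fst ss) refl) (hit-intro p R t (∧-fst st) refl)
    pos : 1 ≤ hits p′ S
    pos = countFin-pos (hit p′ S) (p′ s) (hit-intro p′ S s ss refl)

module Kruskal {n : ℕ} {A : Set} (src tgt : A → Fin n) (wt : A → ℚ) where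

  total : List A → ℚ
  total [] = 0ℚ
  total (e ∷ es) = wt e +ℚ total es

  -- A tag records whether an edge is kept; the selection below greedily drops the edges that
  -- become superfluous, Kruskal-style, once all of S is contracted.
  dropped : List (Bool × A) → ℚ
  dropped [] = 0ℚ
  dropped ((true , e) ∷ bs) = dropped bs
  dropped ((false , e) ∷ bs) = wt e +ℚ dropped bs

  ConstOn : (Fin n → Fin n) → List A → Set
  ConstOn q = All (λ e → q (src e) ≡ q (tgt e))

  ConstOnKept : (Fin n → Fin n) → List (Bool × A) → Set
  ConstOnKept q = All (λ b → T (proj₁ b) → q (src (proj₂ b)) ≡ q (tgt (proj₂ b)))

  joinBoth : (Fin n → Fin n) → (Fin n → Bool) → A → Bool
  joinBoth p S e = hit p S (p (src e)) ∧ hit p S (p (tgt e))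

  contract : (Fin n → Fin n) → A → Fin n → Fin n
  contract p e = merge (p (src e)) (p (tgt e)) p

  -- `p` is the partition generated by all edges seen so far, dropped ones included: it does not
  -- depend on `S`, so the runs for different `S` pass through the same partitions.
  select : (Fin n → Fin n) → (Fin n → Bool) → List A → List (Bool × A)
  select p S [] = []
  select p S (e ∷ es) with p (src e) ≟ p (tgt e)
  ... | yes _ = (false , e) ∷ select p S es
  ... | no _ = (not (joinBoth p S e) , e) ∷ select (contract p e) S es

  select-map : ∀ p S es → map proj₂ (select p S es) ≡ es
  select-map p S [] = refl
  select-map p S (e ∷ es) with p (src e) ≟ p (tgt e)
  ... | yes _ = cong (e ∷_) (select-map p S es)
  ... | no _ = cong (e ∷_) (select-map (contract p e) S es)

  -- A dropped edge either lies inside a part or joins two parts that both contain a vertex of `S`.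
  -- As `q` is constant on `S` and on the parts, it agrees at the two ends, and so stays coarser
  -- than the next partition.
  select-spans : ∀ p q S es → Coarser p q → Constant S q → ConstOnKept q (select p S es) → ConstOn q es
  select-spans p q S [] co cS [] = []
  select-spans p q S (e ∷ es) co cS cs with p (src e) ≟ p (tgt e)
  select-spans p q S (e ∷ es) co cS (_ ∷ cs) | yes eq = co eq ∷ select-spans p q S es co cS cs
  select-spans p q S (e ∷ es) co cS (c ∷ cs) | no _ =
    qe ∷ select-spans (contract p e) q S es (merge-universal (λ x y → q x ≡ q y) sym trans p (src e) (tgt e) co qe) cS cs
    where
    qe : q (src e) ≡ q (tgt e)
    qe with T? (joinBoth p S e)
    ... | yes b with u , su , eu ← hit-elim p S _ (∧-fst b)
                   | v , sv , ev ← hit-elim p S _ (∧-snd {hit p S (p (src e))} b) =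
          trans (sym (co eu)) (trans (cS u v su sv) (co ev))
    ... | no nb = c (not-intro nb)

  dropped-cons : ∀ b e bs → dropped ((not b , e) ∷ bs) ≡ wt e *ℚ ℕ→ℚ (bit b) +ℚ dropped bs
  dropped-cons true e bs = cong (_+ℚ dropped bs) (sym (ℚₚ.*-identityʳ (wt e)))
  dropped-cons false e bs = sym (trans (cong (_+ℚ dropped bs) (ℚₚ.*-zeroʳ (wt e))) (ℚₚ.+-identityˡ _))

  -- With the empty terminal set, exactly the edges that close a cycle with earlier ones are
  -- dropped.
  none : Fin n → Bool
  none _ = false

  none-unhit : ∀ p ℓ → hit p none ℓ ≡ false
  none-unhit p ℓ = ¬T⇒≡ λ t → proj₁ (proj₂ (hit-elim p none ℓ t))

  module _ (R : Fin n → Bool) (xs : FracSol n) (x≥0 : NonnegWeights xs)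
           (feasible : ∀ p → ℕ→ℚ (numParts R p ∸ 1) ≤ℚ fracLHS R p xs) where

    gains : (Fin n → Fin n) → List A → ℚ
    gains p es = wsum xs (λ H → dropped (select p (termSet R H) es))

    rcs : (Fin n → Fin n) → ℚ
    rcs p = wsum xs (λ H → ℕ→ℚ (rc R p H))

    -- The rank contribution of `H` falls by one exactly at those contractions where `select` drops
    -- the edge for `H`. This is what ties the dropped prices to the partition inequalities.
    rc-contract : ∀ p e H → p (src e) ≢ p (tgt e) →
      rc R p H ≡ bit (joinBoth p (termSet R H) e) + rc R (contract p e) H
    rc-contract p e H ne with T? (joinBoth p (termSet R H) e)
    ... | yes b = trans (cong (_∸ 1) (hits-merge-both p S (src e) (tgt e) ne hs ht))
                  (trans (sym (ℕₚ.m+[n∸m]≡n pos)) (cong (λ z → bit z + (hits p′ S ∸ 1)) (sym (T⇒≡ b))))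
      where
      S = termSet R H
      p′ = contract p e
      hs = ∧-fst b
      ht = ∧-snd {hit p S (p (src e))} b
      pos : 1 ≤ hits p′ S
      pos = let u , su , _ = hit-elim p S _ hs in countFin-pos (hit p′ S) (p′ u) (hit-intro p′ S u su refl)
    ... | no nb = trans (cong (_∸ 1) (trans (sym (hits-merge p S _ _ ne))
                     (trans (cong (λ z → hits p′ S + bit z) (¬T⇒≡ nb)) (ℕₚ.+-identityʳ _))))
                   (cong (λ z → bit z + (hits p′ S ∸ 1)) (sym (¬T⇒≡ nb)))
      where
      S = termSet R H
      p′ = contract p e

    -- Abel summation over the thresholds w₀ ≤ wt e₁ ≤ wt e₂ ≤ …, using feasibility for the
    -- partition reached at each threshold.
    total≤gains : ∀ w₀ p es → All (λ e → w₀ ≤ℚ wt e) es → AllPairs (λ e f → wt e ≤ℚ wt f) es →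
      All (λ e → 0ℚ ≤ℚ wt e) es → All (λ e → T (R (src e)) × T (R (tgt e))) es →
      (∀ q → Coarser p q → ConstOn q es → Constant R q) →
      total es +ℚ w₀ *ℚ rcs p ≤ℚ (gains p es +ℚ dropped (select p none es)) +ℚ w₀ *ℚ ℕ→ℚ (numParts R p ∸ 1)
    -- Without further edges `conn` leaves at most one part, so all ranks vanish on both sides.
    total≤gains w₀ p [] _ _ _ _ conn = ℚₚ.≤-reflexive (begin
        0ℚ +ℚ w₀ *ℚ rcs p ≡⟨ cong (λ z → 0ℚ +ℚ w₀ *ℚ z) (wsum-zero xs λ H → cong ℕ→ℚ (rc0 H)) ⟩
        0ℚ +ℚ w₀ *ℚ 0ℚ ≡⟨ cong₂ (λ y z → y +ℚ w₀ *ℚ z)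
                            (sym (trans (cong (_+ℚ 0ℚ) (wsum-zero xs λ H → refl)) (ℚₚ.+-identityˡ 0ℚ)))
                            (cong ℕ→ℚ (sym (ℕₚ.m≤n⇒m∸n≡0 h≤1))) ⟩
        (gains p [] +ℚ 0ℚ) +ℚ w₀ *ℚ ℕ→ℚ (numParts R p ∸ 1) ∎)
      where
      open ≡-Reasoning
      h≤1 : numParts R p ≤ 1
      h≤1 = constant⇒hits≤1 p R (conn p (λ e → e) [])
      rc0 : ∀ H → rc R p H ≡ 0
      rc0 H = ℕₚ.m≤n⇒m∸n≡0 (ℕₚ.≤-trans (hits-mono p (termSet R H) R (λ u → ∧-fst)) h≤1)
    total≤gains w₀ p (e ∷ es) (le ∷ les) (ord ∷ ords) (nn ∷ nns) ((rs , rt) ∷ rst) conn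
      with p (src e) ≟ p (tgt e)
    -- An edge inside a part is charged to the `none` term. The gains drop it as well, and so only
    -- grow.
    ... | yes eq = begin
        (wt e +ℚ total es) +ℚ w₀ *ℚ rcs p
          ≡⟨ ℚₚ.+-assoc (wt e) (total es) _ ⟩
        wt e +ℚ (total es +ℚ w₀ *ℚ rcs p)
          ≤⟨ ℚₚ.+-monoʳ-≤ (wt e) (total≤gains w₀ p es les ords nns rst (λ q co cs → conn q co (co eq ∷ cs))) ⟩
        wt e +ℚ ((gains p es +ℚ U) +ℚ N)
          ≤⟨ ℚₚ.+-monoʳ-≤ (wt e) (ℚₚ.+-monoˡ-≤ N (ℚₚ.+-monoˡ-≤ U (wsum-mono xs x≥0 λ H → grow (dropped (select p (termSet R H) es))))) ⟩
        wt e +ℚ ((g′ +ℚ U) +ℚ N)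
          ≡⟨ lemma (wt e) g′ U N ⟩
        (g′ +ℚ (wt e +ℚ U)) +ℚ N ∎
      where
      open ℚₚ.≤-Reasoning
      U = dropped (select p none es)
      N = w₀ *ℚ ℕ→ℚ (numParts R p ∸ 1)
      g′ = wsum xs (λ H → wt e +ℚ dropped (select p (termSet R H) es))
      grow : ∀ d → d ≤ℚ wt e +ℚ d
      grow d = subst (_≤ℚ wt e +ℚ d) (ℚₚ.+-identityˡ d) (ℚₚ.+-monoˡ-≤ d nn)
      lemma : ∀ w g U N → w +ℚ ((g +ℚ U) +ℚ N) ≡ (g +ℚ (w +ℚ U)) +ℚ N
      lemma = solve-∀ ℚ-ring
    -- The difference of the two sides is the slack of the induction hypothesis, taken at the new
    -- threshold `wt e`, plus `wt e - w₀` times the slack of the partition inequality of `p`.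
    ... | no ne = certify (0≤+ (≤⇒0≤- IH) (0≤* (≤⇒0≤- le) (≤⇒0≤- feasible′))) eq
      where
      p′ = contract p e
      B = wsum xs (λ H → ℕ→ℚ (bit (joinBoth p (termSet R H) e)))
      U = dropped (select p′ none es)
      N′ = ℕ→ℚ (numParts R p′ ∸ 1)
      IH : total es +ℚ wt e *ℚ rcs p′ ≤ℚ (gains p′ es +ℚ U) +ℚ wt e *ℚ N′
      IH = total≤gains (wt e) p′ es ord ords nns rst λ q co cs →
             conn q (coarser-merge p q (src e) (tgt e) co) (co (merge-joins p (src e) (tgt e)) ∷ cs)
      rcs≡ : rcs p ≡ B +ℚ rcs p′
      rcs≡ = trans (wsum-cong xs λ H → trans (cong ℕ→ℚ (rc-contract p e H ne)) (ℕ→ℚ-+ (bit (joinBoth p (termSet R H) e)) (rc R p′ H)))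
                   (wsum-+ xs _ _)
      N≡ : ℕ→ℚ (numParts R p ∸ 1) ≡ 1ℚ +ℚ N′
      N≡ = trans (cong ℕ→ℚ (trans (cong (_∸ 1) (hits-merge-both p R (src e) (tgt e) ne
                     (hit-intro p R (src e) rs refl) (hit-intro p R (tgt e) rt refl))) (sym (ℕₚ.m+[n∸m]≡n pos))))
                 (ℕ→ℚ-+ 1 (numParts R p′ ∸ 1))
        where
        pos : 1 ≤ numParts R p′
        pos = countFin-pos (hit p′ R) (p′ (src e)) (hit-intro p′ R (src e) rs refl)
      feasible′ : 1ℚ +ℚ N′ ≤ℚ B +ℚ rcs p′
      feasible′ = subst₂ _≤ℚ_ N≡ (trans (fracLHS-wsum R p xs) rcs≡) (feasible p)
      gains≡ : wsum xs (λ H → dropped ((not (joinBoth p (termSet R H) e) , e) ∷ select p′ (termSet R H) es)) ≡ wt e *ℚ B +ℚ gains p′ es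
      gains≡ = trans (wsum-cong xs λ H → dropped-cons (joinBoth p (termSet R H) e) e (select p′ (termSet R H) es))
                     (trans (wsum-+ xs _ _) (cong (_+ℚ gains p′ es) (wsum-scale xs (wt e) _)))
      U≡ : dropped ((not (joinBoth p none e) , e) ∷ select p′ none es) ≡ U
      U≡ rewrite none-unhit p (p (src e)) = refl
      lemma : ∀ w w₀ B r N g U t →
        ((w *ℚ B +ℚ g +ℚ U) +ℚ w₀ *ℚ (1ℚ +ℚ N)) -ℚ ((w +ℚ t) +ℚ w₀ *ℚ (B +ℚ r)) ≡
        (((g +ℚ U) +ℚ w *ℚ N) -ℚ (t +ℚ w *ℚ r)) +ℚ (w -ℚ w₀) *ℚ ((B +ℚ r) -ℚ (1ℚ +ℚ N))
      lemma = solve-∀ ℚ-ring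
      eq : _ ≡ _
      eq = trans (cong₂ _-ℚ_ (cong₂ _+ℚ_ (cong₂ _+ℚ_ gains≡ U≡) (cong (w₀ *ℚ_) N≡)) (cong (λ z → (wt e +ℚ total es) +ℚ w₀ *ℚ z) rcs≡))
             (lemma (wt e) w₀ B (rcs p′) N′ (gains p′ es) U (total es))

-- Walks, connected components and deletion of vertices.

module _ {n : ℕ} where

  infix 4 _⊑_
  _⊑_ : Subgraph n → Subgraph n → Set
  A ⊑ B = ∀ x y → T (A x y) → T (B x y)

  Symm : Subgraph n → Set
  Symm H = ∀ u v → H u v ≡ H v u

  flip : ∀ {H : Subgraph n} → Symm H → ∀ {u v} → T (H u v) → T (H v u)
  flip sy {u} {v} = subst T (sy u v)

  infixr 5 _⊕_
  _⊕_ : ∀ {H : Subgraph n} {u v w} → Walk H u v → Walk H v w → Walk H u w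
  nil ⊕ Q = Q
  cons e P ⊕ Q = cons e (P ⊕ Q)

  reverse : ∀ {H : Subgraph n} → Symm H → ∀ {u v} → Walk H u v → Walk H v u
  reverse sy nil = nil
  reverse sy (cons e P) = reverse sy P ⊕ cons (flip sy e) nil

  walk-map : ∀ {A B : Subgraph n} → A ⊑ B → ∀ {u v} → Walk A u v → Walk B u v
  walk-map h nil = nil
  walk-map h (cons e P) = cons (h _ _ e) (walk-map h P)

  cycle-map : ∀ {A B : Subgraph n} → A ⊑ B → Cycle A → Cycle B
  cycle-map h (a , ys , l , u , lk) = a , ys , l , u , Linked.map (h _ _) lk

  deg-mono : ∀ {A B : Subgraph n} → A ⊑ B → ∀ u → deg A u ≤ deg B u
  deg-mono h u = countFin-mono _ _ (h u)

  deg1-unique : ∀ {H : Subgraph n} {u v w} → deg H u ≡ 1 → T (H u v) → T (H u w) → v ≡ w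
  deg1-unique {H} {u} {v} {w} d hv hw with v ≟ w
  ... | yes e = e
  ... | no ne = ⊥-elim (ℕₚ.<-irrefl (sym d) (countFin-two (H u) v w ne hv hw))

  mergeEdges : Subgraph n → List (Fin n × Fin n) → (Fin n → Fin n) → Fin n → Fin n
  mergeEdges H [] p = p
  mergeEdges H ((u , v) ∷ es) p = mergeEdges H es (if H u v then merge (p u) (p v) p else p)

  -- Merging along every edge makes the components the classes of a labeling; reachability becomes
  -- decidable, and a component can be split off by comparing labels.
  component : Subgraph n → Fin n → Fin n
  component H = mergeEdges H (cartesianProduct (allFin n) (allFin n)) id

  component-sound : ∀ {H} → Symm H → ∀ {u v} → component H u ≡ component H v → Walk H u v
  component-sound {H} sy = go (cartesianProduct (allFin n) (allFin n)) id λ { refl → nil }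
    where
    go : ∀ es p → (∀ {x y} → p x ≡ p y → Walk H x y) → ∀ {x y} → mergeEdges H es p x ≡ mergeEdges H es p y → Walk H x y
    go [] p h e = h e
    go ((u , v) ∷ es) p h e with H u v in eq
    ... | true = go es _ (merge-universal (Walk H) (reverse sy) _⊕_ p u v h (cons (subst T (sym eq) tt) nil)) e
    ... | false = go es p h e

  component-edge : ∀ H {u v} → T (H u v) → component H u ≡ component H v
  component-edge H {u} {v} huv = go (cartesianProduct (allFin n) (allFin n)) id (∈-cartesianProduct⁺ (∈-allFin u) (∈-allFin v))
    where
    coarse : ∀ es p {x y} → p x ≡ p y → mergeEdges H es p x ≡ mergeEdges H es p y
    coarse [] p e = e
    coarse ((a , b) ∷ es) p e with H a b
    ... | true = coarse es _ (merge-coarsens (p a) (p b) p e)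
    ... | false = coarse es p e
    go : ∀ es p → (u , v) ∈ es → mergeEdges H es p u ≡ mergeEdges H es p v
    go ((a , b) ∷ es) p (here refl) rewrite T⇒≡ huv = coarse es _ (merge-joins p u v)
    go ((a , b) ∷ es) p (there m) = go es _ m

  component-complete : ∀ H {u v} → Walk H u v → component H u ≡ component H v
  component-complete H nil = refl
  component-complete H (cons e P) = trans (component-edge H e) (component-complete H P)

  walk? : ∀ {H} → Symm H → ∀ u v → Dec (Walk H u v)
  walk? {H} sy u v with component H u ≟ component H v
  ... | yes e = yes (component-sound sy e)
  ... | no ne = no λ P → ne (component-complete H P)

  delete : Fin n → Subgraph n → Subgraph n
  delete v H x y = H x y ∧ (not (does (x ≟ v)) ∧ not (does (y ≟ v)))

  delete-intro : ∀ {H v x y} → T (H x y) → x ≢ v → y ≢ v → T (delete v H x y)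
  delete-intro {H} {v} {x} {y} h nx ny =
    ∧-intro h (∧-intro (not-intro λ d → nx (does-elim (x ≟ v) d)) (not-intro λ d → ny (does-elim (y ≟ v) d)))

  delete-⊑ : ∀ {H v} → delete v H ⊑ H
  delete-⊑ x y = ∧-fst

  delete-≢ˡ : ∀ {H v x y} → T (delete v H x y) → x ≢ v
  delete-≢ˡ {H} {v} {x} {y} t e = not-elim (∧-fst (∧-snd {H x y} t)) (does-intro (x ≟ v) e)

  delete-≢ʳ : ∀ {H v x y} → T (delete v H x y) → y ≢ v
  delete-≢ʳ {H} {v} {x} {y} t e = not-elim (∧-snd {not (does (x ≟ v))} (∧-snd {H x y} t)) (does-intro (y ≟ v) e)

  delete-symm : ∀ {H v} → Symm H → Symm (delete v H)
  delete-symm {H} {v} sy x y = T-ext (sw x y) (sw y x)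
    where
    sw : ∀ x y → T (delete v H x y) → T (delete v H y x)
    sw x y t = delete-intro {H} (flip sy (delete-⊑ {H} {v} x y t)) (delete-≢ʳ {H} {v} {x} {y} t) (delete-≢ˡ {H} {v} {x} {y} t)

  -- A pendant vertex v is folded onto its only neighbour w.
  delete-walk : ∀ {H v w} → Symm H → (∀ z → T (H v z) → z ≡ w) → ∀ {s t} → Walk H s t →
    Walk (delete v H) (merge v w id s) (merge v w id t)
  delete-walk sy h nil = nil
  delete-walk {H} {v} {w} sy h (cons {s} {x} e P) with s ≟ v
  ... | yes refl = subst (λ z → Walk (delete v H) z _) fold (delete-walk sy h P)
    where
    fold : merge v w id x ≡ w
    fold with x ≟ v
    ... | yes _ = refl
    ... | no _ = h x e
  ... | no ne with x ≟ v | delete-walk sy h P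
  ...   | yes refl | Q = subst (λ z → Walk (delete v H) z _) (sym (h s (flip sy e))) Q
  ...   | no nx | Q = cons (delete-intro {H} e ne nx) Q

  walk⇒deg : ∀ {H : Subgraph n} {s t} → s ≢ t → Walk H s t → 1 ≤ deg H s
  walk⇒deg ne nil = ⊥-elim (ne refl)
  walk⇒deg {H} ne (cons {s} {x} e P) = countFin-pos (H s) x e

  -- The vertex set of a subgraph is implicit. Its size, the number of non-isolated vertices, is the
  -- measure for the recursions on subgraphs below.
  order : Subgraph n → ℕ
  order H = countFin (λ u → 0 <ᵇ deg H u)

  order-strict : ∀ {A B : Subgraph n} → A ⊑ B → ∀ u → 1 ≤ deg B u → ¬ (1 ≤ deg A u) → order A < order B
  order-strict h u p q = countFin-strict _ _ u (λ j t → T-<ᵇ (ℕₚ.≤-trans (T-<ᵇ⁻ t) (deg-mono h j))) (T-<ᵇ p) λ t → q (T-<ᵇ⁻ t)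

-- Costs of subgraphs and of edge lists.

sumFin-mono : ∀ {n} {f g : Fin n → ℚ} → (∀ i → f i ≤ℚ g i) → sumFin f ≤ℚ sumFin g
sumFin-mono {zero} h = ℚₚ.≤-refl
sumFin-mono {suc n} h = ℚₚ.+-mono-≤ (h zero) (sumFin-mono λ i → h (suc i))

sumFin-cong : ∀ {n} {f g : Fin n → ℚ} → (∀ i → f i ≡ g i) → sumFin f ≡ sumFin g
sumFin-cong {zero} h = refl
sumFin-cong {suc n} h = cong₂ _+ℚ_ (h zero) (sumFin-cong λ i → h (suc i))

sumFin-+ : ∀ {n} (f g : Fin n → ℚ) → sumFin (λ i → f i +ℚ g i) ≡ sumFin f +ℚ sumFin g
sumFin-+ {zero} f g = refl
sumFin-+ {suc n} f g rewrite sumFin-+ (λ i → f (suc i)) (λ i → g (suc i)) =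
  lemma (f zero) (g zero) (sumFin λ i → f (suc i)) (sumFin λ i → g (suc i))
  where
  lemma : ∀ a b c d → (a +ℚ b) +ℚ (c +ℚ d) ≡ (a +ℚ c) +ℚ (b +ℚ d)
  lemma = solve-∀ ℚ-ring

sumFin-zero : ∀ {n} (f : Fin n → ℚ) → (∀ i → f i ≡ 0ℚ) → sumFin f ≡ 0ℚ
sumFin-zero {zero} f h = refl
sumFin-zero {suc n} f h = cong₂ _+ℚ_ (h zero) (sumFin-zero (λ i → f (suc i)) λ i → h (suc i))

sumFin-single : ∀ {n} (f : Fin n → ℚ) a → (∀ i → i ≢ a → f i ≡ 0ℚ) → sumFin f ≡ f a
sumFin-single f zero h = trans (cong (f zero +ℚ_) (sumFin-zero (λ i → f (suc i)) λ i → h (suc i) λ ())) (ℚₚ.+-identityʳ _)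
sumFin-single f (suc a) h = trans (cong₂ _+ℚ_ (h zero λ ()) (sumFin-single (λ i → f (suc i)) a λ i ne → h (suc i) λ { refl → ne refl })) (ℚₚ.+-identityˡ _)

module Costs {n : ℕ} (G : Graph n) where

  cost : Subgraph n → ℚ
  cost = subgraphCost G

  pairCost : Subgraph n → Fin n → Fin n → ℚ
  pairCost H u v = if H u v ∧ (toℕ u <ᵇ toℕ v) then c G u v else 0ℚ

  pair-nonneg : ∀ {H} → H ⊑ adj G → ∀ u v → 0ℚ ≤ℚ pairCost H u v
  pair-nonneg {H} h u v with H u v in eq | toℕ u <ᵇ toℕ v
  ... | true | true = c-nonneg G u v (h u v (subst T (sym eq) tt))
  ... | true | false = ℚₚ.≤-refl
  ... | false | _ = ℚₚ.≤-refl

  cost-split : ∀ {A B H} → H ⊑ adj G → A ⊑ H → B ⊑ H → (∀ x y → T (A x y) → T (B x y) → ⊥) → cost A +ℚ cost B ≤ℚ cost H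
  cost-split {A} {B} {H} hG hA hB dis = subst (_≤ℚ cost H)
      (trans (sumFin-cong λ u → sumFin-+ (pairCost A u) (pairCost B u)) (sumFin-+ (λ u → sumFin (pairCost A u)) (λ u → sumFin (pairCost B u))))
      (sumFin-mono λ u → sumFin-mono λ v → pw u v)
    where
    pw : ∀ u v → pairCost A u v +ℚ pairCost B u v ≤ℚ pairCost H u v
    pw u v with A u v in ea | B u v in eb | H u v in eh | toℕ u <ᵇ toℕ v
    ... | true | true | _ | _ = ⊥-elim (dis u v (subst T (sym ea) tt) (subst T (sym eb) tt))
    ... | true | false | true | true = ℚₚ.≤-reflexive (ℚₚ.+-identityʳ _)
    ... | true | false | true | false = ℚₚ.≤-refl
    ... | true | false | false | _ = ⊥-elim (subst T eh (hA u v (subst T (sym ea) tt)))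
    ... | false | true | true | true = ℚₚ.≤-reflexive (ℚₚ.+-identityˡ _)
    ... | false | true | true | false = ℚₚ.≤-refl
    ... | false | true | false | _ = ⊥-elim (subst T eh (hB u v (subst T (sym eb) tt)))
    ... | false | false | true | true = c-nonneg G u v (hG u v (subst T (sym eh) tt))
    ... | false | false | true | false = ℚₚ.≤-refl
    ... | false | false | false | _ = ℚₚ.≤-refl

  cost-nonneg : ∀ {H} → H ⊑ adj G → 0ℚ ≤ℚ cost H
  cost-nonneg {H} h = subst (_≤ℚ cost H) (sumFin-zero {n} (λ _ → sumFin {n} λ _ → 0ℚ) λ _ → sumFin-zero {n} (λ _ → 0ℚ) λ _ → refl)
    (sumFin-mono λ u → sumFin-mono λ v → pair-nonneg h u v)

  cost-mono : ∀ {A H} → H ⊑ adj G → A ⊑ H → cost A ≤ℚ cost H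
  cost-mono {A} {H} hG h = sumFin-mono λ u → sumFin-mono λ v → pw u v
    where
    pw : ∀ u v → pairCost A u v ≤ℚ pairCost H u v
    pw u v with A u v in ea | H u v in eh | toℕ u <ᵇ toℕ v
    ... | true | true | _ = ℚₚ.≤-refl
    ... | true | false | _ = ⊥-elim (subst T eh (h u v (subst T (sym ea) tt)))
    ... | false | true | true = c-nonneg G u v (hG u v (subst T (sym eh) tt))
    ... | false | true | false = ℚₚ.≤-refl
    ... | false | false | _ = ℚₚ.≤-refl

  singlePair : Fin n → Fin n → Fin n → Fin n → ℚ
  singlePair u v x y = if does (x ≟ u) ∧ does (y ≟ v) then c G u v else 0ℚ

  singlePair-on : ∀ u v → singlePair u v u v ≡ c G u v
  singlePair-on u v rewrite dec-true (u ≟ u) refl | dec-true (v ≟ v) refl = refl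

  sum-singlePair : ∀ u v → sumFin (λ x → sumFin (singlePair u v x)) ≡ c G u v
  sum-singlePair u v = trans (sumFin-single (λ x → sumFin (singlePair u v x)) u λ x ne → sumFin-zero (singlePair u v x) λ y → off {x} {y} ne)
      (trans (sumFin-single (singlePair u v u) v λ y ne → off′ {y} ne) (singlePair-on u v))
    where
    off : ∀ {x y} → x ≢ u → singlePair u v x y ≡ 0ℚ
    off {x} ne rewrite dec-false (x ≟ u) ne = refl
    off′ : ∀ {y} → y ≢ v → singlePair u v u y ≡ 0ℚ
    off′ {y} ne rewrite dec-true (u ≟ u) refl | dec-false (y ≟ v) ne = refl

  -- `subgraphCost` counts an edge only in its increasing orientation, so that orientation is
  -- treated first and the other is reduced to it.
  cost-insert< : ∀ {A H} u v → toℕ u < toℕ v → A ⊑ adj G → T (adj G u v) →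
    (∀ x y → T (H x y) → T (A x y) ⊎ ((x ≡ u × y ≡ v) ⊎ (x ≡ v × y ≡ u))) → cost H ≤ℚ c G u v +ℚ cost A
  cost-insert< {A} {H} u v lt hA uv h = begin
      cost H
        ≤⟨ sumFin-mono (λ x → sumFin-mono (pw x)) ⟩
      sumFin (λ x → sumFin (λ y → δ x y +ℚ pairCost A x y))
        ≡⟨ sumFin-cong (λ x → sumFin-+ (δ x) (pairCost A x)) ⟩
      sumFin (λ x → sumFin (δ x) +ℚ sumFin (pairCost A x))
        ≡⟨ sumFin-+ (λ x → sumFin (δ x)) (λ x → sumFin (pairCost A x)) ⟩
      sumFin (λ x → sumFin (δ x)) +ℚ cost A
        ≡⟨ cong (_+ℚ cost A) (sum-singlePair u v) ⟩
      c G u v +ℚ cost A ∎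
    where
    open ℚₚ.≤-Reasoning
    δ = singlePair u v
    δ≥0 : ∀ x y → 0ℚ ≤ℚ δ x y
    δ≥0 x y with does (x ≟ u) ∧ does (y ≟ v)
    ... | true = c-nonneg G u v uv
    ... | false = ℚₚ.≤-refl
    pw : ∀ x y → pairCost H x y ≤ℚ δ x y +ℚ pairCost A x y
    pw x y with T? (H x y ∧ (toℕ x <ᵇ toℕ y))
    ... | no nt rewrite ¬T⇒≡ nt = 0≤+ (δ≥0 x y) (pair-nonneg hA x y)
    ... | yes t with h x y (∧-fst t)
    ...   | inj₁ a rewrite T⇒≡ t | T⇒≡ (∧-intro a (∧-snd {H x y} t)) =
            ℚₚ.≤-trans (ℚₚ.≤-reflexive (sym (ℚₚ.+-identityˡ _))) (ℚₚ.+-monoˡ-≤ (c G x y) (δ≥0 x y))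
    ...   | inj₂ (inj₁ (refl , refl)) rewrite T⇒≡ t =
            ℚₚ.≤-trans (ℚₚ.≤-reflexive (trans (sym (singlePair-on u v)) (sym (ℚₚ.+-identityʳ _)))) (ℚₚ.+-monoʳ-≤ (δ u v) (pair-nonneg hA u v))
    ...   | inj₂ (inj₂ (refl , refl)) = ⊥-elim (ℕₚ.<-asym lt (ℕₚ.<ᵇ⇒< (toℕ v) (toℕ u) (∧-snd {H x y} t)))

  cost-insert : ∀ {A H} u v → A ⊑ adj G → T (adj G u v) →
    (∀ x y → T (H x y) → T (A x y) ⊎ ((x ≡ u × y ≡ v) ⊎ (x ≡ v × y ≡ u))) → cost H ≤ℚ c G u v +ℚ cost A
  cost-insert {A} {H} u v hA uv h with ℕₚ.<-cmp (toℕ u) (toℕ v)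
  ... | tri≈ _ e _ = ⊥-elim (subst T (trans (cong (adj G u) (sym (Finₚ.toℕ-injective e))) (adj-irrefl G u)) uv)
  ... | tri< lt _ _ = cost-insert< u v lt hA uv h
  ... | tri> _ _ gt = subst (λ z → cost H ≤ℚ z +ℚ cost A) (c-sym G v u vu) (cost-insert< v u gt hA vu λ x y t → swap₂ (h x y t))
    where
    vu = subst T (adj-sym G u v) uv
    swap₂ : ∀ {P Q S : Set} → P ⊎ (Q ⊎ S) → P ⊎ (S ⊎ Q)
    swap₂ (inj₁ p) = inj₁ p
    swap₂ (inj₂ (inj₁ q)) = inj₂ (inj₂ q)
    swap₂ (inj₂ (inj₂ s)) = inj₂ (inj₁ s)

  cost-extract< : ∀ {A H} u v → toℕ u < toℕ v → H ⊑ adj G → A ⊑ H → T (H u v) → ¬ T (A u v) → c G u v +ℚ cost A ≤ℚ cost H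
  cost-extract< {A} {H} u v lt hG hA uv nuv = begin
      c G u v +ℚ cost A
        ≡⟨ cong (_+ℚ cost A) (sym (sum-singlePair u v)) ⟩
      sumFin (λ x → sumFin (δ x)) +ℚ cost A
        ≡⟨ sym (sumFin-+ (λ x → sumFin (δ x)) (λ x → sumFin (pairCost A x))) ⟩
      sumFin (λ x → sumFin (δ x) +ℚ sumFin (pairCost A x))
        ≡⟨ sumFin-cong (λ x → sym (sumFin-+ (δ x) (pairCost A x))) ⟩
      sumFin (λ x → sumFin (λ y → δ x y +ℚ pairCost A x y))
        ≤⟨ sumFin-mono (λ x → sumFin-mono (pw x)) ⟩
      cost H ∎
    where
    open ℚₚ.≤-Reasoning
    δ = singlePair u v
    smaller : ∀ x y → pairCost A x y ≤ℚ pairCost H x y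
    smaller x y with T? (A x y ∧ (toℕ x <ᵇ toℕ y))
    ... | no nt rewrite ¬T⇒≡ nt = pair-nonneg hG x y
    ... | yes t rewrite T⇒≡ t | T⇒≡ (∧-intro (hA x y (∧-fst t)) (∧-snd {A x y} t)) = ℚₚ.≤-refl
    pw : ∀ x y → δ x y +ℚ pairCost A x y ≤ℚ pairCost H x y
    pw x y with x ≟ u | y ≟ v
    ... | yes refl | yes refl rewrite ¬T⇒≡ nuv | T⇒≡ uv | T⇒≡ (ℕₚ.<⇒<ᵇ lt) = ℚₚ.≤-reflexive (ℚₚ.+-identityʳ _)
    ... | yes refl | no _ = ℚₚ.≤-trans (ℚₚ.≤-reflexive (ℚₚ.+-identityˡ _)) (smaller x y)
    ... | no _ | _ = ℚₚ.≤-trans (ℚₚ.≤-reflexive (ℚₚ.+-identityˡ _)) (smaller x y)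

  cost-extract : ∀ {A H} u v → Symm H → H ⊑ adj G → A ⊑ H → T (H u v) → ¬ T (A u v) → ¬ T (A v u) → c G u v +ℚ cost A ≤ℚ cost H
  cost-extract {A} {H} u v sy hG hA uv nuv nvu with ℕₚ.<-cmp (toℕ u) (toℕ v)
  ... | tri≈ _ e _ = ⊥-elim (subst T (trans (cong (adj G u) (sym (Finₚ.toℕ-injective e))) (adj-irrefl G u)) (hG u v uv))
  ... | tri< lt _ _ = cost-extract< u v lt hG hA uv nuv
  ... | tri> _ _ gt = subst (λ z → z +ℚ cost A ≤ℚ cost H) (sym (c-sym G u v (hG u v uv))) (cost-extract< v u gt hG hA (flip sy uv) nvu)

  edgeCost : List (Fin n × Fin n) → ℚ
  edgeCost [] = 0ℚ
  edgeCost ((u , v) ∷ es) = c G u v +ℚ edgeCost es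

  edgeCost-++ : ∀ es fs → edgeCost (es ++ fs) ≡ edgeCost es +ℚ edgeCost fs
  edgeCost-++ [] fs = sym (ℚₚ.+-identityˡ _)
  edgeCost-++ ((u , v) ∷ es) fs = trans (cong (c G u v +ℚ_) (edgeCost-++ es fs)) (sym (ℚₚ.+-assoc (c G u v) _ _))

  edgeCost-↭ : ∀ {es fs} → es ↭ fs → edgeCost es ≡ edgeCost fs
  edgeCost-↭ _↭_.refl = refl
  edgeCost-↭ (prep (u , v) p) = cong (c G u v +ℚ_) (edgeCost-↭ p)
  edgeCost-↭ (swap {xs = es} {ys = fs} (u , v) (x , y) p) = trans (cong (λ z → c G u v +ℚ (c G x y +ℚ z)) (edgeCost-↭ p)) (lemma (c G u v) (c G x y) (edgeCost fs))
    where
    lemma : ∀ a b d → a +ℚ (b +ℚ d) ≡ b +ℚ (a +ℚ d)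
    lemma = solve-∀ ℚ-ring
  edgeCost-↭ (_↭_.trans p q) = trans (edgeCost-↭ p) (edgeCost-↭ q)

  fromEdges : List (Fin n × Fin n) → Subgraph n
  fromEdges [] x y = false
  fromEdges ((u , v) ∷ es) x y = fromEdges es x y ∨ ((does (x ≟ u) ∧ does (y ≟ v)) ∨ (does (x ≟ v) ∧ does (y ≟ u)))

  fromEdges-elim : ∀ u v es x y → T (fromEdges ((u , v) ∷ es) x y) → T (fromEdges es x y) ⊎ ((x ≡ u × y ≡ v) ⊎ (x ≡ v × y ≡ u))
  fromEdges-elim u v es x y t with ∨-elim {fromEdges es x y} t
  ... | inj₁ a = inj₁ a
  ... | inj₂ b with ∨-elim {does (x ≟ u) ∧ does (y ≟ v)} b
  ...   | inj₁ d = inj₂ (inj₁ (does-elim (x ≟ u) (∧-fst d) , does-elim (y ≟ v) (∧-snd {does (x ≟ u)} d)))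
  ...   | inj₂ d = inj₂ (inj₂ (does-elim (x ≟ v) (∧-fst d) , does-elim (y ≟ u) (∧-snd {does (x ≟ v)} d)))

  fromEdges-intro : ∀ es {u v} → (u , v) ∈ es → T (fromEdges es u v) × T (fromEdges es v u)
  fromEdges-intro ((u , v) ∷ es) (here refl) =
    ∨-right {fromEdges es u v} (∨-left (∧-intro (does-intro (u ≟ u) refl) (does-intro (v ≟ v) refl))) ,
    ∨-right {fromEdges es v u} (∨-right {does (v ≟ u) ∧ does (u ≟ v)} (∧-intro (does-intro (v ≟ v) refl) (does-intro (u ≟ u) refl)))
  fromEdges-intro (_ ∷ es) (there i) = let a , b = fromEdges-intro es i in ∨-left a , ∨-left b

  fromEdges-⊑ : ∀ {H : Subgraph n} → Symm H → ∀ es → All (λ e → T (H (proj₁ e) (proj₂ e))) es → fromEdges es ⊑ H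
  fromEdges-⊑ sy ((u , v) ∷ es) (t ∷ ts) x y a with fromEdges-elim u v es x y a
  ... | inj₁ b = fromEdges-⊑ sy es ts x y b
  ... | inj₂ (inj₁ (refl , refl)) = t
  ... | inj₂ (inj₂ (refl , refl)) = flip sy t

  fromEdges-symm : ∀ es → Symm (fromEdges es)
  fromEdges-symm es x y = T-ext (sw es x y) (sw es y x)
    where
    sw : ∀ es x y → T (fromEdges es x y) → T (fromEdges es y x)
    sw ((u , v) ∷ es) x y t with fromEdges-elim u v es x y t
    ... | inj₁ b = ∨-left (sw es x y b)
    ... | inj₂ (inj₁ (refl , refl)) = proj₂ (fromEdges-intro ((u , v) ∷ es) (here refl))
    ... | inj₂ (inj₂ (refl , refl)) = proj₁ (fromEdges-intro ((u , v) ∷ es) (here refl))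

  -- The list may repeat an edge in either orientation, while the subgraph pays for it once.
  fromEdges-cost : ∀ es → All (λ e → T (adj G (proj₁ e) (proj₂ e))) es → cost (fromEdges es) ≤ℚ edgeCost es
  fromEdges-cost [] [] = ℚₚ.≤-reflexive (sumFin-zero {n} (λ _ → sumFin {n} λ _ → 0ℚ) λ _ → sumFin-zero {n} (λ _ → 0ℚ) λ _ → refl)
  fromEdges-cost ((u , v) ∷ es) (t ∷ ts) =
    ℚₚ.≤-trans (cost-insert u v (fromEdges-⊑ (adj-sym G) es ts) t (fromEdges-elim u v es))
      (ℚₚ.+-monoʳ-≤ (c G u v) (fromEdges-cost es ts))

-- Cutting part of a full component into full components.

module Pieces {n : ℕ} (G : Graph n) (R : Fin n → Bool) where
  open Costs G

  -- `InKr` without cost minimality, a property that the pieces left after a deletion need not have.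
  FullR : ℕ → Subgraph n → Set
  FullR r H = IsFullComponent G R H × 2 ≤ countFin (termSet R H) × countFin (termSet R H) ≤ r

  Ties : IntSol n → (Fin n → Fin n) → Set
  Ties Zs q = All (λ Z → Constant (termSet R Z) q) Zs

  module _ (r : ℕ) (H : Subgraph n) (full : IsFullComponent G R H) (size : countFin (termSet R H) ≤ r) where

    HG : H ⊑ adj G
    HG = proj₁ (proj₁ full)

    terminal-intro : ∀ {A : Subgraph n} u → T (R u) → 1 ≤ deg A u → T (termSet R A u)
    terminal-intro u ru d = ∧-intro ru (T-<ᵇ d)

    termSet-mono : ∀ {A B : Subgraph n} → A ⊑ B → ∀ u → T (termSet R A u) → T (termSet R B u)
    termSet-mono {A} h u t = ∧-intro (∧-fst t) (T-<ᵇ (ℕₚ.≤-trans (T-<ᵇ⁻ (∧-snd {R u} t)) (deg-mono h u)))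

    -- Prune Steiner leaves; once there are none, every component is a full component.
    decompose : ∀ k H′ → H′ ⊑ H → Symm H′ → order H′ ≤ k → ∃ λ Zs →
      All (FullR r) Zs × intCost G Zs ≤ℚ cost H′ ×
      (∀ q → Ties Zs q → ∀ s t → T (R s) → T (R t) → Walk H′ s t → q s ≡ q t)
    decompose k H′ sub sy le with Finₚ.any? (λ v → T? (not (R v)) ×-dec (deg H′ v ℕₚ.≟ 1))
    decompose zero H′ sub sy le | yes (v , _ , d) =
      ⊥-elim (ℕₚ.<⇒≱ (countFin-pos (λ u → 0 <ᵇ deg H′ u) v (T-<ᵇ (ℕₚ.≤-reflexive (sym d)))) le)
    decompose (suc k) H′ sub sy le | yes (v , sv , d)
      with w , vw ← countFin-pos⁻ (H′ v) (ℕₚ.≤-reflexive (sym d))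
      with decompose k (delete v H′) (λ x y t → sub x y (delete-⊑ {H = H′} {v} x y t)) (delete-symm sy)
             (ℕₚ.≤-pred (ℕₚ.≤-trans (order-strict (delete-⊑ {H = H′}) v (ℕₚ.≤-reflexive (sym d))
               λ p → let x , t = countFin-pos⁻ (delete v H′ v) p in delete-≢ˡ {H = H′} {v} {v} {x} t refl) le))
    -- Walks are folded onto the neighbour of the deleted leaf; terminals do not move, since the
    -- leaf is Steiner.
    ... | Zs , fs , cs , ties = Zs , fs , ℚₚ.≤-trans cs (cost-mono (λ x y t → HG x y (sub x y t)) delete-⊑) ,
          λ q ts s t rs rt P → ties q ts s t rs rt
            (subst₂ (Walk (delete v H′)) (unmoved s rs) (unmoved t rt) (delete-walk sy (λ z t → deg1-unique {H = H′} d t vw) P))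
      where
      unmoved : ∀ s → T (R s) → merge v w id s ≡ s
      unmoved s rs = merge-ne {p = id} λ { refl → not-elim sv rs }
    decompose k H′ sub sy le | no noLeaf with Finₚ.any? (λ u → 1 ℕₚ.≤? deg H′ u)
    ... | no empty = [] , [] , cost-nonneg (λ x y t → HG x y (sub x y t)) , λ { q _ s t rs rt nil → refl ; q _ s t rs rt (cons {v = x} e P) → ⊥-elim (empty (s , countFin-pos (H′ s) x e)) }
    decompose zero H′ sub sy le | no noLeaf | yes (u , d) =
      ⊥-elim (ℕₚ.<⇒≱ (countFin-pos (λ u → 0 <ᵇ deg H′ u) u (T-<ᵇ d)) le)
    decompose (suc k) H′ sub sy le | no noLeaf | yes (u , d) = result
      where
      lab = component H′
      C D : Subgraph n
      C x y = H′ x y ∧ does (lab x ≟ lab u)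
      D x y = H′ x y ∧ not (does (lab x ≟ lab u))
      C⊑ : C ⊑ H′
      C⊑ x y = ∧-fst
      D⊑ : D ⊑ H′
      D⊑ x y = ∧-fst
      inC : ∀ {x y} → T (H′ x y) → lab x ≡ lab u → T (C x y)
      inC {x} h e = ∧-intro h (does-intro (lab x ≟ lab u) e)
      outC : ∀ {x y} → T (C x y) → lab x ≡ lab u
      outC {x} {y} t = does-elim (lab x ≟ lab u) (∧-snd {H′ x y} t)
      inD : ∀ {x y} → T (H′ x y) → lab x ≢ lab u → T (D x y)
      inD {x} h ne = ∧-intro h (not-intro λ t → ne (does-elim (lab x ≟ lab u) t))
      outD : ∀ {x y} → T (D x y) → lab x ≢ lab u
      outD {x} {y} t e = not-elim (∧-snd {H′ x y} t) (does-intro (lab x ≟ lab u) e)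
      symC : Symm C
      symC x y = T-ext (sw x y) (sw y x)
        where
        sw : ∀ x y → T (C x y) → T (C y x)
        sw x y t = inC (flip sy (C⊑ x y t)) (trans (sym (component-edge H′ (C⊑ x y t))) (outC {x} {y} t))
      symD : Symm D
      symD x y = T-ext (sw x y) (sw y x)
        where
        sw : ∀ x y → T (D x y) → T (D y x)
        sw x y t = inD (flip sy (D⊑ x y t)) λ e → outD {x} {y} t (trans (component-edge H′ (D⊑ x y t)) e)
      walkC : ∀ {x y} → lab x ≡ lab u → Walk H′ x y → Walk C x y
      walkC e nil = nil
      walkC e (cons t P) = cons (inC t e) (walkC (trans (sym (component-edge H′ t)) e) P)
      walkD : ∀ {x y} → lab x ≢ lab u → Walk H′ x y → Walk D x y
      walkD e nil = nil
      walkD e (cons t P) = cons (inD t e) (walkD (λ e′ → e (trans (component-edge H′ t) e′)) P)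
      labC : ∀ x → 1 ≤ deg C x → lab x ≡ lab u
      labC x p = let y , t = countFin-pos⁻ (C x) p in outC {x} {y} t
      degC : ∀ x → lab x ≡ lab u → deg H′ x ≡ deg C x
      degC x e = countFin-cong (H′ x) (C x) λ y → T-ext (λ t → inC t e) (C⊑ x y)
      rest = decompose k D (λ x y t → sub x y (D⊑ x y t)) symD
               (ℕₚ.≤-pred (ℕₚ.≤-trans (order-strict D⊑ u d λ p → let y , t = countFin-pos⁻ (D u) p in outD {u} {y} t refl) le))
      C⊑H : C ⊑ H
      C⊑H x y t = sub x y (C⊑ x y t)
      -- On the vertices of `C` degrees agree with those in `H′`, which has no Steiner leaf;
      -- acyclicity and the condition on internal vertices are inherited from `H`.
      fullC : IsFullComponent G R C
      fullC = ((λ x y t → HG x y (C⊑H x y t)) , symC ,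
               (λ x y px py → walkC (labC x px) (component-sound sy (trans (labC x px) (sym (labC y py))))) ,
               λ cy → proj₂ (proj₂ (proj₂ (proj₁ full))) (cycle-map C⊑H cy)) ,
              (λ x p → proj₁ (proj₂ full) x (ℕₚ.≤-trans p (deg-mono C⊑H x))) ,
              λ x e → terminal x (trans (degC x (labC x (ℕₚ.≤-reflexive (sym e)))) e)
        where
        terminal : ∀ x → deg H′ x ≡ 1 → T (R x)
        terminal x e with T? (R x)
        ... | yes t = t
        ... | no nt = ⊥-elim (noLeaf (x , not-intro nt , e))
      costs : cost C +ℚ cost D ≤ℚ cost H′
      costs = cost-split (λ x y t → HG x y (sub x y t)) C⊑ D⊑ λ x y tc td → outD {x} {y} td (outC {x} {y} tc)
      result : ∃ λ Zs → All (FullR r) Zs × intCost G Zs ≤ℚ cost H′ ×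
        (∀ q → Ties Zs q → ∀ s t → T (R s) → T (R t) → Walk H′ s t → q s ≡ q t)
      result with rest | 2 ℕₚ.≤? countFin (termSet R C)
      ... | Zs , fs , cs , ties | yes p =
            C ∷ Zs ,
            (fullC , p , ℕₚ.≤-trans (countFin-mono _ _ (termSet-mono C⊑H)) size) ∷ fs ,
            ℚₚ.≤-trans (ℚₚ.+-monoʳ-≤ (cost C) cs) costs ,
            λ { q (tc ∷ ts) s t rs rt P → tie q tc ts s t rs rt P }
        where
        tie : ∀ q → Constant (termSet R C) q → Ties Zs q → ∀ s t → T (R s) → T (R t) → Walk H′ s t → q s ≡ q t
        tie q tc ts s t rs rt P with s ≟ t
        ... | yes refl = refl
        ... | no ne with lab s ≟ lab u
        ...   | yes e = tc s t (terminal-intro {C} s rs (walk⇒deg ne (walkC e P)))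
                              (terminal-intro {C} t rt (walk⇒deg (λ e → ne (sym e)) (reverse symC (walkC e P))))
        ...   | no ne′ = ties q ts s t rs rt (walkD ne′ P)
      -- A component with fewer than two terminals is thrown away: it joins no two distinct
      -- terminals.
      ... | Zs , fs , cs , ties | no np =
            Zs , fs ,
            ℚₚ.≤-trans cs (cost-mono (λ x y t → HG x y (sub x y t)) D⊑) ,
            tie
        where
        tie : ∀ q → Ties Zs q → ∀ s t → T (R s) → T (R t) → Walk H′ s t → q s ≡ q t
        tie q ts s t rs rt P with s ≟ t
        ... | yes refl = refl
        ... | no ne with lab s ≟ lab u
        ...   | yes e = ⊥-elim (np (countFin-two (termSet R C) s t ne (terminal-intro {C} s rs (walk⇒deg ne (walkC e P)))
                              (terminal-intro {C} t rt (walk⇒deg (λ e → ne (sym e)) (reverse symC (walkC e P))))))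
        ...   | no ne′ = ties q ts s t rs rt (walkD ne′ P)

-- Finite enumeration and the existence of an optimal solution.

functions : ∀ {A : Set} m → List A → List (Fin m → A)
functions zero as = Vector.[] ∷ []
functions (suc m) as = cartesianProductWith Vector._∷_ as (functions m as)

-- Functions are matched only pointwise. Keeping the relation on values a parameter lets the
-- statement be applied twice, for subgraphs as functions of two arguments.
functions-complete : ∀ {A : Set} (_~_ : A → A → Set) (as : List A) → (∀ a → ∃ λ a′ → a′ ∈ as × a ~ a′) →
  ∀ m (f : Fin m → A) → ∃ λ f′ → f′ ∈ functions m as × (∀ i → f i ~ f′ i)
functions-complete _~_ as h zero f = Vector.[] , here refl , λ ()
functions-complete _~_ as h (suc m) f
  with a , a∈ , e ← h (f zero) | g , g∈ , es ← functions-complete _~_ as h m (λ i → f (suc i)) =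
  a Vector.∷ g , ∈-cartesianProductWith⁺ Vector._∷_ a∈ g∈ , λ { zero → e ; (suc i) → es i }

argmin : ∀ {A : Set} {P : A → Set} (f : A → ℚ) → (∀ x → Dec (P x)) → (L : List A) →
  (∀ y → y ∈ L → ¬ P y) ⊎ (∃ λ x → P x × (∀ y → y ∈ L → P y → f x ≤ℚ f y))
argmin f P? [] = inj₁ λ y ()
argmin f P? (x ∷ L) with P? x | argmin f P? L
... | no nx | inj₁ none = inj₁ λ { y (here refl) → nx ; y (there m) → none y m }
... | no nx | inj₂ (m , pm , min) = inj₂ (m , pm , λ { y (here refl) py → ⊥-elim (nx py) ; y (there i) → min y i })
... | yes px | inj₁ none = inj₂ (x , px , λ { y (here refl) _ → ℚₚ.≤-refl ; y (there i) py → ⊥-elim (none y i py) })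
... | yes px | inj₂ (m , pm , min) with ℚₚ.≤-total (f x) (f m)
...   | inj₁ le = inj₂ (x , px , λ { y (here refl) _ → ℚₚ.≤-refl ; y (there i) py → ℚₚ.≤-trans le (min y i py) })
...   | inj₂ ge = inj₂ (m , pm , λ { y (here refl) _ → ge ; y (there i) → min y i })

lookup-injective : ∀ {A : Set} {xs : List A} → Unique xs → ∀ {i j} → lookup xs i ≡ lookup xs j → i ≡ j
lookup-injective (_ ∷ u) {zero} {zero} e = refl
lookup-injective {xs = x ∷ xs} (d ∷ u) {zero} {suc j} e = ⊥-elim (All.lookup d (∈-lookup {xs = xs} j) e)
lookup-injective {xs = x ∷ xs} (d ∷ u) {suc i} {zero} e = ⊥-elim (All.lookup d (∈-lookup {xs = xs} i) (sym e))
lookup-injective (_ ∷ u) {suc i} {suc j} e = cong suc (lookup-injective u e)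

unique-length : ∀ {n} {xs : List (Fin n)} → Unique xs → length xs ≤ n
unique-length u = Finₚ.injective⇒≤ (lookup-injective u)

anyList? : ∀ {n} k {P : List (Fin n) → Set} → (∀ ys → Dec (P ys)) → Dec (∃ λ ys → length ys ≤ k × P ys)
anyList? zero P? = map′ (λ p → [] , z≤n , p) (λ { ([] , _ , p) → p }) (P? [])
anyList? (suc k) {P} P? with P? []
... | yes p = yes ([] , z≤n , p)
... | no np = map′ (λ { (x , ys , l , p) → x ∷ ys , s≤s l , p })
                   (λ { ([] , _ , p) → ⊥-elim (np p) ; (x ∷ ys , s≤s l , p) → x , ys , l , p })
                   (Finₚ.any? λ x → anyList? k (λ ys → P? (x ∷ ys)))

-- A cycle repeats no vertex, so the search can be limited to lists of length at most `n`.
cycle? : ∀ {n} (H : Subgraph n) → Dec (Cycle H)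
cycle? {n} H = map′ (λ { (a , ys , _ , p) → a , ys , p })
    (λ { (a , ys , l , u , lk) → a , ys , ℕₚ.≤-trans (ℕₚ.n≤1+n _) (unique-length u) , l , u , lk })
    (Finₚ.any? λ a → anyList? n λ ys →
      (2 ℕₚ.≤? length ys) ×-dec unique? _≟_ (a ∷ ys) ×-dec Linked.linked? (λ x y → T? (H x y)) (a ∷ ys ++ [ a ]))

subgraphs : ∀ n → List (Subgraph n)
subgraphs n = functions n (functions n (true ∷ false ∷ []))

infix 4 _≋_
_≋_ : ∀ {n} → Subgraph n → Subgraph n → Set
A ≋ B = ∀ x y → A x y ≡ B x y

subgraphs-complete : ∀ {n} (H : Subgraph n) → ∃ λ H′ → H′ ∈ subgraphs n × H ≋ H′
subgraphs-complete {n} = functions-complete (λ f g → ∀ y → f y ≡ g y) _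
  (functions-complete _≡_ _ (λ { true → true , here refl , refl ; false → false , there (here refl) , refl }) n) n

deg-≋ : ∀ {n} {A B : Subgraph n} → A ≋ B → ∀ u → deg A u ≡ deg B u
deg-≋ e u = countFin-cong _ _ (e u)

termSet-≋ : ∀ {n} R {A B : Subgraph n} → A ≋ B → ∀ u → termSet R A u ≡ termSet R B u
termSet-≋ R e u = cong (λ d → R u ∧ (0 <ᵇ d)) (deg-≋ e u)

constant-resp : ∀ {n} {S S′ : Fin n → Bool} {q} → (∀ u → S u ≡ S′ u) → Constant S q → Constant S′ q
constant-resp e cs u v su sv = cs u v (subst T (sym (e u)) su) (subst T (sym (e v)) sv)

module Optimum {n : ℕ} (G : Graph n) (R : Fin n → Bool) where
  open Costs G
  open Pieces G R

  cost-≋ : ∀ {A B} → A ≋ B → cost A ≡ cost B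
  cost-≋ e = sumFin-cong λ u → sumFin-cong λ v → cong (λ b → if b ∧ (toℕ u <ᵇ toℕ v) then c G u v else 0ℚ) (e u v)

  full-≋ : ∀ {A B} → A ≋ B → IsFullComponent G R A → IsFullComponent G R B
  full-≋ {A} {B} e ((sub , sy , con , acyc) , two , one) =
    ((λ u v t → sub u v (B⊑A u v t)) , (λ u v → trans (sym (e u v)) (trans (sy u v) (e v u))) ,
     (λ u v du dv → walk-map A⊑B (con u v (subst (1 ≤_) (sym (deg-≋ e u)) du) (subst (1 ≤_) (sym (deg-≋ e v)) dv))) ,
     λ cy → acyc (cycle-map B⊑A cy)) ,
    (λ u d → two u (subst (2 ≤_) (sym (deg-≋ e u)) d)) ,
    (λ u d → one u (trans (deg-≋ e u) d))
    where
    A⊑B : A ⊑ B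
    A⊑B u v = subst T (e u v)
    B⊑A : B ⊑ A
    B⊑A u v = subst T (sym (e u v))

  full? : ∀ H → Dec (IsFullComponent G R H)
  full? H = tree? ×-dec
      (Finₚ.all? λ u → (2 ℕₚ.≤? deg H u) →-dec T? (not (R u))) ×-dec
      (Finₚ.all? λ u → (deg H u ℕₚ.≟ 1) →-dec T? (R u))
    where
    tree? : Dec (IsTree G H)
    tree? with Finₚ.all? (λ u → Finₚ.all? λ v → H u v Bool.≟ H v u)
    ... | no ns = no λ t → ns (proj₁ (proj₂ t))
    ... | yes sy = (Finₚ.all? λ u → Finₚ.all? λ v → T? (H u v) →-dec T? (adj G u v)) ×-dec
                   yes sy ×-dec
                   (Finₚ.all? λ u → Finₚ.all? λ v → (1 ℕₚ.≤? deg H u) →-dec (1 ℕₚ.≤? deg H v) →-dec walk? sy u v) ×-dec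
                   ¬? (cycle? H)

  fullR? : ∀ r H → Dec (FullR r H)
  fullR? r H = full? H ×-dec (2 ℕₚ.≤? countFin (termSet R H)) ×-dec (countFin (termSet R H) ℕₚ.≤? r)

  fullR-≋ : ∀ {r A B} → A ≋ B → FullR r A → FullR r B
  fullR-≋ {r} {A} {B} e (f , lo , hi) = full-≋ e f , subst (2 ≤_) ct lo , subst (_≤ r) ct hi
    where
    ct : countFin (termSet R A) ≡ countFin (termSet R B)
    ct = countFin-cong _ _ (termSet-≋ R e)

  minimise : ∀ {r H} → FullR r H → ∃ λ K → InKr G R r K × (∀ u → termSet R K u ≡ termSet R H u) × cost K ≤ℚ cost H
  minimise {r} {H} (f , lo , hi)
    with argmin cost (λ K → full? K ×-dec Finₚ.all? (λ u → termSet R K u Bool.≟ termSet R H u)) (subgraphs n)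
  ... | inj₁ none = let K , m , e = subgraphs-complete H in
        ⊥-elim (none K m (full-≋ e f , λ u → sym (termSet-≋ R e u)))
  ... | inj₂ (K , (fK , tK) , min) =
        K , (fK , subst (2 ≤_) ct lo , subst (_≤ r) ct hi , λ H′ f′ t′ → le H′ f′ (λ u → trans (t′ u) (tK u))) , tK , le H f (λ _ → refl)
    where
    ct : countFin (termSet R H) ≡ countFin (termSet R K)
    ct = countFin-cong _ _ (λ u → sym (tK u))
    le : ∀ H′ → IsFullComponent G R H′ → (∀ u → termSet R H′ u ≡ termSet R H u) → cost K ≤ℚ cost H′
    le H′ f′ t′ = let L , m , e = subgraphs-complete H′ in
      subst (cost K ≤ℚ_) (sym (cost-≋ e)) (min L m (full-≋ e f′ , λ u → trans (sym (termSet-≋ R e u)) (t′ u)))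

  constant? : ∀ (S : Fin n → Bool) (q : Fin n → Fin n) → Dec (Constant S q)
  constant? S q = Finₚ.all? λ u → Finₚ.all? λ v → T? (S u) →-dec T? (S v) →-dec (q u ≟ q v)

  connects? : ∀ Zs → Dec (Connects R Zs)
  connects? Zs = map′ to (λ co → All.tabulate λ {q} _ → co q)
      (All.all? (λ q → All.all? (λ Z → constant? (termSet R Z) q) Zs →-dec constant? R q) (functions n (allFin n)))
    where
    resp : ∀ {S : Fin n → Bool} {q q′ : Fin n → Fin n} → (∀ x → q x ≡ q′ x) → Constant S q → Constant S q′
    resp e cs u v su sv = trans (sym (e u)) (trans (cs u v su sv) (e v))
    to : All (λ q → Ties Zs q → Constant R q) (functions n (allFin n)) → Connects R Zs
    to as q ts with q′ , m , e ← functions-complete _≡_ (allFin n) (λ a → a , ∈-allFin a , refl) n q =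
      resp (λ x → sym (e x)) (All.lookup as m (All.map (resp e) ts))

  sublists : ∀ {A : Set} → List A → List (List A)
  sublists [] = [] ∷ []
  sublists (x ∷ xs) = map (x ∷_) (sublists xs) ++ sublists xs

  sublists-complete : ∀ {A : Set} {ws xs : List A} → ws ⊆ xs → ws ∈ sublists xs
  sublists-complete [] = here refl
  sublists-complete {xs = x ∷ xs} (_ ∷ʳ s) = ∈-++⁺ʳ (map (x ∷_) (sublists xs)) (sublists-complete s)
  sublists-complete (refl ∷ s) = ∈-++⁺ˡ (∈-map⁺ _ (sublists-complete s))

  -- `K` is put at its own place in `Xs`. If it is already chosen nothing changes, and the bound
  -- holds because costs are nonnegative.
  sublist-insert : ∀ {Ws Xs : IntSol n} {K} → All (λ X → 0ℚ ≤ℚ cost X) Xs → Ws ⊆ Xs → K ∈ Xs →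
    ∃ λ Vs → Vs ⊆ Xs × K ∈ Vs × (∀ {W} → W ∈ Ws → W ∈ Vs) × intCost G Vs ≤ℚ cost K +ℚ intCost G Ws
  sublist-insert {K = K} (_ ∷ _) (y ∷ʳ s) (here refl) = K ∷ _ , refl ∷ s , here refl , there , ℚₚ.≤-refl
  sublist-insert {Ws = Ws} (p ∷ _) (refl ∷ s) (here refl) = Ws , refl ∷ s , here refl , id ,
    ℚₚ.≤-trans (ℚₚ.≤-reflexive (sym (ℚₚ.+-identityˡ _))) (ℚₚ.+-monoˡ-≤ (intCost G Ws) p)
  sublist-insert (_ ∷ ps) (y ∷ʳ s) (there m) with Vs , t , k , h , le ← sublist-insert ps s m =
    Vs , y ∷ʳ t , k , h , le
  sublist-insert {Ws = W ∷ Ws} {K = K} (_ ∷ ps) (refl ∷ s) (there m) with Vs , t , k , h , le ← sublist-insert ps s m =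
    W ∷ Vs , refl ∷ t , there k , (λ { (here e) → here e ; (there i) → there (h i) }) ,
    ℚₚ.≤-trans (ℚₚ.+-monoʳ-≤ (cost W) le) (ℚₚ.≤-reflexive
      (trans (sym (ℚₚ.+-assoc (cost W) (cost K) (intCost G Ws)))
      (trans (cong (_+ℚ intCost G Ws) (ℚₚ.+-comm (cost W) (cost K))) (ℚₚ.+-assoc (cost K) (cost W) (intCost G Ws)))))

  module _ (r : ℕ) where

    candidates : IntSol n
    candidates = filter (fullR? r) (subgraphs n)

    candidates-nonneg : All (λ X → 0ℚ ≤ℚ cost X) candidates
    candidates-nonneg = All.tabulate λ m → let _ , f , _ = ∈-filter⁻ (fullR? r) {xs = subgraphs n} m in cost-nonneg (proj₁ (proj₁ f))

    -- Solutions can be arbitrarily long lists. Replacing each component by its enumerated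
    -- representative and dropping repetitions costs nothing and leaves finitely many solutions to
    -- compare, the sublists of `candidates`.
    normalise : ∀ Zs → All (FullR r) Zs → ∃ λ Ws → Ws ⊆ candidates × All (FullR r) Ws × intCost G Ws ≤ℚ intCost G Zs ×
      (∀ q → Ties Ws q → Ties Zs q)
    normalise [] [] = [] , minimum _ , [] , ℚₚ.≤-refl , λ _ _ → []
    normalise (Z ∷ Zs) (f ∷ fs)
      with Ws , s , _ , le , ties ← normalise Zs fs
      with K , m , e ← subgraphs-complete Z
      with Vs , t , k , h , le′ ← sublist-insert candidates-nonneg s (∈-filter⁺ (fullR? r) m (fullR-≋ e f)) =
      Vs , t , All.tabulate (λ i → proj₂ (∈-filter⁻ (fullR? r) {xs = subgraphs n} (sub t i))) ,
      ℚₚ.≤-trans le′ (ℚₚ.≤-trans (ℚₚ.+-monoʳ-≤ (cost K) le) (ℚₚ.≤-reflexive (cong (_+ℚ intCost G Zs) (sym (cost-≋ e))))) ,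
      λ q ts → constant-resp (λ u → sym (termSet-≋ R e u)) (All.lookup ts k) ∷ ties q (All.tabulate λ i → All.lookup ts (h i))
      where
      sub : ∀ {A : Set} {ws xs : List A} → ws ⊆ xs → ∀ {x} → x ∈ ws → x ∈ xs
      sub (_ ∷ʳ s) i = there (sub s i)
      sub (refl ∷ s) (here e) = here e
      sub (refl ∷ s) (there i) = there (sub s i)

    optimum : ∀ Zs → All (FullR r) Zs → Connects R Zs → ∃ λ Y → All (FullR r) Y × Connects R Y ×
      (∀ Zs → All (FullR r) Zs → Connects R Zs → intCost G Y ≤ℚ intCost G Zs)
    optimum Zs₀ fs₀ co₀
      with argmin (intCost G) (λ Ws → connects? Ws ×-dec All.all? (fullR? r) Ws) (sublists candidates)
    ... | inj₁ none = let Ws , s , fs , _ , ties = normalise Zs₀ fs₀ in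
          ⊥-elim (none Ws (sublists-complete s) ((λ q ts → co₀ q (ties q ts)) , fs))
    ... | inj₂ (Y , (co , fs) , min) = Y , fs , co , λ Zs fZ cZ →
          let Ws , s , fW , le , ties = normalise Zs fZ in
          ℚₚ.≤-trans (min Ws (sublists-complete s) ((λ q ts → cZ q (ties q ts)) , fW)) le

-- Pendant vertices and spanning trees in first-child form.

unique-resp-↭ : ∀ {A : Set} {xs ys : List A} → xs ↭ ys → Unique xs → Unique ys
unique-resp-↭ {A} p = Permutationₛ.Unique-resp-↭ (setoid A) (↭⇒↭ₛ p)

module _ {n : ℕ} where

  -- The prefix ending at `z`: the part of a path that an edge from its start to `z` closes to a
  -- cycle.
  takeTo : ∀ {l : List (Fin n)} {z} → z ∈ l → List (Fin n)
  takeTo {w ∷ l} (here _) = w ∷ []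
  takeTo {w ∷ l} (there m) = w ∷ takeTo m

  takeTo-All : ∀ {P : Fin n → Set} {l z} (m : z ∈ l) → All P l → All P (takeTo m)
  takeTo-All (here _) (p ∷ _) = p ∷ []
  takeTo-All (there m) (p ∷ ps) = p ∷ takeTo-All m ps

  takeTo-unique : ∀ {l : List (Fin n)} {z} (m : z ∈ l) → Unique l → Unique (takeTo m)
  takeTo-unique (here _) (_ ∷ _) = [] ∷ []
  takeTo-unique (there m) (p ∷ u) = takeTo-All m p ∷ takeTo-unique m u

  takeTo-pos : ∀ {l : List (Fin n)} {z} (m : z ∈ l) → 1 ≤ length (takeTo m)
  takeTo-pos (here _) = s≤s z≤n
  takeTo-pos (there m) = s≤s z≤n

  takeTo-linked : ∀ {E : Fin n → Fin n → Set} {w l z x} (m : z ∈ l) → Linked E (w ∷ l) → E z x → Linked E (w ∷ takeTo m ++ [ x ])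
  takeTo-linked (here refl) (e ∷ _) zx = e ∷ zx ∷ [-]
  takeTo-linked (there m) (e ∷ lk) zx = e ∷ takeTo-linked m lk zx

  -- The pendant vertex must differ from `a`, so that deleting it keeps the root.
  Pendant : Subgraph n → Fin n → Set
  Pendant H a = ∃₂ λ x y → x ≢ a × T (H x y) × (∀ z → T (H x z) → z ≡ y) × Walk H a x

  -- Extend a simple path from a until it gets stuck.
  pendant : ∀ (H : Subgraph n) → Symm H → (∀ u → ¬ T (H u u)) → ¬ Cycle H → ∀ a → 1 ≤ deg H a → Pendant H a
  pendant H sy irr acyc a d with z , az ← countFin-pos⁻ (H a) d =
    go n z a [] (((λ e → irr a (subst (λ w → T (H a w)) e az)) ∷ []) ∷ [] ∷ []) (flip sy az ∷ [-]) (here refl) (cons az nil) (ℕₚ.m<m+n n (s≤s z≤n))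
    where
    go : ∀ k x y rest → Unique (x ∷ y ∷ rest) → Linked (λ u v → T (H u v)) (x ∷ y ∷ rest) → a ∈ y ∷ rest → Walk H a x →
      n < k + length (x ∷ y ∷ rest) → Pendant H a
    go zero x y rest u _ _ _ lt = ⊥-elim (ℕₚ.<⇒≱ lt (unique-length u))
    go (suc k) x y rest u@((_ ∷ xs) ∷ ur@(_ ∷ _)) lk@(xy ∷ lr) a∈ P lt with Finₚ.any? (λ z → T? (H x z) ×-dec ¬? (z ≟ y))
    ... | no stuck = x , y , (λ e → All.lookup (AllPairs.head u) a∈ e) , xy , only , P
      where
      only : ∀ z → T (H x z) → z ≡ y
      only z t with z ≟ y
      ... | yes e = e
      ... | no ne = ⊥-elim (stuck (z , t , ne))
    ... | yes (z , xz , ne) with DecMembership._∈?_ _≟_ z rest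
    -- The path is stored with its newest vertex first. Here `z` lies behind the predecessor `y`, so
    -- the cycle has at least three vertices.
    ...   | yes m = ⊥-elim (acyc (x , y ∷ takeTo m , s≤s (takeTo-pos m) ,
                ((λ e → irr x (subst (λ w → T (H x w)) (sym e) xy)) ∷ takeTo-All m xs) ∷ takeTo-unique (there m) ur ,
                xy ∷ takeTo-linked m lr (flip sy xz)))
    ...   | no nm = go k z x (y ∷ rest)
                (((λ e → irr x (subst (λ w → T (H x w)) e xz)) ∷ ne ∷ All.tabulate λ i e → nm (subst (_∈ rest) (sym e) i)) ∷ u)
                (flip sy xz ∷ lk) (there a∈) (P ⊕ cons xz nil) (subst (n <_) (sym (ℕₚ.+-suc k _)) lt)

  -- Rooted forests in first-child/next-sibling form; the root of each tree is a child of a vertex given from outside.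
  data Forest : Set where
    empty : Forest
    node : (v : Fin n) (children siblings : Forest) → Forest

  vertices : Forest → List (Fin n)
  vertices empty = []
  vertices (node v c s) = v ∷ vertices c ++ vertices s

  edges : Fin n → Forest → List (Fin n × Fin n)
  edges p empty = []
  edges p (node v c s) = (p , v) ∷ edges v c ++ edges p s

  edge-parent : ∀ p f {x y} → (x , y) ∈ edges p f → x ∈ p ∷ vertices f
  edge-parent p (node v c s) (here refl) = here refl
  edge-parent p (node v c s) (there i) with ∈-++⁻ (edges v c) i
  ... | inj₁ j = there (∈-++⁺ˡ {xs = v ∷ vertices c} (edge-parent v c j))
  ... | inj₂ j with edge-parent p s j
  ...   | here e = here e
  ...   | there k = there (there (∈-++⁺ʳ (vertices c) k))

  edge-child : ∀ p f {x y} → (x , y) ∈ edges p f → y ∈ vertices f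
  edge-child p (node v c s) (here refl) = here refl
  edge-child p (node v c s) (there i) with ∈-++⁻ (edges v c) i
  ... | inj₁ j = there (∈-++⁺ˡ (edge-child v c j))
  ... | inj₂ j = there (∈-++⁺ʳ (vertices c) (edge-child p s j))

  child-edge : ∀ p f {y} → y ∈ vertices f → ∃ λ x → (x , y) ∈ edges p f
  child-edge p (node v c s) (here refl) = p , here refl
  child-edge p (node v c s) (there i) with ∈-++⁻ (vertices c) i
  ... | inj₁ j = let x , k = child-edge v c j in x , there (∈-++⁺ˡ k)
  ... | inj₂ j = let x , k = child-edge p s j in x , there (∈-++⁺ʳ (edges v c) k)

  graft : ∀ p f x {y} → y ∈ p ∷ vertices f → ∃ λ f′ → vertices f′ ↭ x ∷ vertices f × edges p f′ ↭ (y , x) ∷ edges p f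
  graft p f x (here refl) = node x empty f , ↭-refl , ↭-refl
  graft p (node v c s) x (there (here refl)) = node v (node x empty c) s , swap v x ↭-refl , swap _ _ ↭-refl
  graft p (node v c s) x {y} (there (there i)) with ∈-++⁻ (vertices c) i
  ... | inj₁ j with c′ , vs , es ← graft v c x (there j) =
        node v c′ s , ↭-trans (prep v (++⁺ʳ (vertices s) vs)) (swap v x ↭-refl) ,
        ↭-trans (prep _ (++⁺ʳ (edges p s) es)) (swap _ _ ↭-refl)
  ... | inj₂ j with s′ , vs , es ← graft p s x (there j) =
        node v c s′ , ↭-trans (prep v (↭-trans (++⁺ˡ (vertices c) vs) (shift x (vertices c) (vertices s)))) (swap v x ↭-refl) ,
        ↭-trans (prep _ (↭-trans (++⁺ˡ (edges v c) es) (shift (y , x) (edges v c) (edges p s)))) (swap _ _ ↭-refl)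

module SpanningForest {n : ℕ} (G : Graph n) where
  open Costs G

  -- Only the component of `a` is spanned, whence the inequality in `weight≤`; `covers` supplies the
  -- reverse one when `H` is connected.
  record Spanning (H : Subgraph n) (a : Fin n) (f : Forest {n}) : Set where
    field
      distinct : Unique (a ∷ vertices f)
      inside : All (λ e → T (H (proj₁ e) (proj₂ e))) (edges a f)
      weight≤ : edgeCost (edges a f) ≤ℚ cost H
      covers : ∀ x y → Walk H a x → T (H x y) → (x , y) ∈ edges a f ⊎ (y , x) ∈ edges a f

    reaches : Symm H → ∀ {x} → Walk H a x → x ∈ a ∷ vertices f
    reaches sy {x} P with reverse sy P
    ... | nil = here refl
    ... | cons {v = z} t _ with covers x z P t
    ...   | inj₁ i = edge-parent a f i
    ...   | inj₂ i = there (edge-child a f i)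

  -- A pendant vertex is deleted, the rest is spanned, and the vertex is grafted below its only
  -- neighbour.
  spanning : ∀ k (H : Subgraph n) → Symm H → H ⊑ adj G → ¬ Cycle H → ∀ a → order H ≤ k → ∃ (Spanning H a)
  spanning k H sy hG acyc a le with 1 ℕₚ.≤? deg H a
  spanning k H sy hG acyc a le | no isolated = empty , record
    { distinct = [] ∷ []
    ; inside = []
    ; weight≤ = cost-nonneg hG
    ; covers = λ { x y nil t → ⊥-elim (isolated (countFin-pos (H a) y t)) ; x y (cons {v = z} t _) _ → ⊥-elim (isolated (countFin-pos (H a) z t)) }
    }
  spanning zero H sy hG acyc a le | yes d = ⊥-elim (ℕₚ.<⇒≱ (countFin-pos (λ u → 0 <ᵇ deg H u) a (T-<ᵇ d)) le)
  spanning (suc k) H sy hG acyc a le | yes d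
    with x , y , x≢a , xy , only , P ← pendant H sy (λ u t → subst T (adj-irrefl G u) (hG u u t)) acyc a d
    with f , F ← spanning k (delete x H) (delete-symm sy) (λ u w t → hG u w (delete-⊑ {H = H} u w t))
                   (λ cy → acyc (cycle-map (delete-⊑ {H = H}) cy)) a
                   (ℕₚ.≤-pred (ℕₚ.≤-trans (order-strict (delete-⊑ {H = H}) x (countFin-pos (H x) y xy)
                     λ p → let z , t = countFin-pos⁻ (delete x H x) p in delete-≢ˡ {H = H} {x} {x} {z} t refl) le))
    with f′ , vs , es ← graft a f x (Spanning.reaches F (delete-symm sy)
           (subst₂ (Walk (delete x H)) (merge-ne {p = id} (λ e → x≢a (sym e))) (merge-eq {p = id} {x = x} refl) (delete-walk sy only P))) =
    f′ , record { distinct = unique-resp-↭ (↭-trans (swap x a ↭-refl) (prep a (↭-sym vs))) (fresh ∷ F.distinct)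
                ; inside = All-resp-↭ (↭-sym es) (flip sy xy ∷ All.map (λ {e} → delete-⊑ {H = H} (proj₁ e) (proj₂ e)) F.inside)
                ; weight≤ = ℚₚ.≤-trans (ℚₚ.≤-reflexive (edgeCost-↭ es)) (ℚₚ.≤-trans (ℚₚ.+-monoʳ-≤ (c G y x) F.weight≤)
                    (cost-extract y x sy hG (delete-⊑ {H = H}) (flip sy xy)
                      (λ t → delete-≢ʳ {H = H} {x} {y} {x} t refl) (λ t → delete-≢ˡ {H = H} {x} {x} {y} t refl)))
                ; covers = cov }
    where
    module F = Spanning F
    fresh : All (x ≢_) (a ∷ vertices f)
    fresh = x≢a ∷ All.tabulate λ i e → let p , j = child-edge a f i in delete-≢ʳ {H = H} {x} {p} (All.lookup F.inside j) (sym e)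
    up : ∀ {e} → e ∈ (y , x) ∷ edges a f → e ∈ edges a f′
    up = ∈-resp-↭ (↭-sym es)
    cov : ∀ u w → Walk H a u → T (H u w) → (u , w) ∈ edges a f′ ⊎ (w , u) ∈ edges a f′
    cov u w Q t with u ≟ x
    ... | yes refl with refl ← only w t = inj₂ (up (here refl))
    ... | no nu with w ≟ x
    ...   | yes refl with refl ← only u (flip sy t) = inj₁ (up (here refl))
    ...   | no nw with F.covers u w (subst₂ (Walk (delete x H)) (merge-ne {p = id} (λ e → x≢a (sym e))) (merge-ne {p = id} nu) (delete-walk sy only Q))
                        (delete-intro {H = H} t nu nw)
    ...     | inj₁ i = inj₁ (up (there i))
    ...     | inj₂ i = inj₂ (up (there i))

-- Trees with suppressed vertices: rerooting, loss and links.

-- An inventory of a tree: its path lengths, one mark per fork, and its terminals. Rerooting and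
-- reordering only permute this list, so a single permutation carries over cost, number of forks and
-- terminals.
data Item (n : ℕ) : Set where
  length′ : ℚ → Item n
  branching : Item n
  terminal : Fin n → Item n

module _ {n : ℕ} where

  totalLength : List (Item n) → ℚ
  totalLength [] = 0ℚ
  totalLength (length′ w ∷ is) = w +ℚ totalLength is
  totalLength (branching ∷ is) = totalLength is
  totalLength (terminal _ ∷ is) = totalLength is

  branchings : List (Item n) → ℕ
  branchings [] = 0
  branchings (length′ w ∷ is) = branchings is
  branchings (branching ∷ is) = suc (branchings is)
  branchings (terminal _ ∷ is) = branchings is

  lengthOf : Item n → ℚ
  lengthOf (length′ w) = w
  lengthOf branching = 0ℚ
  lengthOf (terminal _) = 0ℚ

  totalLength-∷ : ∀ i is → totalLength (i ∷ is) ≡ lengthOf i +ℚ totalLength is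
  totalLength-∷ (length′ w) is = refl
  totalLength-∷ branching is = sym (ℚₚ.+-identityˡ _)
  totalLength-∷ (terminal _) is = sym (ℚₚ.+-identityˡ _)

  totalLength-++ : ∀ is js → totalLength (is ++ js) ≡ totalLength is +ℚ totalLength js
  totalLength-++ [] js = sym (ℚₚ.+-identityˡ _)
  totalLength-++ (length′ w ∷ is) js = trans (cong (w +ℚ_) (totalLength-++ is js)) (sym (ℚₚ.+-assoc w _ _))
  totalLength-++ (branching ∷ is) js = totalLength-++ is js
  totalLength-++ (terminal _ ∷ is) js = totalLength-++ is js

  totalLength-↭ : ∀ {is js} → is ↭ js → totalLength is ≡ totalLength js
  totalLength-↭ _↭_.refl = refl
  totalLength-↭ (prep {xs = is} {ys = js} i p) = trans (totalLength-∷ i is) (trans (cong (lengthOf i +ℚ_) (totalLength-↭ p)) (sym (totalLength-∷ i js)))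
  totalLength-↭ (swap {xs = is} {ys = js} i j p) = begin
      totalLength (i ∷ j ∷ is)
        ≡⟨ trans (totalLength-∷ i (j ∷ is)) (cong (lengthOf i +ℚ_) (totalLength-∷ j is)) ⟩
      lengthOf i +ℚ (lengthOf j +ℚ totalLength is)
        ≡⟨ cong (λ z → lengthOf i +ℚ (lengthOf j +ℚ z)) (totalLength-↭ p) ⟩
      lengthOf i +ℚ (lengthOf j +ℚ totalLength js)
        ≡⟨ lemma (lengthOf i) (lengthOf j) (totalLength js) ⟩
      lengthOf j +ℚ (lengthOf i +ℚ totalLength js)
        ≡⟨ sym (trans (totalLength-∷ j (i ∷ js)) (cong (lengthOf j +ℚ_) (totalLength-∷ i js))) ⟩
      totalLength (j ∷ i ∷ js) ∎
    where
    open ≡-Reasoning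
    lemma : ∀ a b d → a +ℚ (b +ℚ d) ≡ b +ℚ (a +ℚ d)
    lemma = solve-∀ ℚ-ring
  totalLength-↭ (_↭_.trans p q) = trans (totalLength-↭ p) (totalLength-↭ q)

  branchings-++ : ∀ is js → branchings (is ++ js) ≡ branchings is + branchings js
  branchings-++ [] js = refl
  branchings-++ (length′ w ∷ is) js = branchings-++ is js
  branchings-++ (branching ∷ is) js = cong suc (branchings-++ is js)
  branchings-++ (terminal _ ∷ is) js = branchings-++ is js

  tally : Item n → ℕ
  tally (length′ _) = 0
  tally branching = 1
  tally (terminal _) = 0

  branchings-∷ : ∀ i is → branchings (i ∷ is) ≡ tally i + branchings is
  branchings-∷ (length′ _) is = refl
  branchings-∷ branching is = refl
  branchings-∷ (terminal _) is = refl

  branchings-↭ : ∀ {is js} → is ↭ js → branchings is ≡ branchings js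
  branchings-↭ _↭_.refl = refl
  branchings-↭ (prep {xs = is} {ys = js} i p) = trans (branchings-∷ i is) (trans (cong (λ z → tally i + z) (branchings-↭ p)) (sym (branchings-∷ i js)))
  branchings-↭ (swap {xs = is} {ys = js} i j p) = begin
      branchings (i ∷ j ∷ is)
        ≡⟨ trans (branchings-∷ i (j ∷ is)) (cong (λ z → tally i + z) (branchings-∷ j is)) ⟩
      tally i + (tally j + branchings is)
        ≡⟨ cong (λ z → tally i + (tally j + z)) (branchings-↭ p) ⟩
      tally i + (tally j + branchings js)
        ≡⟨ sym (ℕₚ.+-assoc (tally i) _ _) ⟩
      (tally i + tally j) + branchings js
        ≡⟨ cong (_+ branchings js) (ℕₚ.+-comm (tally i) _) ⟩
      (tally j + tally i) + branchings js
        ≡⟨ ℕₚ.+-assoc (tally j) _ _ ⟩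
      tally j + (tally i + branchings js)
        ≡⟨ sym (trans (branchings-∷ j (i ∷ js)) (cong (λ z → tally j + z) (branchings-∷ i js))) ⟩
      branchings (j ∷ i ∷ js) ∎
    where open ≡-Reasoning
  branchings-↭ (_↭_.trans p q) = trans (branchings-↭ p) (branchings-↭ q)

  Below : ℚ → List (Item n) → Set
  Below m = All (λ i → lengthOf i ≤ℚ m)

  longest : ∀ w is → 0ℚ ≤ℚ w → ∃ λ m → length′ m ∈ length′ w ∷ is × Below m (length′ w ∷ is)
  longest w [] w≥0 = w , here refl , ℚₚ.≤-refl ∷ []
  longest w (i ∷ is) w≥0 with longest w is w≥0
  ... | m , m∈ , b@(w≤m ∷ bs) with ℚₚ.≤-total (lengthOf i) m
  ...   | inj₁ le = m , insert m∈ , w≤m ∷ le ∷ bs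
    where
    insert : length′ m ∈ length′ w ∷ is → length′ m ∈ length′ w ∷ i ∷ is
    insert (here e) = here e
    insert (there k) = there (there k)
  longest w (length′ x ∷ is) w≥0 | m , m∈ , (w≤m ∷ bs) | inj₂ ge =
    x , there (here refl) , ℚₚ.≤-trans w≤m ge ∷ ℚₚ.≤-refl ∷ All.map (λ le → ℚₚ.≤-trans le ge) bs
  longest w (branching ∷ is) w≥0 | m , m∈ , (w≤m ∷ bs) | inj₂ ge =
    w , here refl , ℚₚ.≤-refl ∷ w≥0 ∷ All.map (λ le → ℚₚ.≤-trans le (ℚₚ.≤-trans ge w≥0)) bs
  longest w (terminal _ ∷ is) w≥0 | m , m∈ , (w≤m ∷ bs) | inj₂ ge =
    w , here refl , ℚₚ.≤-refl ∷ w≥0 ∷ All.map (λ le → ℚₚ.≤-trans le (ℚₚ.≤-trans ge w≥0)) bs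

module Branches {n : ℕ} (G : Graph n) (R : Fin n → Bool) (H : Subgraph n) (sy : Symm H) (hG : H ⊑ adj G) where
  open Costs G
  private module Bag = Algebra.Solver.CommutativeMonoid (++-commutativeMonoid {A = Item n})

  weight : ∀ {H′ : Subgraph n} {u v} → Walk H′ u v → ℚ
  weight P = walkCost (c G) P

  weight-⊕ : ∀ {u v w} (P : Walk H u v) (Q : Walk H v w) → weight (P ⊕ Q) ≡ weight P +ℚ weight Q
  weight-⊕ nil Q = sym (ℚₚ.+-identityˡ _)
  weight-⊕ (cons {u} {v} _ P) Q = trans (cong (c G u v +ℚ_) (weight-⊕ P Q)) (sym (ℚₚ.+-assoc (c G u v) _ _))

  weight-reverse : ∀ {u v} (P : Walk H u v) → weight (reverse sy P) ≡ weight P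
  weight-reverse nil = refl
  weight-reverse (cons {u} {v} e P) = begin
      weight (reverse sy P ⊕ cons (flip sy e) nil)
        ≡⟨ weight-⊕ (reverse sy P) _ ⟩
      weight (reverse sy P) +ℚ (c G v u +ℚ 0ℚ)
        ≡⟨ cong₂ _+ℚ_ (weight-reverse P) (ℚₚ.+-identityʳ _) ⟩
      weight P +ℚ c G v u
        ≡⟨ ℚₚ.+-comm (weight P) (c G v u) ⟩
      c G v u +ℚ weight P
        ≡⟨ cong (_+ℚ weight P) (sym (c-sym G u v (hG u v e))) ⟩
      c G u v +ℚ weight P ∎
    where open ≡-Reasoning

  weight-nonneg : ∀ {u v} (P : Walk H u v) → 0ℚ ≤ℚ weight P
  weight-nonneg nil = ℚₚ.≤-refl
  weight-nonneg (cons {u} {v} e P) = 0≤+ (c-nonneg G u v (hG u v e)) (weight-nonneg P)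

  -- A rooted tree in H with its degree-two vertices suppressed: a fork is a Steiner vertex with two
  -- children, and hang attaches a further child to an existing vertex.
  data Branch : Fin n → Set where
    leaf : ∀ t → T (R t) → Branch t
    fork : ∀ {v u u′} → Walk H v u → Branch u → Walk H v u′ → Branch u′ → Branch v
    hang : ∀ {v u} → Walk H v u → Branch u → Branch v → Branch v

  items : ∀ {v} → Branch v → List (Item n)
  items (leaf t _) = terminal t ∷ []
  items (fork P l Q r) = branching ∷ length′ (weight P) ∷ length′ (weight Q) ∷ items l ++ items r
  items (hang P l B) = length′ (weight P) ∷ items l ++ items B

  -- The root is a path rather than a vertex. Seen from it, a branching end has two children left,
  -- as `fork` requires.
  record Rooted : Set where
    constructor rooted
    field
      {x y} : Fin n
      left : Branch x
      path : Walk H x y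
      right : Branch y

    allItems : List (Item n)
    allItems = length′ (weight path) ∷ items left ++ items right

  open Rooted

  Child : Fin n → Set
  Child v = ∃ λ u → Walk H v u × Branch u

  childItems : ∀ {v} → List (Child v) → List (Item n)
  childItems [] = []
  childItems ((u , P , l) ∷ E) = length′ (weight P) ∷ items l ++ childItems E

  hangAll : ∀ {v} → List (Child v) → Branch v → Branch v
  hangAll [] B = B
  hangAll ((u , P , l) ∷ E) B = hang P l (hangAll E B)

  hangAll-items : ∀ {v} (E : List (Child v)) B → items (hangAll E B) ↭ childItems E ++ items B
  hangAll-items [] B = ↭-refl
  hangAll-items ((u , P , l) ∷ E) B = prep _ (↭-trans (++⁺ˡ (items l) (hangAll-items E B))
    (Bag.solve 3 (λ a b d → a Bag.⊕ (b Bag.⊕ d) Bag.⊜ (a Bag.⊕ b) Bag.⊕ d) ↭-refl (items l) (childItems E) (items B)))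

  -- Moves the root to the edge carrying a given item; E collects the children of y already passed.
  locate : ∀ {x y} (E : List (Child y)) (L : Branch x) (P : Walk H x y) (B : Branch y) {m} → length′ m ∈ items B →
    ∃ λ S → weight (path S) ≡ m × allItems S ↭ length′ (weight P) ∷ items L ++ (childItems E ++ items B)
  locate E L P (leaf t _) (here ())
  locate E L P (leaf t _) (there ())
  locate {x} {y} E L P (fork P₁ l P₂ r) {m} (there i) = go i
    where
    goal = length′ (weight P) ∷ items L ++ (childItems E ++ items (fork P₁ l P₂ r))
    -- When `P₁` becomes the root path, the fork at `y` survives: the old far side `L`, reached by
    -- `P` backwards, takes the place of the child across `P₁`.
    K₁ = hangAll E (fork (reverse sy P) L P₂ r)
    K₂ = hangAll E (fork (reverse sy P) L P₁ l)
    π₁ : length′ (weight P₁) ∷ items K₁ ++ items l ↭ goal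
    π₁ = ↭-trans (prep _ (++⁺ʳ (items l) (hangAll-items E _)))
      (subst (λ w → length′ (weight P₁) ∷ (childItems E ++ (branching ∷ length′ w ∷ length′ (weight P₂) ∷ items L ++ items r)) ++ items l ↭ goal) (sym (weight-reverse P))
      (Bag.solve 8 (λ p p₁ p₂ f e a b d → p₁ Bag.⊕ ((e Bag.⊕ (f Bag.⊕ (p Bag.⊕ (p₂ Bag.⊕ (a Bag.⊕ d))))) Bag.⊕ b)
          Bag.⊜ p Bag.⊕ (a Bag.⊕ (e Bag.⊕ (f Bag.⊕ (p₁ Bag.⊕ (p₂ Bag.⊕ (b Bag.⊕ d)))))))
        ↭-refl (length′ (weight P) ∷ []) (length′ (weight P₁) ∷ []) (length′ (weight P₂) ∷ []) (branching ∷ []) (childItems E) (items L) (items l) (items r)))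
    π₂ : length′ (weight P₂) ∷ items K₂ ++ items r ↭ goal
    π₂ = ↭-trans (prep _ (++⁺ʳ (items r) (hangAll-items E _)))
      (subst (λ w → length′ (weight P₂) ∷ (childItems E ++ (branching ∷ length′ w ∷ length′ (weight P₁) ∷ items L ++ items l)) ++ items r ↭ goal) (sym (weight-reverse P))
      (Bag.solve 8 (λ p p₁ p₂ f e a b d → p₂ Bag.⊕ ((e Bag.⊕ (f Bag.⊕ (p Bag.⊕ (p₁ Bag.⊕ (a Bag.⊕ b))))) Bag.⊕ d)
          Bag.⊜ p Bag.⊕ (a Bag.⊕ (e Bag.⊕ (f Bag.⊕ (p₁ Bag.⊕ (p₂ Bag.⊕ (b Bag.⊕ d)))))))
        ↭-refl (length′ (weight P) ∷ []) (length′ (weight P₁) ∷ []) (length′ (weight P₂) ∷ []) (branching ∷ []) (childItems E) (items L) (items l) (items r)))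
    go : length′ m ∈ length′ (weight P₁) ∷ length′ (weight P₂) ∷ items l ++ items r → _
    go (here refl) = rooted K₁ P₁ l , refl , π₁
    go (there (here refl)) = rooted K₂ P₂ r , refl , π₂
    go (there (there i)) with ∈-++⁻ (items l) i
    ... | inj₁ j = let S , e , π = locate [] K₁ P₁ l j in S , e , ↭-trans π π₁
    ... | inj₂ j = let S , e , π = locate [] K₂ P₂ r j in S , e , ↭-trans π π₂
  locate {x} {y} E L P (hang P₁ l B) {m} i = go i
    where
    goal = length′ (weight P) ∷ items L ++ (childItems E ++ items (hang P₁ l B))
    K₁ = hangAll E (hang (reverse sy P) L B)
    π₁ : length′ (weight P₁) ∷ items K₁ ++ items l ↭ goal
    π₁ = ↭-trans (prep _ (++⁺ʳ (items l) (hangAll-items E _)))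
      (subst (λ w → length′ (weight P₁) ∷ (childItems E ++ (length′ w ∷ items L ++ items B)) ++ items l ↭ goal) (sym (weight-reverse P))
      (Bag.solve 6 (λ p p₁ e a b d → p₁ Bag.⊕ ((e Bag.⊕ (p Bag.⊕ (a Bag.⊕ d))) Bag.⊕ b)
          Bag.⊜ p Bag.⊕ (a Bag.⊕ (e Bag.⊕ (p₁ Bag.⊕ (b Bag.⊕ d)))))
        ↭-refl (length′ (weight P) ∷ []) (length′ (weight P₁) ∷ []) (childItems E) (items L) (items l) (items B)))
    go : length′ m ∈ length′ (weight P₁) ∷ items l ++ items B → _
    go (here refl) = rooted K₁ P₁ l , refl , π₁
    go (there i) with ∈-++⁻ (items l) i
    ... | inj₁ j = let S , e , π = locate [] K₁ P₁ l j in S , e , ↭-trans π π₁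
    -- The item belongs to the rest of the branch at the same vertex `y`; the root path stays and
    -- the hung child is set aside.
    ... | inj₂ j = let S , e , π = locate ((_ , P₁ , l) ∷ E) L P B j in S , e , ↭-trans π
          (Bag.solve 6 (λ p p₁ e a b d → p Bag.⊕ (a Bag.⊕ ((p₁ Bag.⊕ (b Bag.⊕ e)) Bag.⊕ d))
              Bag.⊜ p Bag.⊕ (a Bag.⊕ (e Bag.⊕ (p₁ Bag.⊕ (b Bag.⊕ d)))))
            ↭-refl (length′ (weight P) ∷ []) (length′ (weight P₁) ∷ []) (childItems E) (items L) (items l) (items B))

  -- Afterwards no path is longer than the root path, which is never a loss path.
  reroot : ∀ S → ∃ λ S′ → allItems S′ ↭ allItems S × Below (weight (path S′)) (allItems S′)
  reroot S@(rooted L P B) with longest (weight P) (items L ++ items B) (weight-nonneg P)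
  ... | m , m∈ , below = let S′ , e , π = at m∈ in
        S′ , π , All-resp-↭ (↭-sym π) (subst (λ w → Below w (allItems S)) (sym e) below)
    where
    at : length′ m ∈ allItems S → ∃ λ S′ → weight (path S′) ≡ m × allItems S′ ↭ allItems S
    at (here refl) = S , refl , ↭-refl
    at (there i) with ∈-++⁻ (items L) i
    ... | inj₂ j = locate [] L P B j
    ... | inj₁ j = let S′ , e , π = locate [] B (reverse sy P) L j in S′ , e , ↭-trans π
          (subst (λ w → length′ w ∷ items B ++ items L ↭ allItems S) (sym (weight-reverse P))
            (prep _ (Bag.solve 2 (λ a b → b Bag.⊕ a Bag.⊜ a Bag.⊕ b) ↭-refl (items L) (items B))))

  Ordered : ∀ {v} → Branch v → Set
  Ordered (leaf _ _) = ⊤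
  Ordered (fork P l Q r) = weight P ≤ℚ weight Q × Ordered l × Ordered r
  Ordered (hang P l B) = Ordered l × Ordered B

  orient : ∀ {v} (B : Branch v) → ∃ λ (B′ : Branch v) → items B′ ↭ items B × Ordered B′
  orient (leaf t rt) = leaf t rt , ↭-refl , tt
  orient (fork P l Q r) with orient l | orient r | ℚₚ.≤-total (weight P) (weight Q)
  ... | l′ , πl , ol | r′ , πr , or | inj₁ le = fork P l′ Q r′ , prep _ (prep _ (prep _ (++⁺ πl πr))) , le , ol , or
  ... | l′ , πl , ol | r′ , πr , or | inj₂ ge = fork Q r′ P l′ ,
        prep _ (swap _ _ (↭-trans (++⁺ πr πl) (Bag.solve 2 (λ a b → b Bag.⊕ a Bag.⊜ a Bag.⊕ b) ↭-refl (items l) (items r)))) , ge , or , ol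
  orient (hang P l B) with orient l | orient B
  ... | l′ , πl , ol | B′ , πB , oB = hang P l′ B′ , prep _ (++⁺ πl πB) , ol , oB

  -- The terminal with which `v` is identified when the loss walks are contracted.
  rep : ∀ {v} → Branch v → Fin n
  rep (leaf t _) = t
  rep (fork P l Q r) = rep l
  rep (hang P l B) = rep B

  rep-terminal : ∀ {v} (B : Branch v) → T (R (rep B))
  rep-terminal (leaf t rt) = rt
  rep-terminal (fork P l Q r) = rep-terminal l
  rep-terminal (hang P l B) = rep-terminal B

  SomeWalk : Set
  SomeWalk = ∃₂ λ x y → Walk H x y

  -- Every fork is connected to the terminal rep of its subtree by its first child edge; contracting
  -- these loss walks turns the remaining child edges into edges between terminals.
  record Link : Set where
    constructor link
    field
      {x y} : Fin n
      s t : Fin n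
      sR : T (R s)
      tR : T (R t)
      walk : Walk H x y

  lossWalks : ∀ {v} → Branch v → List SomeWalk
  lossWalks (leaf _ _) = []
  lossWalks (fork P l Q r) = (_ , _ , P) ∷ lossWalks l ++ lossWalks r
  lossWalks (hang P l B) = lossWalks l ++ lossWalks B

  links : ∀ {v} → Branch v → List Link
  links (leaf _ _) = []
  links (fork P l Q r) = link (rep l) (rep r) (rep-terminal l) (rep-terminal r) Q ∷ links l ++ links r
  links (hang P l B) = link (rep B) (rep l) (rep-terminal B) (rep-terminal l) P ∷ links l ++ links B

  walksWeight : List SomeWalk → ℚ
  walksWeight [] = 0ℚ
  walksWeight ((_ , _ , P) ∷ Ps) = weight P +ℚ walksWeight Ps

  linksWeight : List Link → ℚ
  linksWeight [] = 0ℚ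
  linksWeight (e ∷ es) = weight (Link.walk e) +ℚ linksWeight es

  walksWeight-++ : ∀ Ps Qs → walksWeight (Ps ++ Qs) ≡ walksWeight Ps +ℚ walksWeight Qs
  walksWeight-++ [] Qs = sym (ℚₚ.+-identityˡ _)
  walksWeight-++ ((_ , _ , P) ∷ Ps) Qs = trans (cong (weight P +ℚ_) (walksWeight-++ Ps Qs)) (sym (ℚₚ.+-assoc (weight P) _ _))

  linksWeight-++ : ∀ es fs → linksWeight (es ++ fs) ≡ linksWeight es +ℚ linksWeight fs
  linksWeight-++ [] fs = sym (ℚₚ.+-identityˡ _)
  linksWeight-++ (e ∷ es) fs = trans (cong (weight (Link.walk e) +ℚ_) (linksWeight-++ es fs)) (sym (ℚₚ.+-assoc (weight (Link.walk e)) _ _))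

  loss : ∀ {v} → Branch v → ℚ
  loss B = walksWeight (lossWalks B)

  loss-fork : ∀ {v u u′} (P : Walk H v u) l (Q : Walk H v u′) r → loss (fork P l Q r) ≡ weight P +ℚ (loss l +ℚ loss r)
  loss-fork P l Q r = cong (weight P +ℚ_) (walksWeight-++ (lossWalks l) (lossWalks r))

  loss-hang : ∀ {v u} (P : Walk H v u) l B → loss (hang P l B) ≡ loss l +ℚ loss B
  loss-hang P l B = walksWeight-++ (lossWalks l) (lossWalks B)

  length-fork : ∀ {v u u′} (P : Walk H v u) l (Q : Walk H v u′) r →
    totalLength (items (fork P l Q r)) ≡ weight P +ℚ (weight Q +ℚ (totalLength (items l) +ℚ totalLength (items r)))
  length-fork P l Q r = cong (λ z → weight P +ℚ (weight Q +ℚ z)) (totalLength-++ (items l) (items r))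

  length-hang : ∀ {v u} (P : Walk H v u) l B →
    totalLength (items (hang P l B)) ≡ weight P +ℚ (totalLength (items l) +ℚ totalLength (items B))
  length-hang P l B = cong (weight P +ℚ_) (totalLength-++ (items l) (items B))

  loss+links : ∀ {v} (B : Branch v) → loss B +ℚ linksWeight (links B) ≡ totalLength (items B)
  loss+links (leaf _ _) = refl
  loss+links (fork P l Q r) rewrite loss-fork P l Q r | linksWeight-++ (links l) (links r) | length-fork P l Q r
      | sym (loss+links l) | sym (loss+links r) =
    lemma (weight P) (weight Q) (loss l) (loss r) (linksWeight (links l)) (linksWeight (links r))
    where
    lemma : ∀ p q a b d e → (p +ℚ (a +ℚ b)) +ℚ (q +ℚ (d +ℚ e)) ≡ p +ℚ (q +ℚ ((a +ℚ d) +ℚ (b +ℚ e)))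
    lemma = solve-∀ ℚ-ring
  loss+links (hang P l B) rewrite loss-hang P l B | linksWeight-++ (links l) (links B) | length-hang P l B
      | sym (loss+links l) | sym (loss+links B) =
    lemma (weight P) (loss l) (loss B) (linksWeight (links l)) (linksWeight (links B))
    where
    lemma : ∀ p a b d e → (a +ℚ b) +ℚ (p +ℚ (d +ℚ e)) ≡ p +ℚ ((a +ℚ d) +ℚ (b +ℚ e))
    lemma = solve-∀ ℚ-ring

  -- Each fork pairs its loss path with a sibling that is at least as long; hung paths only add
  -- length.
  2loss≤length : ∀ {v} (B : Branch v) → Ordered B → loss B +ℚ loss B ≤ℚ totalLength (items B)
  2loss≤length (leaf _ _) _ = ℚₚ.≤-refl
  2loss≤length (fork P l Q r) (le , ol , or) rewrite loss-fork P l Q r | length-fork P l Q r =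
    certify (0≤+ (≤⇒0≤- le) (0≤+ (≤⇒0≤- (2loss≤length l ol)) (≤⇒0≤- (2loss≤length r or))))
      (lemma (weight P) (weight Q) (loss l) (loss r) (totalLength (items l)) (totalLength (items r)))
    where
    lemma : ∀ p q a b d e → (p +ℚ (q +ℚ (d +ℚ e))) -ℚ ((p +ℚ (a +ℚ b)) +ℚ (p +ℚ (a +ℚ b))) ≡
      (q -ℚ p) +ℚ ((d -ℚ (a +ℚ a)) +ℚ (e -ℚ (b +ℚ b)))
    lemma = solve-∀ ℚ-ring
  2loss≤length (hang P l B) (ol , oB) rewrite loss-hang P l B | length-hang P l B =
    certify (0≤+ (weight-nonneg P) (0≤+ (≤⇒0≤- (2loss≤length l ol)) (≤⇒0≤- (2loss≤length B oB))))
      (lemma (weight P) (loss l) (loss B) (totalLength (items l)) (totalLength (items B)))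
    where
    lemma : ∀ p a b d e → (p +ℚ (d +ℚ e)) -ℚ ((a +ℚ b) +ℚ (a +ℚ b)) ≡
      p +ℚ ((d -ℚ (a +ℚ a)) +ℚ (e -ℚ (b +ℚ b)))
    lemma = solve-∀ ℚ-ring

  -- There is one loss path per fork, and `m` bounds each.
  loss≤branchings : ∀ {m v} (B : Branch v) → Below m (items B) → loss B ≤ℚ ℕ→ℚ (branchings (items B)) *ℚ m
  loss≤branchings {m} (leaf _ _) _ = ℚₚ.≤-reflexive (sym (ℚₚ.*-zeroˡ m))
  loss≤branchings {m} (fork P l Q r) (_ ∷ p ∷ _ ∷ bs)
    rewrite loss-fork P l Q r | branchings-++ (items l) (items r) | ℕ→ℚ-+ 1 (branchings (items l) + branchings (items r))
      | ℕ→ℚ-+ (branchings (items l)) (branchings (items r)) =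
    ℚₚ.≤-trans (ℚₚ.+-mono-≤ p (ℚₚ.+-mono-≤ (loss≤branchings l (Allₚ.++⁻ˡ (items l) bs)) (loss≤branchings r (Allₚ.++⁻ʳ (items l) bs))))
      (ℚₚ.≤-reflexive (lemma m (ℕ→ℚ (branchings (items l))) (ℕ→ℚ (branchings (items r)))))
    where
    lemma : ∀ m a b → m +ℚ (a *ℚ m +ℚ b *ℚ m) ≡ (1ℚ +ℚ (a +ℚ b)) *ℚ m
    lemma = solve-∀ ℚ-ring
  loss≤branchings {m} (hang P l B) (_ ∷ bs)
    rewrite loss-hang P l B | branchings-++ (items l) (items B) | ℕ→ℚ-+ (branchings (items l)) (branchings (items B)) =
    ℚₚ.≤-trans (ℚₚ.+-mono-≤ (loss≤branchings l (Allₚ.++⁻ˡ (items l) bs)) (loss≤branchings B (Allₚ.++⁻ʳ (items l) bs)))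
      (ℚₚ.≤-reflexive (sym (ℚₚ.*-distribʳ-+ m (ℕ→ℚ (branchings (items l))) (ℕ→ℚ (branchings (items B))))))

  ConstOnLinks : (Fin n → Fin n) → List Link → Set
  ConstOnLinks q = All (λ e → q (Link.s e) ≡ q (Link.t e))

  -- Inductively the links of a subtree join its terminals to its `rep`, and the link made at a fork
  -- or a hung child joins the two values of `rep`.
  links-span : ∀ q {v} (B : Branch v) → ConstOnLinks q (links B) → ∀ {x} → terminal x ∈ items B → q x ≡ q (rep B)
  links-span q (leaf t _) _ (here refl) = refl
  links-span q (fork P l Q r) (e ∷ es) (there (there (there i))) with ∈-++⁻ (items l) i
  ... | inj₁ j = links-span q l (Allₚ.++⁻ˡ (links l) es) j
  ... | inj₂ j = trans (links-span q r (Allₚ.++⁻ʳ (links l) es) j) (sym e)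
  links-span q (hang P l B) (e ∷ es) (there i) with ∈-++⁻ (items l) i
  ... | inj₁ j = trans (links-span q l (Allₚ.++⁻ˡ (links l) es) j) (sym e)
  ... | inj₂ j = links-span q B (Allₚ.++⁻ʳ (links l) es) j

  module _ (H′ : Subgraph n) (sy′ : Symm H′) where

    Present : List SomeWalk → Set
    Present = All (λ P → Walk H′ (proj₁ P) (proj₁ (proj₂ P)))

    -- What turns a kept link into a connection of its terminals: both ends of its walk reach,
    -- inside `H′`, the terminals they are contracted to. Keeping all loss walks ensures it.
    Attached : Link → Set
    Attached e = Walk H′ (Link.s e) (Link.x e) × Walk H′ (Link.y e) (Link.t e)

    to-rep : ∀ {v} (B : Branch v) → Present (lossWalks B) → Walk H′ v (rep B)
    to-rep (leaf _ _) _ = nil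
    to-rep (fork P l Q r) (p ∷ ps) = p ⊕ to-rep l (Allₚ.++⁻ˡ (lossWalks l) ps)
    to-rep (hang P l B) ps = to-rep B (Allₚ.++⁻ʳ (lossWalks l) ps)

    attached : ∀ {v} (B : Branch v) → Present (lossWalks B) → All Attached (links B)
    attached (leaf _ _) _ = []
    attached (fork P l Q r) (p ∷ ps) =
      (reverse sy′ (to-rep l pl) ⊕ reverse sy′ p , to-rep r pr) ∷ Allₚ.++⁺ (attached l pl) (attached r pr)
      where
      pl = Allₚ.++⁻ˡ (lossWalks l) ps
      pr = Allₚ.++⁻ʳ (lossWalks l) ps
    attached (hang P l B) ps = (reverse sy′ (to-rep B pB) , to-rep l pl) ∷ Allₚ.++⁺ (attached l pl) (attached B pB)
      where
      pl = Allₚ.++⁻ˡ (lossWalks l) ps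
      pB = Allₚ.++⁻ʳ (lossWalks l) ps

-- From spanning trees to suppressed trees.

unique-++ : ∀ {A : Set} (xs : List A) {ys} → Unique (xs ++ ys) → Unique xs × Unique ys × (∀ {x} → x ∈ xs → x ∉ ys)
unique-++ [] u = [] , u , λ ()
unique-++ (x ∷ xs) (d ∷ u) with ux , uy , dis ← unique-++ xs u =
  Allₚ.++⁻ˡ xs d ∷ ux , uy , λ { (here refl) j → All.lookup (Allₚ.++⁻ʳ xs d) j refl ; (there i) → dis i }

map-++⁻ : ∀ {A B : Set} (f : A → B) xs {ys} as → map f as ≡ xs ++ ys → ∃₂ λ bs cs → as ≡ bs ++ cs × map f bs ≡ xs × map f cs ≡ ys
map-++⁻ f [] as e = [] , as , refl , refl , e
map-++⁻ f (x ∷ xs) (a ∷ as) e with ∷-injective e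
... | e₀ , es with bs , cs , refl , e₁ , e₂ ← map-++⁻ f xs as es = a ∷ bs , cs , refl , cong₂ _∷_ e₀ e₁ , e₂

module Terminals {n : ℕ} (R : Fin n → Bool) where

  steiner? : ∀ v → Dec (T (not (R v)))
  steiner? v = T? (not (R v))

  steinerCount : List (Fin n) → ℕ
  steinerCount vs = length (filter steiner? vs)

  steinerCount-++ : ∀ vs ws → steinerCount (vs ++ ws) ≡ steinerCount vs + steinerCount ws
  steinerCount-++ [] ws = refl
  steinerCount-++ (v ∷ vs) ws with does (steiner? v)
  ... | true = cong suc (steinerCount-++ vs ws)
  ... | false = steinerCount-++ vs ws

  steinerCount-≥ : ∀ v vs → steinerCount vs ≤ steinerCount (v ∷ vs)
  steinerCount-≥ v vs with does (steiner? v)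
  ... | true = ℕₚ.n≤1+n _
  ... | false = ℕₚ.≤-refl

  parent-unique : ∀ (p : Fin n) f → Unique (vertices f) → ∀ {x x′ v} → (x , v) ∈ edges p f → (x′ , v) ∈ edges p f → x ≡ x′
  parent-unique p (node v c s) u (here refl) (here refl) = refl
  parent-unique p (node v c s) (d ∷ u) (here refl) (there j) with ∈-++⁻ (edges v c) j
  ... | inj₁ k = ⊥-elim (All.lookup d (∈-++⁺ˡ (edge-child v c k)) refl)
  ... | inj₂ k = ⊥-elim (All.lookup d (∈-++⁺ʳ (vertices c) (edge-child p s k)) refl)
  parent-unique p (node v c s) (d ∷ u) (there i) (here refl) with ∈-++⁻ (edges v c) i
  ... | inj₁ k = ⊥-elim (All.lookup d (∈-++⁺ˡ (edge-child v c k)) refl)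
  ... | inj₂ k = ⊥-elim (All.lookup d (∈-++⁺ʳ (vertices c) (edge-child p s k)) refl)
  parent-unique p (node v c s) (d ∷ u) (there i) (there j) with unique-++ (vertices c) u | ∈-++⁻ (edges v c) i | ∈-++⁻ (edges v c) j
  ... | uc , us , dis | inj₁ k | inj₁ l = parent-unique v c uc k l
  ... | uc , us , dis | inj₁ k | inj₂ l = ⊥-elim (dis (edge-child v c k) (edge-child p s l))
  ... | uc , us , dis | inj₂ k | inj₁ l = ⊥-elim (dis (edge-child v c l) (edge-child p s k))
  ... | uc , us , dis | inj₂ k | inj₂ l = parent-unique p s us k l

  module _ (H : Subgraph n) where

    -- The second component excludes Steiner leaves, for which `Branch` has no constructor.
    Valid : Fin n → Forest → Set
    Valid p empty = ⊤
    Valid p (node v c s) = T (H p v) × (c ≡ empty → T (R v)) × Valid v c × Valid p s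

    valid : ∀ p f → Unique (p ∷ vertices f) → All (λ e → T (H (proj₁ e) (proj₂ e))) (edges p f) →
      (∀ v → v ∈ vertices f → (∀ z → (v , z) ∉ edges p f) → T (R v)) → Valid p f
    valid p empty u ins lf = tt
    valid p (node v c s) (dp@(p≢v ∷ dp′) ∷ dv ∷ u) (t ∷ ts) lf with unique-++ (vertices c) u
    ... | uc , us , dis =
        t , (λ { refl → lf v (here refl) childless }) ,
        valid v c (Allₚ.++⁻ˡ (vertices c) dv ∷ uc) (Allₚ.++⁻ˡ (edges v c) ts)
          (λ x i none → lf x (there (∈-++⁺ˡ i)) λ { z (here refl) → All.lookup dp (there (∈-++⁺ˡ i)) refl
                                                  ; z (there j) → inC x i none z (∈-++⁻ (edges v c) j) }) ,
        valid p s (Allₚ.++⁻ʳ (vertices c) dp′ ∷ us) (Allₚ.++⁻ʳ (edges v c) ts)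
          (λ x i none → lf x (there (∈-++⁺ʳ (vertices c) i)) λ { z (here refl) → All.lookup dp (there (∈-++⁺ʳ (vertices c) i)) refl
                                                  ; z (there j) → inS x i none z (∈-++⁻ (edges v c) j) })
      where
      childless : ∀ z → (v , z) ∉ (p , v) ∷ edges p s
      childless z (here refl) = p≢v refl
      childless z (there j) with edge-parent p s j
      ... | here e = p≢v (sym e)
      ... | there k = All.lookup (Allₚ.++⁻ʳ (vertices c) dv) k refl
      inC : ∀ x → x ∈ vertices c → (∀ z → (x , z) ∉ edges v c) → ∀ z → (x , z) ∈ edges v c ⊎ (x , z) ∈ edges p s → ⊥
      inC x i none z (inj₁ j) = none z j
      inC x i none z (inj₂ j) with edge-parent p s j
      ... | here refl = All.lookup (Allₚ.++⁻ˡ (vertices c) dp′) i refl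
      ... | there k = dis i k
      inS : ∀ x → x ∈ vertices s → (∀ z → (x , z) ∉ edges p s) → ∀ z → (x , z) ∈ edges v c ⊎ (x , z) ∈ edges p s → ⊥
      inS x i none z (inj₂ j) = none z j
      inS x i none z (inj₁ j) with edge-parent v c j
      ... | here refl = All.lookup (Allₚ.++⁻ʳ (vertices c) dv) i refl
      ... | there k = dis k i

module Suppress {n : ℕ} (G : Graph n) (R : Fin n → Bool) (H : Subgraph n) (sy : Symm H) (hG : H ⊑ adj G) where
  open Costs G
  open Branches G R H sy hG
  open Terminals R

  -- `walk` starts with the edge from `p` to `v` and runs on through Steiner vertices with a single
  -- child. Such vertices are not forks, so `few` is only an inequality.
  record Converted (p v : Fin n) (children : Forest) : Set where
    field
      {u} : Fin n
      walk : Walk H p u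
      branch : Branch u
      len : weight walk +ℚ totalLength (items branch) ≡ c G p v +ℚ edgeCost (edges v children)
      few : branchings (items branch) ≤ steinerCount (v ∷ vertices children)
      all : ∀ x → x ∈ v ∷ vertices children → T (R x) → terminal x ∈ items branch

  record Hung (p : Fin n) (B : Branch p) (s : Forest) : Set where
    field
      branch : Branch p
      len : totalLength (items branch) ≡ totalLength (items B) +ℚ edgeCost (edges p s)
      few : branchings (items branch) ≤ branchings (items B) + steinerCount (vertices s)
      base : ∀ x → terminal x ∈ items B → terminal x ∈ items branch
      all : ∀ x → x ∈ vertices s → T (R x) → terminal x ∈ items branch

  -- A terminal becomes a leaf with its children hung on it, a Steiner vertex with one child
  -- lengthens the walk, and one with several becomes a fork of the first two with the others hung.
  -- Every fork is thus charged to its own Steiner vertex.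
  convert : ∀ p v f → T (H p v) → (f ≡ empty → T (R v)) → Valid H v f → Converted p v f
  hangForest : ∀ p B s → Valid H p s → Hung p B s

  hangForest p B empty _ = record
    { branch = B ; len = sym (ℚₚ.+-identityʳ _) ; few = ℕₚ.m≤m+n _ _ ; base = λ _ i → i ; all = λ _ () }
  hangForest p B (node v f s) (pv , lf , vf , vs) = record
    { branch = S.branch
    ; len = begin
        totalLength (items S.branch)
          ≡⟨ S.len ⟩
        totalLength (items (hang C.walk C.branch B)) +ℚ edgeCost (edges p s)
          ≡⟨ cong (_+ℚ edgeCost (edges p s)) (length-hang C.walk C.branch B) ⟩
        (weight C.walk +ℚ (totalLength (items C.branch) +ℚ totalLength (items B))) +ℚ edgeCost (edges p s)
          ≡⟨ lemma₁ (weight C.walk) (totalLength (items C.branch)) (totalLength (items B)) (edgeCost (edges p s)) ⟩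
        totalLength (items B) +ℚ ((weight C.walk +ℚ totalLength (items C.branch)) +ℚ edgeCost (edges p s))
          ≡⟨ cong (λ z → totalLength (items B) +ℚ (z +ℚ edgeCost (edges p s))) C.len ⟩
        totalLength (items B) +ℚ ((c G p v +ℚ edgeCost (edges v f)) +ℚ edgeCost (edges p s))
          ≡⟨ cong (totalLength (items B) +ℚ_) (trans (ℚₚ.+-assoc (c G p v) _ _) (cong (c G p v +ℚ_) (sym (edgeCost-++ (edges v f) (edges p s))))) ⟩
        totalLength (items B) +ℚ edgeCost (edges p (node v f s)) ∎
    ; few = ℕₚ.≤-trans S.few (ℕₚ.≤-trans (ℕₚ.+-monoˡ-≤ (steinerCount (vertices s))
              (ℕₚ.≤-trans (ℕₚ.≤-reflexive (branchings-++ (items C.branch) (items B))) (ℕₚ.+-monoˡ-≤ (branchings (items B)) C.few)))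
              (ℕₚ.≤-reflexive (trans (cong (_+ steinerCount (vertices s)) (ℕₚ.+-comm (steinerCount (v ∷ vertices f)) (branchings (items B))))
                (trans (ℕₚ.+-assoc (branchings (items B)) _ _) (cong (λ z → branchings (items B) + z) (sym (steinerCount-++ (v ∷ vertices f) (vertices s))))))))
    ; base = λ x i → S.base x (there (∈-++⁺ʳ (items C.branch) i))
    ; all = all′
    }
    where
    open ≡-Reasoning
    module C = Converted (convert p v f pv lf vf)
    module S = Hung (hangForest p (hang C.walk C.branch B) s vs)
    lemma₁ : ∀ w b d e → (w +ℚ (b +ℚ d)) +ℚ e ≡ d +ℚ ((w +ℚ b) +ℚ e)
    lemma₁ = solve-∀ ℚ-ring
    all′ : ∀ x → x ∈ v ∷ vertices f ++ vertices s → T (R x) → terminal x ∈ items S.branch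
    all′ x i rx with ∈-++⁻ (v ∷ vertices f) i
    ... | inj₁ j = S.base x (there (∈-++⁺ˡ (C.all x j rx)))
    ... | inj₂ j = S.all x j rx

  convert p v f pv lf vf with T? (R v)
  convert p v f pv lf vf | yes rv = record
    { walk = cons pv nil ; branch = B.branch
    ; len = cong₂ _+ℚ_ (ℚₚ.+-identityʳ (c G p v)) (trans B.len (ℚₚ.+-identityˡ _))
    ; few = ℕₚ.≤-trans B.few (steinerCount-≥ v (vertices f))
    ; all = λ { x (here refl) _ → B.base x (here refl) ; x (there i) rx → B.all x i rx } }
    where
    module B = Hung (hangForest v (leaf v rv) f vf)
  convert p v empty pv lf vf | no nrv = ⊥-elim (nrv (lf refl))
  convert p v (node x f empty) pv lf (vx , lfx , vf , _) | no nrv = record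
    { walk = cons pv C.walk ; branch = C.branch
    ; len = trans (ℚₚ.+-assoc (c G p v) _ _) (cong (c G p v +ℚ_) (trans C.len
              (trans (sym (ℚₚ.+-identityʳ _)) (trans (ℚₚ.+-assoc (c G v x) _ _) (cong (c G v x +ℚ_) (sym (edgeCost-++ (edges x f) [])))))))
    ; few = ℕₚ.≤-trans C.few (ℕₚ.≤-trans (ℕₚ.m≤m+n _ 0) (ℕₚ.≤-trans (ℕₚ.≤-reflexive (sym (steinerCount-++ (x ∷ vertices f) []))) (steinerCount-≥ v (x ∷ vertices f ++ []))))
    ; all = λ { y (here refl) ry → ⊥-elim (nrv ry) ; y (there i) ry → C.all y (unpad i) ry } }
    where
    module C = Converted (convert v x f vx lfx vf)
    unpad : ∀ {y} → y ∈ x ∷ vertices f ++ [] → y ∈ x ∷ vertices f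
    unpad i with ∈-++⁻ (x ∷ vertices f) i
    ... | inj₁ j = j
  convert p v (node x f (node x′ f′ s)) pv lf (vx , lfx , vf , vx′ , lfx′ , vf′ , vs) | no nrv = record
    { walk = cons pv nil ; branch = S.branch
    ; len = begin
        (c G p v +ℚ 0ℚ) +ℚ totalLength (items S.branch)
          ≡⟨ cong₂ _+ℚ_ (ℚₚ.+-identityʳ (c G p v)) S.len ⟩
        c G p v +ℚ (totalLength (items K) +ℚ E₃)
          ≡⟨ cong (λ z → c G p v +ℚ (z +ℚ E₃)) (length-fork C.walk C.branch D.walk D.branch) ⟩
        c G p v +ℚ ((weight C.walk +ℚ (weight D.walk +ℚ (totalLength (items C.branch) +ℚ totalLength (items D.branch)))) +ℚ E₃)
          ≡⟨ cong (c G p v +ℚ_) (lemma₁ (weight C.walk) (weight D.walk) (totalLength (items C.branch)) (totalLength (items D.branch)) E₃) ⟩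
        c G p v +ℚ ((weight C.walk +ℚ totalLength (items C.branch)) +ℚ ((weight D.walk +ℚ totalLength (items D.branch)) +ℚ E₃))
          ≡⟨ cong₂ (λ y z → c G p v +ℚ (y +ℚ (z +ℚ E₃))) C.len D.len ⟩
        c G p v +ℚ ((c G v x +ℚ edgeCost (edges x f)) +ℚ ((c G v x′ +ℚ edgeCost (edges x′ f′)) +ℚ E₃))
          ≡⟨ cong (c G p v +ℚ_) (trans (ℚₚ.+-assoc (c G v x) _ _) (cong (c G v x +ℚ_) (sym (trans (edgeCost-++ (edges x f) ((v , x′) ∷ edges x′ f′ ++ edges v s))
               (cong (edgeCost (edges x f) +ℚ_) (trans (cong (c G v x′ +ℚ_) (edgeCost-++ (edges x′ f′) (edges v s))) (sym (ℚₚ.+-assoc (c G v x′) _ _)))))))) ⟩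
        c G p v +ℚ edgeCost (edges v (node x f (node x′ f′ s))) ∎
    ; few = few′
    ; all = λ { y (here refl) ry → ⊥-elim (nrv ry) ; y (there i) ry → all′ y i ry } }
    where
    open ≡-Reasoning
    module C = Converted (convert v x f vx lfx vf)
    module D = Converted (convert v x′ f′ vx′ lfx′ vf′)
    K = fork C.walk C.branch D.walk D.branch
    module S = Hung (hangForest v K s vs)
    E₃ = edgeCost (edges v s)
    lemma₁ : ∀ w y b d e → (w +ℚ (y +ℚ (b +ℚ d))) +ℚ e ≡ (w +ℚ b) +ℚ ((y +ℚ d) +ℚ e)
    lemma₁ = solve-∀ ℚ-ring
    few′ : branchings (items S.branch) ≤ steinerCount (v ∷ x ∷ vertices f ++ x′ ∷ vertices f′ ++ vertices s)
    few′ = subst (branchings (items S.branch) ≤_) (sym (cong length (filter-accept steiner? (not-intro nrv)))) (ℕₚ.≤-trans S.few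
      (s≤s (ℕₚ.≤-trans (ℕₚ.+-monoˡ-≤ (steinerCount (vertices s)) (ℕₚ.≤-trans (ℕₚ.≤-reflexive (branchings-++ (items C.branch) (items D.branch))) (ℕₚ.+-mono-≤ C.few D.few)))
        (ℕₚ.≤-reflexive (trans (ℕₚ.+-assoc (steinerCount (x ∷ vertices f)) _ _) (sym (trans (steinerCount-++ (x ∷ vertices f) (x′ ∷ vertices f′ ++ vertices s))
           (cong (λ z → steinerCount (x ∷ vertices f) + z) (steinerCount-++ (x′ ∷ vertices f′) (vertices s))))))))))
    all′ : ∀ y → y ∈ x ∷ vertices f ++ x′ ∷ vertices f′ ++ vertices s → T (R y) → terminal y ∈ items S.branch
    all′ y i ry with ∈-++⁻ (x ∷ vertices f) i
    ... | inj₁ j = S.base y (there (there (there (∈-++⁺ˡ (C.all y j ry)))))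
    ... | inj₂ j with ∈-++⁻ (x′ ∷ vertices f′) j
    ...   | inj₁ k = S.base y (there (there (there (∈-++⁺ʳ (items C.branch) (D.all y k ry)))))
    ...   | inj₂ k = S.all y k ry

-- Priced edges between terminals.

module TerminalEdges {n : ℕ} where

  TerminalEdge : Set
  TerminalEdge = Fin n × Fin n × ℚ

  open Kruskal {n} {TerminalEdge} proj₁ (λ e → proj₁ (proj₂ e)) (λ e → proj₂ (proj₂ e)) public

  price : TerminalEdge → ℚ
  price e = proj₂ (proj₂ e)

  total-++ : ∀ es fs → total (es ++ fs) ≡ total es +ℚ total fs
  total-++ [] fs = sym (ℚₚ.+-identityˡ _)
  total-++ (e ∷ es) fs = trans (cong (price e +ℚ_) (total-++ es fs)) (sym (ℚₚ.+-assoc (price e) _ _))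

  private
    interchange : ∀ a b d → a +ℚ (b +ℚ d) ≡ b +ℚ (a +ℚ d)
    interchange = solve-∀ ℚ-ring

  total-↭ : ∀ {es fs} → es ↭ fs → total es ≡ total fs
  total-↭ _↭_.refl = refl
  total-↭ (prep e p) = cong (price e +ℚ_) (total-↭ p)
  total-↭ (swap {ys = fs} e f p) = trans (cong (λ z → price e +ℚ (price f +ℚ z)) (total-↭ p)) (interchange (price e) (price f) (total fs))
  total-↭ (_↭_.trans p q) = trans (total-↭ p) (total-↭ q)

  dropped-++ : ∀ bs cs → dropped (bs ++ cs) ≡ dropped bs +ℚ dropped cs
  dropped-++ [] cs = sym (ℚₚ.+-identityˡ _)
  dropped-++ ((true , e) ∷ bs) cs = dropped-++ bs cs
  dropped-++ ((false , e) ∷ bs) cs = trans (cong (price e +ℚ_) (dropped-++ bs cs)) (sym (ℚₚ.+-assoc (price e) _ _))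

  dropped-↭ : ∀ {bs cs} → bs ↭ cs → dropped bs ≡ dropped cs
  dropped-↭ _↭_.refl = refl
  dropped-↭ (prep (true , _) p) = dropped-↭ p
  dropped-↭ (prep (false , e) p) = cong (price e +ℚ_) (dropped-↭ p)
  dropped-↭ (swap (true , _) (true , _) p) = dropped-↭ p
  dropped-↭ (swap (true , _) (false , f) p) = cong (price f +ℚ_) (dropped-↭ p)
  dropped-↭ (swap (false , e) (true , _) p) = cong (price e +ℚ_) (dropped-↭ p)
  dropped-↭ (swap {ys = cs} (false , e) (false , f) p) =
    trans (cong (λ z → price e +ℚ (price f +ℚ z)) (dropped-↭ p)) (interchange (price e) (price f) (dropped cs))
  dropped-↭ (_↭_.trans p q) = trans (dropped-↭ p) (dropped-↭ q)

-- The upper bound: loss contraction, exchange and comparison with the fractional solution.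

module UpperBound {n : ℕ} (G : Graph n) (R : Fin n → Bool) (r b : ℕ) (qb : QuasiBipartite b G R) where
  open Costs G
  open Pieces G R
  open Optimum G R
  open TerminalEdges {n}

  -- All that the exchange argument uses of a solution. `heavy` is the ratio `(b + 1) / (2 b + 1)`
  -- with denominators cleared. `swap-out` treats all dropped edges at once and accepts the edges in
  -- any order, since `F` is sorted by price only after the contractions of the single components
  -- have been concatenated.
  record LossContraction (Ys : IntSol n) : Set where
    field
      F : List TerminalEdge
      nonneg : All (λ e → 0ℚ ≤ℚ price e) F
      ends : All (λ e → T (R (proj₁ e)) × T (R (proj₁ (proj₂ e)))) F
      spans : ∀ q → ConstOn q F → Ties Ys q
      heavy : ℕ→ℚ (suc b) *ℚ intCost G Ys ≤ℚ ℕ→ℚ (2 * b + 1) *ℚ total F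
      swap-out : ∀ bs → map proj₂ bs ↭ F → ∃ λ Zs → All (FullR r) Zs ×
        intCost G Zs +ℚ dropped bs ≤ℚ intCost G Ys × (∀ q → Ties Zs q → ConstOnKept q bs)

  module Single (H : Subgraph n) (hG : H ⊑ adj G) (sy : Symm H)
                (connected : ∀ u v → 1 ≤ deg H u → 1 ≤ deg H v → Walk H u v) (acyclic : ¬ Cycle H)
                (internal : ∀ u → 2 ≤ deg H u → Steiner R u) (leaves : ∀ u → deg H u ≡ 1 → T (R u))
                (several : 2 ≤ countFin (termSet R H)) (few-terminals : countFin (termSet R H) ≤ r) where
    open Branches G R H sy hG
    open Suppress G R H sy hG
    open SpanningForest G
    open Terminals R

    -- No terminal has two neighbours in `H`, so a walk entering one must turn back at once, and
    -- this detour is cut out.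
    steiner-walk : ∀ {x y} → T (not (R x)) → T (not (R y)) → Walk H x y → Walk (steinerAdj G R) x y
    steiner-walk sx sy′ nil = nil
    steiner-walk {x} sx sy′ (cons {v = z} e P) with T? (R z)
    steiner-walk {x} sx sy′ (cons {v = z} e P) | no nz = cons (∧-intro (hG x z e) (∧-intro sx (not-intro nz))) (steiner-walk (not-intro nz) sy′ P)
    steiner-walk {x} sx sy′ (cons {v = z} e nil) | yes rz = ⊥-elim (not-elim sy′ rz)
    steiner-walk {x} sx sy′ (cons {v = z} e (cons {v = w} e′ P)) | yes rz with x ≟ w
    ... | yes refl = steiner-walk sx sy′ P
    ... | no ne = ⊥-elim (not-elim (internal z (countFin-two (H z) x w ne (flip sy e) e′)) rz)

    -- The Steiner vertices of a full component share one Steiner neighborhood; `b + 1` distinct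
    -- ones would contradict `qb`.
    steinerCount≤b : ∀ vs → Unique vs → All (λ v → 1 ≤ deg H v) vs → steinerCount vs ≤ b
    steinerCount≤b vs u ds with steinerCount vs ℕₚ.≤? b
    ... | yes le = le
    ... | no nle = ⊥-elim (qb (at zero) (steiner zero) at injective λ i → steiner i ,
            steiner-walk (steiner zero) (steiner i) (connected _ _ (deg≥1 zero) (deg≥1 i)))
      where
      ss = filter steiner? vs
      at : Fin (suc b) → Fin n
      at i = lookup ss (inject≤ i (ℕₚ.≰⇒> nle))
      at∈ : ∀ i → at i ∈ vs × T (not (R (at i)))
      at∈ i = ∈-filter⁻ steiner? {xs = vs} (∈-lookup {xs = ss} (inject≤ i (ℕₚ.≰⇒> nle)))
      steiner : ∀ i → T (not (R (at i)))
      steiner i = proj₂ (at∈ i)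
      deg≥1 : ∀ i → 1 ≤ deg H (at i)
      deg≥1 i = All.lookup ds (proj₁ (at∈ i))
      injective : ∀ {i j} → at i ≡ at j → i ≡ j
      injective e = Finₚ.inject≤-injective _ _ _ _ (lookup-injective (Uniqueₚ.filter⁺ steiner? u) e)

    record Tree : Set where
      field
        tree : Rooted
        tree-length : totalLength (Rooted.allItems tree) ≡ cost H
        tree-branchings : branchings (Rooted.allItems tree) ≤ b
        tree-terminals : ∀ x → T (termSet R H x) → terminal x ∈ Rooted.allItems tree

    module WithForest (a : Fin n) (aR : T (R a)) (a-deg : 1 ≤ deg H a) (f : Forest) (spans : Spanning H a f) where
     module F = Spanning spans

     vertex-deg : ∀ v → v ∈ vertices f → 1 ≤ deg H v
     vertex-deg v i = let p , j = child-edge a f i in countFin-pos (H v) p (flip sy (All.lookup F.inside j))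

     isValid : Valid H a f
     isValid = valid H a f F.distinct F.inside leafOK
       where
       leafOK : ∀ v → v ∈ vertices f → (∀ z → (v , z) ∉ edges a f) → T (R v)
       -- Every neighbour of a childless vertex is its parent, and parents are unique, so its degree
       -- is one.
       leafOK v i childless = leaves v (ℕₚ.≤-antisym (ℕₚ.≤-pred (ℕₚ.≰⇒> two)) (vertex-deg v i))
         where
         parent : ∀ z → T (H v z) → (z , v) ∈ edges a f
         parent z t with F.covers v z (connected a v a-deg (vertex-deg v i)) t
         ... | inj₁ j = ⊥-elim (childless z j)
         ... | inj₂ j = j
         two : ¬ (2 ≤ deg H v)
         two d = let x , y , ne , vx , vy = countFin-two⁻ (H v) d in
           ne (parent-unique a f (AllPairs.tail F.distinct) (parent x vx) (parent y vy))

     edge-in-forest : ∀ x y → T (H x y) → (x , y) ∈ edges a f ⊎ (y , x) ∈ edges a f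
     edge-in-forest x y t = F.covers x y (connected a x a-deg (countFin-pos (H x) y t)) t

     cost≡ : cost H ≡ edgeCost (edges a f)
     cost≡ = ℚₚ.≤-antisym
       (ℚₚ.≤-trans (cost-mono (fromEdges-⊑ (adj-sym G) (edges a f) insideG) sub) (fromEdges-cost (edges a f) insideG))
       F.weight≤
       where
       insideG : All (λ e → T (adj G (proj₁ e) (proj₂ e))) (edges a f)
       insideG = All.map (λ {e} → hG (proj₁ e) (proj₂ e)) F.inside
       sub : H ⊑ fromEdges (edges a f)
       sub x y t with edge-in-forest x y t
       ... | inj₁ i = proj₁ (fromEdges-intro (edges a f) i)
       ... | inj₂ i = proj₂ (fromEdges-intro (edges a f) i)

     initial : Tree
     initial = build f isValid (λ x t → Spanning.reaches spans sy (connected a x a-deg (T-<ᵇ⁻ (∧-snd {R x} t))))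
         (sym cost≡) (steinerCount≤b (vertices f) (AllPairs.tail F.distinct) (All.tabulate λ {v} → vertex-deg v)) edge-in-forest
       where
       build : ∀ g → Valid H a g → (∀ x → T (termSet R H x) → x ∈ a ∷ vertices g) → edgeCost (edges a g) ≡ cost H →
         steinerCount (vertices g) ≤ b → (∀ x y → T (H x y) → (x , y) ∈ edges a g ⊎ (y , x) ∈ edges a g) → Tree
       build empty _ _ _ _ cover with countFin-pos⁻ (H a) a-deg
       ... | z , az with cover a z az
       ...   | inj₁ ()
       ...   | inj₂ ()
       -- The path through the first child of `a` is the initial root path; further children of `a`
       -- are hung on the leaf `a`.
       build (node v g s) (av , lf , vg , vs) reach costs count _ =
         assemble (convert a v g av lf vg) (hangForest a (leaf a aR) s vs)
         where
         assemble : Converted a v g → Hung a (leaf a aR) s → Tree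
         assemble C L = record
           { tree = rooted L.branch C.walk C.branch
           ; tree-length = begin
               weight C.walk +ℚ totalLength (items L.branch ++ items C.branch)
                 ≡⟨ cong (weight C.walk +ℚ_) (trans (totalLength-++ (items L.branch) (items C.branch)) (cong (_+ℚ totalLength (items C.branch)) (trans L.len (ℚₚ.+-identityˡ (edgeCost (edges a s)))))) ⟩
               weight C.walk +ℚ (edgeCost (edges a s) +ℚ totalLength (items C.branch))
                 ≡⟨ lemma (weight C.walk) (edgeCost (edges a s)) (totalLength (items C.branch)) ⟩
               (weight C.walk +ℚ totalLength (items C.branch)) +ℚ edgeCost (edges a s)
                 ≡⟨ cong (_+ℚ edgeCost (edges a s)) C.len ⟩
               (c G a v +ℚ edgeCost (edges v g)) +ℚ edgeCost (edges a s)
                 ≡⟨ trans (ℚₚ.+-assoc (c G a v) _ _) (cong (c G a v +ℚ_) (sym (edgeCost-++ (edges v g) (edges a s)))) ⟩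
               edgeCost (edges a (node v g s))
                 ≡⟨ costs ⟩
               cost H ∎
           ; tree-branchings = ℕₚ.≤-trans (ℕₚ.≤-reflexive (branchings-++ (items L.branch) (items C.branch)))
               (ℕₚ.≤-trans (ℕₚ.+-mono-≤ L.few C.few) (ℕₚ.≤-trans (ℕₚ.≤-reflexive
                 (trans (ℕₚ.+-comm (steinerCount (vertices s)) _) (sym (steinerCount-++ (v ∷ vertices g) (vertices s))))) count))
           ; tree-terminals = all
           }
           where
           open ≡-Reasoning
           module C = Converted C
           module L = Hung L
           lemma : ∀ w x y → w +ℚ (x +ℚ y) ≡ (w +ℚ y) +ℚ x
           lemma = solve-∀ ℚ-ring
           all : ∀ x → T (termSet R H x) → terminal x ∈ length′ (weight C.walk) ∷ items L.branch ++ items C.branch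
           all x t with reach x t
           ... | here refl = there (∈-++⁺ˡ (L.base a (here refl)))
           ... | there i with ∈-++⁻ (v ∷ vertices g) i
           ...   | inj₁ j = there (∈-++⁺ʳ (items L.branch) (C.all x j (∧-fst t)))
           ...   | inj₂ j = there (∈-++⁺ˡ (L.all x j (∧-fst t)))

    toEdge : Link → TerminalEdge
    toEdge e = Link.s e , Link.t e , weight (Link.walk e)

    total-links : ∀ es → total (map toEdge es) ≡ linksWeight es
    total-links [] = refl
    total-links (e ∷ es) = cong (weight (Link.walk e) +ℚ_) (total-links es)

    walkEdges : ∀ {u v} → Walk H u v → List (Fin n × Fin n)
    walkEdges nil = []
    walkEdges (cons {u} {v} _ P) = (u , v) ∷ walkEdges P

    allEdges : List SomeWalk → List (Fin n × Fin n)
    allEdges [] = []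
    allEdges ((_ , _ , P) ∷ Ps) = walkEdges P ++ allEdges Ps

    walkEdges-inside : ∀ {u v} (P : Walk H u v) → All (λ e → T (H (proj₁ e) (proj₂ e))) (walkEdges P)
    walkEdges-inside nil = []
    walkEdges-inside (cons t P) = t ∷ walkEdges-inside P

    allEdges-inside : ∀ Ps → All (λ e → T (H (proj₁ e) (proj₂ e))) (allEdges Ps)
    allEdges-inside [] = []
    allEdges-inside ((_ , _ , P) ∷ Ps) = Allₚ.++⁺ (walkEdges-inside P) (allEdges-inside Ps)

    walkEdges-cost : ∀ {u v} (P : Walk H u v) → edgeCost (walkEdges P) ≡ weight P
    walkEdges-cost nil = refl
    walkEdges-cost (cons {u} {v} _ P) = cong (c G u v +ℚ_) (walkEdges-cost P)

    allEdges-cost : ∀ Ps → edgeCost (allEdges Ps) ≡ walksWeight Ps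
    allEdges-cost [] = refl
    allEdges-cost ((_ , _ , P) ∷ Ps) = trans (edgeCost-++ (walkEdges P) (allEdges Ps)) (cong₂ _+ℚ_ (walkEdges-cost P) (allEdges-cost Ps))

    walk-within : ∀ (H′ : Subgraph n) {u v} (P : Walk H u v) → (∀ {x y} → (x , y) ∈ walkEdges P → T (H′ x y)) → Walk H′ u v
    walk-within H′ nil h = nil
    walk-within H′ (cons t P) h = cons (h (here refl)) (walk-within H′ P λ i → h (there i))

    present : ∀ H′ sy′ Ps → (∀ {x y} → (x , y) ∈ allEdges Ps → T (H′ x y)) → Present H′ sy′ Ps
    present H′ sy′ [] h = []
    present H′ sy′ ((_ , _ , P) ∷ Ps) h = walk-within H′ P (λ i → h (∈-++⁺ˡ i)) ∷ present H′ sy′ Ps λ i → h (∈-++⁺ʳ (walkEdges P) i)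

    Joined : Subgraph n → Bool × TerminalEdge → Set
    Joined H′ (k , s , t , _) = T k → T (R s) × T (R t) × Walk H′ s t

    -- `Ks` collects the walks of the kept links. Any subgraph that contains them, and in which
    -- their ends are attached, joins the terminals of each kept edge.
    keptWalks : ∀ es bs → map proj₂ bs ≡ map toEdge es → ∃ λ Ks → walksWeight Ks +ℚ dropped bs ≡ linksWeight es ×
      (∀ H′ sy′ → Present H′ sy′ Ks → All (Attached H′ sy′) es → All (Joined H′) bs)
    keptWalks [] [] e = [] , refl , λ _ _ _ _ → []
    keptWalks (e ∷ es) ((k , _) ∷ bs) eq with ∷-injective eq
    ... | refl , eqs with keptWalks es bs eqs
    keptWalks (e ∷ es) ((true , _) ∷ bs) eq | refl , eqs | Ks , ws , joins =
      (_ , _ , Link.walk e) ∷ Ks , trans (ℚₚ.+-assoc (weight (Link.walk e)) _ _) (cong (weight (Link.walk e) +ℚ_) ws) ,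
      λ { H′ sy′ (p ∷ ps) ((p₁ , p₂) ∷ as) → (λ _ → Link.sR e , Link.tR e , p₁ ⊕ p ⊕ p₂) ∷ joins H′ sy′ ps as }
    keptWalks (e ∷ es) ((false , _) ∷ bs) eq | refl , eqs | Ks , ws , joins =
      Ks , trans (lemma (walksWeight Ks) (weight (Link.walk e)) (dropped bs)) (cong (weight (Link.walk e) +ℚ_) ws) ,
      λ { H′ sy′ ps (_ ∷ as) → (λ ()) ∷ joins H′ sy′ ps as }
      where
      lemma : ∀ x y z → x +ℚ (y +ℚ z) ≡ y +ℚ (x +ℚ z)
      lemma = solve-∀ ℚ-ring

    record Oriented : Set where
      field
        {x y} : Fin n
        L : Branch x
        path : Walk H x y
        B : Branch y
        orderedL : Ordered L
        orderedB : Ordered B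
        length≡ : weight path +ℚ (totalLength (items L) +ℚ totalLength (items B)) ≡ cost H
        few : branchings (items L) + branchings (items B) ≤ b
        belowL : Below (weight path) (items L)
        belowB : Below (weight path) (items B)
        all : ∀ x → T (termSet R H x) → terminal x ∈ items L ⊎ terminal x ∈ items B

    orientTree : Tree → Oriented
    orientTree tr with reroot (Tree.tree tr)
    ... | rooted L₀ P B₀ , π₀ , below with orient L₀ | orient B₀
    ...   | L , πL , oL | B , πB , oB = record
      { L = L ; path = P ; B = B ; orderedL = oL ; orderedB = oB
      ; length≡ = trans (cong (weight P +ℚ_) (sym (totalLength-++ (items L) (items B)))) (trans (totalLength-↭ π) (Tree.tree-length tr))
      ; few = ℕₚ.≤-trans (ℕₚ.≤-reflexive (trans (sym (branchings-++ (items L) (items B))) (branchings-↭ π))) (Tree.tree-branchings tr)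
      ; belowL = Allₚ.++⁻ˡ (items L) below′
      ; belowB = Allₚ.++⁻ʳ (items L) below′
      ; all = all′
      }
      where
      π : length′ (weight P) ∷ items L ++ items B ↭ Rooted.allItems (Tree.tree tr)
      π = ↭-trans (prep _ (++⁺ πL πB)) π₀
      below′ : Below (weight P) (items L ++ items B)
      below′ = All.tail (All-resp-↭ (↭-sym (prep _ (++⁺ πL πB))) below)
      all′ : ∀ x → T (termSet R H x) → terminal x ∈ items L ⊎ terminal x ∈ items B
      all′ x t with ∈-resp-↭ (↭-sym π) (Tree.tree-terminals tr x t)
      ... | there i = ∈-++⁻ (items L) i

    module Contract (O : Oriented) where
      open Oriented O
      m = weight path

      allLinks : List Link
      allLinks = link (rep L) (rep B) (rep-terminal L) (rep-terminal B) path ∷ links L ++ links B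

      allLoss : List SomeWalk
      allLoss = lossWalks L ++ lossWalks B

      loss-bound : walksWeight allLoss ≤ℚ ℕ→ℚ b *ℚ m
      loss-bound = begin
          walksWeight allLoss
            ≡⟨ walksWeight-++ (lossWalks L) (lossWalks B) ⟩
          loss L +ℚ loss B
            ≤⟨ ℚₚ.+-mono-≤ (loss≤branchings L belowL) (loss≤branchings B belowB) ⟩
          ℕ→ℚ (branchings (items L)) *ℚ m +ℚ ℕ→ℚ (branchings (items B)) *ℚ m
            ≡⟨ sym (trans (cong (_*ℚ m) (ℕ→ℚ-+ (branchings (items L)) (branchings (items B)))) (ℚₚ.*-distribʳ-+ m (ℕ→ℚ (branchings (items L))) (ℕ→ℚ (branchings (items B))))) ⟩
          ℕ→ℚ (branchings (items L) + branchings (items B)) *ℚ m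
            ≤⟨ ℚₚ.*-monoʳ-≤-nonNeg m {{ℚ.nonNegative (weight-nonneg path)}} (ℕ→ℚ-mono {branchings (items L) + branchings (items B)} {b} few) ⟩
          ℕ→ℚ b *ℚ m ∎
        where
        open ℚₚ.≤-Reasoning

      -- The root path is a link and serves as sibling for no loss path, so its length comes on top
      -- of the doubled loss.
      loss-half : walksWeight allLoss +ℚ walksWeight allLoss +ℚ m ≤ℚ cost H
      loss-half = subst₂ (λ x y → x +ℚ x +ℚ m ≤ℚ y) (sym (walksWeight-++ (lossWalks L) (lossWalks B))) length≡
        (certify (0≤+ (≤⇒0≤- (2loss≤length L orderedL)) (≤⇒0≤- (2loss≤length B orderedB)))
          (lemma m (loss L) (loss B) (totalLength (items L)) (totalLength (items B))))
        where
        lemma : ∀ m x y u v → (m +ℚ (u +ℚ v)) -ℚ ((x +ℚ y) +ℚ (x +ℚ y) +ℚ m) ≡ (u -ℚ (x +ℚ x)) +ℚ (v -ℚ (y +ℚ y))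
        lemma = solve-∀ ℚ-ring

      loss+links≡cost : walksWeight allLoss +ℚ linksWeight allLinks ≡ cost H
      loss+links≡cost = trans (cong₂ (λ x y → x +ℚ (m +ℚ y)) (walksWeight-++ (lossWalks L) (lossWalks B)) (linksWeight-++ (links L) (links B)))
        (trans (lemma m (loss L) (loss B) (linksWeight (links L)) (linksWeight (links B)))
        (trans (cong₂ (λ x y → m +ℚ (x +ℚ y)) (loss+links L) (loss+links B)) length≡))
        where
        lemma : ∀ m x y u v → (x +ℚ y) +ℚ (m +ℚ (u +ℚ v)) ≡ m +ℚ ((x +ℚ u) +ℚ (y +ℚ v))
        lemma = solve-∀ ℚ-ring

      contraction : LossContraction (H ∷ [])
      contraction = record
        { F = map toEdge allLinks
        ; nonneg = Allₚ.map⁺ (All.universal (λ e → weight-nonneg (Link.walk e)) allLinks)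
        ; ends = Allₚ.map⁺ (All.universal (λ e → Link.sR e , Link.tR e) allLinks)
        ; spans = λ q cs → spans′ q (Allₚ.map⁻ cs) ∷ []
        ; heavy = heavy′
        ; swap-out = swap-out′
        }
        where
        spans′ : ∀ q → ConstOnLinks q allLinks → Constant (termSet R H) q
        spans′ q (e ∷ es) u v tu tv = trans (toRep u tu) (sym (toRep v tv))
          where
          toRep : ∀ x → T (termSet R H x) → q x ≡ q (rep B)
          toRep x t with all x t
          ... | inj₁ j = trans (links-span q L (Allₚ.++⁻ˡ (links L) es) j) e
          ... | inj₂ j = links-span q B (Allₚ.++⁻ʳ (links L) es) j
        -- With loss `l` and cost `c`, the difference of the sides is `b (c - 2 l - m) + (b m - l)`.
        heavy′ : ℕ→ℚ (suc b) *ℚ (cost H +ℚ 0ℚ) ≤ℚ ℕ→ℚ (2 * b + 1) *ℚ total (map toEdge allLinks)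
        heavy′ rewrite total-links allLinks | ℚₚ.+-identityʳ (cost H) | ℕ→ℚ-+ 1 b | ℕ→ℚ-+ (2 * b) 1 | ℕ→ℚ-* 2 b =
          certify (0≤+ (0≤* (0≤ℕ→ℚ b) (≤⇒0≤- loss-half)) (≤⇒0≤- loss-bound))
            (trans (cong (λ z → (ℕ→ℚ 2 *ℚ ℕ→ℚ b +ℚ 1ℚ) *ℚ linksWeight allLinks -ℚ (1ℚ +ℚ ℕ→ℚ b) *ℚ z) (sym loss+links≡cost))
            (trans (lemma (ℕ→ℚ b) m (walksWeight allLoss) (linksWeight allLinks))
              (cong (λ z → ℕ→ℚ b *ℚ (z -ℚ (walksWeight allLoss +ℚ walksWeight allLoss +ℚ m)) +ℚ (ℕ→ℚ b *ℚ m -ℚ walksWeight allLoss)) loss+links≡cost)))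
          where
          lemma : ∀ b m l k → ((1ℚ +ℚ 1ℚ) *ℚ b +ℚ 1ℚ) *ℚ k -ℚ (1ℚ +ℚ b) *ℚ (l +ℚ k) ≡
            b *ℚ ((l +ℚ k) -ℚ (l +ℚ l +ℚ m)) +ℚ (b *ℚ m -ℚ l)
          lemma = solve-∀ ℚ-ring
        swap-out′ : ∀ bs → map proj₂ bs ↭ map toEdge allLinks → ∃ λ Zs → All (FullR r) Zs ×
          intCost G Zs +ℚ dropped bs ≤ℚ cost H +ℚ 0ℚ × (∀ q → Ties Zs q → ConstOnKept q bs)
        -- What remains of `H` is the union of all loss walks and the walks of the kept links, which
        -- `decompose` cuts into full components.
        swap-out′ bs p
          with bs′ , eq , p′ ← ↭-map-inv proj₂ p
          with Ks , ws , joins ← keptWalks allLinks bs′ (sym eq)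
          with Zs , fs , cs , ties ← decompose r H ((hG , sy , connected , acyclic) , internal , leaves) few-terminals
                 (order (fromEdges (allEdges (allLoss ++ Ks)))) (fromEdges (allEdges (allLoss ++ Ks)))
                 (fromEdges-⊑ sy _ (allEdges-inside (allLoss ++ Ks))) (fromEdges-symm (allEdges (allLoss ++ Ks))) ℕₚ.≤-refl =
          Zs , fs , costs , λ q ts → All-resp-↭ (↭-sym p′) (All.map (λ {b} → apply q ts b) joined)
          where
          es = allEdges (allLoss ++ Ks)
          H′ = fromEdges es
          sy′ = fromEdges-symm es
          all-present : Present H′ sy′ (allLoss ++ Ks)
          all-present = present H′ sy′ (allLoss ++ Ks) λ i → proj₁ (fromEdges-intro es i)
          pL = Allₚ.++⁻ˡ (lossWalks L) (Allₚ.++⁻ˡ allLoss all-present)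
          pB = Allₚ.++⁻ʳ (lossWalks L) (Allₚ.++⁻ˡ allLoss all-present)
          joined : All (Joined H′) bs′
          joined = joins H′ sy′ (Allₚ.++⁻ʳ allLoss all-present)
            ((reverse sy′ (to-rep H′ sy′ L pL) , to-rep H′ sy′ B pB) ∷ Allₚ.++⁺ (attached H′ sy′ L pL) (attached H′ sy′ B pB))
          apply : ∀ q → Ties Zs q → ∀ e → Joined H′ e → T (proj₁ e) → q (proj₁ (proj₂ e)) ≡ q (proj₁ (proj₂ (proj₂ e)))
          apply q ts (k , s , t , w) j tk = let sR , tR , P = j tk in ties q ts s t sR tR P
          costs : intCost G Zs +ℚ dropped bs ≤ℚ cost H +ℚ 0ℚ
          costs = begin
            intCost G Zs +ℚ dropped bs
              ≤⟨ ℚₚ.+-monoˡ-≤ (dropped bs) (ℚₚ.≤-trans cs (fromEdges-cost es (All.map (λ {e} → hG (proj₁ e) (proj₂ e)) (allEdges-inside (allLoss ++ Ks))))) ⟩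
            edgeCost es +ℚ dropped bs
              ≡⟨ cong₂ _+ℚ_ (trans (allEdges-cost (allLoss ++ Ks)) (walksWeight-++ allLoss Ks)) (dropped-↭ p′) ⟩
            (walksWeight allLoss +ℚ walksWeight Ks) +ℚ dropped bs′
              ≡⟨ trans (ℚₚ.+-assoc (walksWeight allLoss) _ _) (cong (walksWeight allLoss +ℚ_) ws) ⟩
            walksWeight allLoss +ℚ linksWeight allLinks
              ≡⟨ trans loss+links≡cost (sym (ℚₚ.+-identityʳ _)) ⟩
            cost H +ℚ 0ℚ ∎
            where open ℚₚ.≤-Reasoning

  contract-one : ∀ {H} → FullR r H → LossContraction (H ∷ [])
  contract-one {H} (((hG , sy , connected , acyclic) , internal , leaves) , several , few)
    with a , at ← countFin-pos⁻ (termSet R H) (ℕₚ.≤-trans (s≤s z≤n) several)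
    with f , spans ← SpanningForest.spanning G (order H) H sy hG acyclic a ℕₚ.≤-refl =
    Contract.contraction (orientTree (WithForest.initial a (∧-fst at) (T-<ᵇ⁻ (∧-snd {R a} at)) f spans))
    where open Single H hG sy connected acyclic internal leaves several few

  intCost-++ : ∀ Ys Zs → intCost G (Ys ++ Zs) ≡ intCost G Ys +ℚ intCost G Zs
  intCost-++ [] Zs = sym (ℚₚ.+-identityˡ _)
  intCost-++ (Y ∷ Ys) Zs = trans (cong (cost Y +ℚ_) (intCost-++ Ys Zs)) (sym (ℚₚ.+-assoc (cost Y) _ _))

  combine : ∀ {Y Ys} → LossContraction (Y ∷ []) → LossContraction Ys → LossContraction (Y ∷ Ys)
  combine {Y} {Ys} A B = record
    { F = A.F ++ B.F
    ; nonneg = Allₚ.++⁺ A.nonneg B.nonneg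
    ; ends = Allₚ.++⁺ A.ends B.ends
    ; spans = λ q cs → All.head (A.spans q (Allₚ.++⁻ˡ A.F cs)) ∷ B.spans q (Allₚ.++⁻ʳ A.F cs)
    ; heavy = subst₂ _≤ℚ_
        (trans (cong (λ z → β *ℚ z +ℚ β *ℚ intCost G Ys) (ℚₚ.+-identityʳ (cost Y))) (sym (ℚₚ.*-distribˡ-+ β (cost Y) (intCost G Ys))))
        (sym (trans (cong (γ *ℚ_) (total-++ A.F B.F)) (ℚₚ.*-distribˡ-+ γ (total A.F) (total B.F))))
        (ℚₚ.+-mono-≤ A.heavy B.heavy)
    ; swap-out = swap′
    }
    where
    module A = LossContraction A
    module B = LossContraction B
    β = ℕ→ℚ (suc b)
    γ = ℕ→ℚ (2 * b + 1)
    swap′ : ∀ bs → map proj₂ bs ↭ A.F ++ B.F → ∃ λ Zs → All (FullR r) Zs ×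
        intCost G Zs +ℚ dropped bs ≤ℚ cost Y +ℚ intCost G Ys × (∀ q → Ties Zs q → ConstOnKept q bs)
    swap′ bs p
      with bs′ , eq , p′ ← ↭-map-inv proj₂ p
      with b₁ , b₂ , refl , e₁ , e₂ ← map-++⁻ proj₂ A.F bs′ (sym eq)
      with Z₁ , f₁ , c₁ , t₁ ← A.swap-out b₁ (↭-reflexive e₁) | Z₂ , f₂ , c₂ , t₂ ← B.swap-out b₂ (↭-reflexive e₂) =
      Z₁ ++ Z₂ , Allₚ.++⁺ f₁ f₂ ,
      ℚₚ.≤-trans (ℚₚ.≤-reflexive (trans (cong₂ _+ℚ_ (intCost-++ Z₁ Z₂) (trans (dropped-↭ p′) (dropped-++ b₁ b₂)))
          (lemma (intCost G Z₁) (intCost G Z₂) (dropped b₁) (dropped b₂))))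
        (ℚₚ.≤-trans (ℚₚ.+-mono-≤ c₁ c₂) (ℚₚ.≤-reflexive (cong (_+ℚ intCost G Ys) (ℚₚ.+-identityʳ (cost Y))))) ,
      λ q ts → All-resp-↭ (↭-sym p′) (Allₚ.++⁺ (t₁ q (Allₚ.++⁻ˡ Z₁ ts)) (t₂ q (Allₚ.++⁻ʳ Z₁ ts)))
      where
      lemma : ∀ x y z w → (x +ℚ y) +ℚ (z +ℚ w) ≡ (x +ℚ z) +ℚ (y +ℚ w)
      lemma = solve-∀ ℚ-ring

  contract-all : ∀ Ys → All (FullR r) Ys → LossContraction Ys
  contract-all [] [] = record
    { F = [] ; nonneg = [] ; ends = [] ; spans = λ _ _ → []
    ; heavy = ℚₚ.≤-reflexive (trans (ℚₚ.*-zeroʳ (ℕ→ℚ (suc b))) (sym (ℚₚ.*-zeroʳ (ℕ→ℚ (2 * b + 1)))))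
    ; swap-out = λ { [] p → [] , [] , ℚₚ.≤-refl , λ _ _ → [] ; (_ ∷ _) p → ⊥-elim (absurd (↭-empty-inv p)) }
    }
    where
    absurd : ∀ {A : Set} {x : A} {xs : List A} → ¬ (_≡_ {A = List A} (x ∷ xs) [])
    absurd ()
  contract-all (Y ∷ Ys) (fY ∷ fs) = combine (contract-one fY) (contract-all Ys fs)

  -- A labeling constant on every listed member makes the left-hand side vanish, so its inequality
  -- permits only one part. The members listed in `xs` thus form a first integral solution, from
  -- which `optimum` can start.
  support-connects : ∀ xs → (∀ p → ℕ→ℚ (numParts R p ∸ 1) ≤ℚ fracLHS R p xs) → Connects R (map proj₁ xs)
  support-connects xs feas q ts = hits≤1⇒constant q R (ℕₚ.m∸n≡0⇒m≤n (ℕₚ.n≤0⇒n≡0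
      (ℕ→ℚ-cancel {numParts R q ∸ 1} {0} (subst (ℕ→ℚ (numParts R q ∸ 1) ≤ℚ_) (zero-lhs xs ts) (feas q)))))
    where
    zero-lhs : ∀ xs → Ties (map proj₁ xs) q → fracLHS R q xs ≡ 0ℚ
    zero-lhs [] [] = refl
    zero-lhs ((H , x) ∷ xs) (t ∷ ts) rewrite ℕₚ.m≤n⇒m∸n≡0 (constant⇒hits≤1 q (termSet R H) t) | zero-lhs xs ts | ℚₚ.*-zeroʳ x = refl

  minimise-all : ∀ Ys → All (FullR r) Ys → ∃ λ Ws → All (InKr G R r) Ws × intCost G Ws ≤ℚ intCost G Ys × (∀ q → Ties Ws q → Ties Ys q)
  minimise-all [] [] = [] , [] , ℚₚ.≤-refl , λ _ _ → []
  minimise-all (Y ∷ Ys) (f ∷ fs) with minimise f | minimise-all Ys fs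
  ... | K , k , same , le | Ws , ws , les , ties =
    K ∷ Ws , k ∷ ws , ℚₚ.+-mono-≤ le les , λ { q (t ∷ ts) → constant-resp same t ∷ ties q ts }

  module Order = Sort (On.decTotalOrder ℚₚ.≤-decTotalOrder price)

  module Bound (xs : FracSol n) (members : All (FullR r) (map proj₁ xs)) (x≥0 : NonnegWeights xs)
               (feas : ∀ p → ℕ→ℚ (numParts R p ∸ 1) ≤ℚ fracLHS R p xs)
               (Y : IntSol n) (coY : Connects R Y)
               (least : ∀ Zs → All (FullR r) Zs → Connects R Zs → intCost G Y ≤ℚ intCost G Zs)
               (C : LossContraction Y) where
    module C = LossContraction C

    es : List TerminalEdge
    es = Order.sort C.F

    es↭F : es ↭ C.F
    es↭F = Order.sort-↭ C.F

    -- Keeping the edges selected for the terminal set S and adding members that tie S together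
    -- gives another solution, so the edges dropped cannot cost more than what was added.
    exchange : ∀ S Ks → All (FullR r) Ks → (∀ q → Ties Ks q → Constant S q) → dropped (select id S es) ≤ℚ intCost G Ks
    exchange S Ks fKs tie with C.swap-out (select id S es) (↭-trans (↭-reflexive (select-map id S es)) es↭F)
    ... | Zs , fs , cs , ties = certify (0≤+ (≤⇒0≤- (least (Ks ++ Zs) (Allₚ.++⁺ fKs fs) co)) (≤⇒0≤- cs))
          (trans (lemma (dropped (select id S es)) (intCost G Ks) (intCost G Zs) (intCost G Y))
            (cong (λ z → (z -ℚ intCost G Y) +ℚ (intCost G Y -ℚ (intCost G Zs +ℚ dropped (select id S es)))) (sym (intCost-++ Ks Zs))))
      where
      co : Connects R (Ks ++ Zs)
      co q ts = coY q (C.spans q (All-resp-↭ es↭F (select-spans id q S es (cong q) (tie q (Allₚ.++⁻ˡ Ks ts)) (ties q (Allₚ.++⁻ʳ Ks ts)))))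
      lemma : ∀ d k z y → k -ℚ d ≡ ((k +ℚ z) -ℚ y) +ℚ (y -ℚ (z +ℚ d))
      lemma = solve-∀ ℚ-ring

    gains≤ : gains R xs x≥0 feas id es ≤ℚ fracCost G xs
    gains≤ = ℚₚ.≤-trans (wsum-mono-All xs x≥0 (All.map (λ {e} → each {e}) (Allₚ.map⁻ members))) (ℚₚ.≤-reflexive (sym (fracCost-wsum G xs)))
      where
      each : ∀ {e : Subgraph n × ℚ} → FullR r (proj₁ e) → dropped (select id (termSet R (proj₁ e)) es) ≤ℚ cost (proj₁ e)
      each {e} f = ℚₚ.≤-trans (exchange (termSet R (proj₁ e)) (proj₁ e ∷ []) (f ∷ []) λ { q (t ∷ []) → t })
                     (ℚₚ.≤-reflexive (ℚₚ.+-identityʳ (cost (proj₁ e))))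

    -- Edges that close cycles can be removed from `Y` with nothing added, so by optimality they are
    -- worth nothing.
    useless≤ : dropped (select id none es) ≤ℚ 0ℚ
    useless≤ = exchange none [] [] λ _ _ _ _ ()

    total≤ : total C.F ≤ℚ fracCost G xs
    total≤ = begin
        total C.F
          ≡⟨ trans (total-↭ (↭-sym es↭F)) (sym (trans (cong (total es +ℚ_) (ℚₚ.*-zeroˡ (rcs R xs x≥0 feas id))) (ℚₚ.+-identityʳ (total es)))) ⟩
        total es +ℚ 0ℚ *ℚ rcs R xs x≥0 feas id
          -- Starting from threshold 0 and the finest partition, both boundary terms vanish.
          ≤⟨ total≤gains R xs x≥0 feas 0ℚ id es nonneg sorted nonneg (All-resp-↭ (↭-sym es↭F) C.ends)
               (λ q _ cs → coY q (C.spans q (All-resp-↭ es↭F cs))) ⟩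
        (gains R xs x≥0 feas id es +ℚ dropped (select id none es)) +ℚ 0ℚ *ℚ ℕ→ℚ (numParts R id ∸ 1)
          ≤⟨ ℚₚ.+-mono-≤ (ℚₚ.+-mono-≤ gains≤ useless≤) (ℚₚ.≤-reflexive (ℚₚ.*-zeroˡ (ℕ→ℚ (numParts R id ∸ 1)))) ⟩
        (fracCost G xs +ℚ 0ℚ) +ℚ 0ℚ
          ≡⟨ trans (ℚₚ.+-identityʳ (fracCost G xs +ℚ 0ℚ)) (ℚₚ.+-identityʳ (fracCost G xs)) ⟩
        fracCost G xs ∎
      where
      open ℚₚ.≤-Reasoning
      nonneg = All-resp-↭ (↭-sym es↭F) C.nonneg
      sorted : AllPairs (λ e f → price e ≤ℚ price f) es
      sorted = Linked⇒AllPairs ℚₚ.≤-trans (Order.sort-↗ C.F)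

    -- The ratio enters only through this equation, so no fraction with a variable denominator has
    -- to be normalised.
    scaled : ∀ α → α *ℚ ℕ→ℚ (suc b) ≡ ℕ→ℚ (2 * b + 1) → ∀ w → w ≤ℚ intCost G Y → w ≤ℚ α *ℚ fracCost G xs
    scaled α αb w w≤ = ℚₚ.*-cancelˡ-≤-pos (ℕ→ℚ (suc b)) {{ℚₚ.normalize-pos (suc b) 1}} (begin
        ℕ→ℚ (suc b) *ℚ w
          ≤⟨ *-mono-≤ (0≤ℕ→ℚ (suc b)) w≤ ⟩
        ℕ→ℚ (suc b) *ℚ intCost G Y
          ≤⟨ C.heavy ⟩
        ℕ→ℚ (2 * b + 1) *ℚ total C.F
          ≤⟨ *-mono-≤ (0≤ℕ→ℚ (2 * b + 1)) total≤ ⟩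
        ℕ→ℚ (2 * b + 1) *ℚ fracCost G xs
          ≡⟨ cong (_*ℚ fracCost G xs) (trans (sym αb) (ℚₚ.*-comm α (ℕ→ℚ (suc b)))) ⟩
        (ℕ→ℚ (suc b) *ℚ α) *ℚ fracCost G xs
          ≡⟨ ℚₚ.*-assoc (ℕ→ℚ (suc b)) α (fracCost G xs) ⟩
        ℕ→ℚ (suc b) *ℚ (α *ℚ fracCost G xs) ∎)
      where open ℚₚ.≤-Reasoning

  gap : GapAtMost G R r (+ (2 * b + 1) / suc b)
  gap xs (members , feas)
    with members′ ← Allₚ.map⁺ {xs = xs} {f = proj₁} (All.map (λ { ((f , lo , hi , _) , _) → f , lo , hi }) members)
    with Y , fY , coY , least ← optimum r (map proj₁ xs) members′ (support-connects xs feas)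
    -- Only here do cheapest components return: the terminal sets, and with them connectivity, are
    -- unchanged.
    with Ws , inK , Ws≤Y , ties ← minimise-all Y fY =
    Ws , (inK , connects⇒feasible R Ws λ q ts → coY q (ties q ts)) ,
    Bound.scaled xs members′ (All.map proj₂ members) feas Y coY least (contract-all Y fY)
      (+ (2 * b + 1) / suc b) (/-*-cancel (2 * b + 1) b) (intCost G Ws) Ws≤Y

-- The lower bound: counting in natural numbers.

sumℕ : ∀ {n} → (Fin n → ℕ) → ℕ
sumℕ {zero} f = 0
sumℕ {suc n} f = f zero + sumℕ (λ i → f (suc i))

sumFin-ℕ→ℚ : ∀ {n} (f : Fin n → ℕ) → sumFin (λ i → ℕ→ℚ (f i)) ≡ ℕ→ℚ (sumℕ f)
sumFin-ℕ→ℚ {zero} f = refl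
sumFin-ℕ→ℚ {suc n} f = trans (cong (ℕ→ℚ (f zero) +ℚ_) (sumFin-ℕ→ℚ (λ i → f (suc i)))) (sym (ℕ→ℚ-+ (f zero) (sumℕ λ i → f (suc i))))

term≤sumℕ : ∀ {n} (f : Fin n → ℕ) i → f i ≤ sumℕ f
term≤sumℕ f zero = ℕₚ.m≤m+n _ _
term≤sumℕ f (suc i) = ℕₚ.≤-trans (term≤sumℕ (λ j → f (suc j)) i) (ℕₚ.m≤n+m _ (f zero))

bit≤1 : ∀ x → bit x ≤ 1
bit≤1 true = ℕₚ.≤-refl
bit≤1 false = z≤n

bit≤ : ∀ {x m} → (T x → 1 ≤ m) → bit x ≤ m
bit≤ {true} h = h tt
bit≤ {false} h = z≤n

countFin≤sumℕ : ∀ {n} (S : Fin n → Bool) (f : Fin n → ℕ) → (∀ i → T (S i) → 1 ≤ f i) → countFin S ≤ sumℕ f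
countFin≤sumℕ {zero} S f h = z≤n
countFin≤sumℕ {suc n} S f h = ℕₚ.+-mono-≤ (bit≤ (h zero)) (countFin≤sumℕ (λ i → S (suc i)) (λ i → f (suc i)) λ i → h (suc i))

countFin+2≤sumℕ : ∀ {n} (S : Fin n → Bool) (f : Fin n → ℕ) → (∀ i → T (S i) → 1 ≤ f i) → ∀ j → 3 ≤ f j → countFin S + 2 ≤ sumℕ f
countFin+2≤sumℕ S f h zero p = ℕₚ.≤-trans (ℕₚ.≤-reflexive (trans (ℕₚ.+-assoc (bit (S zero)) k 2) (trans (cong (λ z → bit (S zero) + z) (ℕₚ.+-comm k 2)) (sym (ℕₚ.+-assoc (bit (S zero)) 2 k)))))
    (ℕₚ.+-mono-≤ (ℕₚ.≤-trans (ℕₚ.+-monoˡ-≤ 2 (bit≤1 (S zero))) p) (countFin≤sumℕ (λ i → S (suc i)) (λ i → f (suc i)) λ i → h (suc i)))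
  where
  k = countFin (λ i → S (suc i))
countFin+2≤sumℕ S f h (suc j) p = ℕₚ.≤-trans (ℕₚ.≤-reflexive (ℕₚ.+-assoc (bit (S zero)) _ 2))
  (ℕₚ.+-mono-≤ (bit≤ (h zero)) (countFin+2≤sumℕ (λ i → S (suc i)) (λ i → f (suc i)) (λ i → h (suc i)) j p))

sumOver : ∀ {A : Set} → List A → (A → ℕ) → ℕ
sumOver [] f = 0
sumOver (x ∷ xs) f = f x + sumOver xs f

sumOver-mono : ∀ {A : Set} {xs : List A} {f g : A → ℕ} → All (λ x → f x ≤ g x) xs → sumOver xs f ≤ sumOver xs g
sumOver-mono [] = z≤n
sumOver-mono (h ∷ hs) = ℕₚ.+-mono-≤ h (sumOver-mono hs)

sumOver-const : ∀ {A : Set} (xs : List A) k → sumOver xs (λ _ → k) ≡ length xs * k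
sumOver-const [] k = refl
sumOver-const (x ∷ xs) k = cong (λ z → k + z) (sumOver-const xs k)

+-interchange : ∀ a b c d → (a + b) + (c + d) ≡ (a + c) + (b + d)
+-interchange a b c d = begin
    (a + b) + (c + d) ≡⟨ ℕₚ.+-assoc a b (c + d) ⟩
    a + (b + (c + d)) ≡⟨ cong (λ z → a + z) (trans (sym (ℕₚ.+-assoc b c d)) (trans (cong (_+ d) (ℕₚ.+-comm b c)) (ℕₚ.+-assoc c b d))) ⟩
    a + (c + (b + d)) ≡⟨ sym (ℕₚ.+-assoc a c (b + d)) ⟩
    (a + c) + (b + d) ∎
  where open ≡-Reasoning

sumOver-+ : ∀ {A : Set} (xs : List A) (f g : A → ℕ) → sumOver xs (λ x → f x + g x) ≡ sumOver xs f + sumOver xs g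
sumOver-+ [] f g = refl
sumOver-+ (x ∷ xs) f g = trans (cong (λ z → f x + g x + z) (sumOver-+ xs f g)) (+-interchange (f x) (g x) (sumOver xs f) (sumOver xs g))

-- Double counting of pairs of a star and a part that it hits. Each part is hit by 4 stars, and the
-- part of the root by 3 more.
sumOver-countFin : ∀ {A : Set} {m} (xs : List A) (g : A → Fin m → Bool) (a e : Fin m → Bool) →
  (∀ ℓ → 4 * bit (a ℓ) + 3 * bit (e ℓ) ≤ sumOver xs (λ x → bit (g x ℓ))) →
  4 * countFin a + 3 * countFin e ≤ sumOver xs (λ x → countFin (g x))
sumOver-countFin {m = zero} xs g a e h = z≤n
sumOver-countFin {m = suc m} xs g a e h = begin
    4 * (bit (a zero) + a′) + 3 * (bit (e zero) + e′)
      ≡⟨ cong₂ _+_ (ℕₚ.*-distribˡ-+ 4 (bit (a zero)) a′) (ℕₚ.*-distribˡ-+ 3 (bit (e zero)) e′) ⟩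
    (4 * bit (a zero) + 4 * a′) + (3 * bit (e zero) + 3 * e′)
      ≡⟨ +-interchange (4 * bit (a zero)) (4 * a′) (3 * bit (e zero)) (3 * e′) ⟩
    (4 * bit (a zero) + 3 * bit (e zero)) + (4 * a′ + 3 * e′)
      ≤⟨ ℕₚ.+-mono-≤ (h zero) (sumOver-countFin xs (λ x i → g x (suc i)) (λ i → a (suc i)) (λ i → e (suc i)) λ ℓ → h (suc ℓ)) ⟩
    sumOver xs (λ x → bit (g x zero)) + sumOver xs (λ x → countFin (λ i → g x (suc i)))
      ≡⟨ sym (sumOver-+ xs (λ x → bit (g x zero)) (λ x → countFin (λ i → g x (suc i)))) ⟩
    sumOver xs (λ x → countFin (g x)) ∎
  where
  open ℕₚ.≤-Reasoning
  a′ = countFin (λ i → a (suc i))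
  e′ = countFin (λ i → e (suc i))

-- Quasi-bipartite instances given by a metric with distances 1, 2 and 3.

-- Steiner vertices are pairwise non-adjacent, and d is the metric giving the edge costs; near v is
-- the set of terminals at distance 1 from the Steiner vertex v.
module Instance {n : ℕ} (R : Fin n → Bool) (near : Fin n → Fin n → Bool) (d : Fin n → Fin n → ℕ)
  (d-sym : ∀ u v → d u v ≡ d v u) (d-refl : ∀ u → d u u ≡ 0)
  (triangle : ∀ u v w → d u w ≤ d u v + d v w) where

  instanceGraph : Graph n
  instanceGraph = record
    { adj = λ u v → not (does (u ≟ v)) ∧ (R u ∨ R v)
    ; c = λ u v → ℕ→ℚ (d u v)
    ; adj-sym = λ u v → T-ext (sw u v) (sw v u)
    ; adj-irrefl = λ u → ¬T⇒≡ λ t → not-elim (∧-fst t) (does-intro (u ≟ u) refl)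
    ; c-sym = λ u v _ → cong ℕ→ℚ (d-sym u v)
    ; c-nonneg = λ u v _ → 0≤ℕ→ℚ (d u v)
    }
    where
    sw : ∀ u v → T (not (does (u ≟ v)) ∧ (R u ∨ R v)) → T (not (does (v ≟ u)) ∧ (R v ∨ R u))
    sw u v t = ∧-intro (not-intro λ e → not-elim (∧-fst t) (does-intro (u ≟ v) (sym (does-elim (v ≟ u) e)))) (comm (∧-snd {not (does (u ≟ v))} t))
      where
      comm : T (R u ∨ R v) → T (R v ∨ R u)
      comm t with ∨-elim {R u} t
      ... | inj₁ a = ∨-right {R v} a
      ... | inj₂ b = ∨-left b

  private G = instanceGraph

  adj-intro : ∀ {u v} → u ≢ v → T (R u) ⊎ T (R v) → T (adj G u v)
  adj-intro {u} {v} ne (inj₁ a) = ∧-intro (not-intro λ e → ne (does-elim (u ≟ v) e)) (∨-left a)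
  adj-intro {u} {v} ne (inj₂ a) = ∧-intro (not-intro λ e → ne (does-elim (u ≟ v) e)) (∨-right {R u} a)

  adj-≢ : ∀ {u v} → T (adj G u v) → u ≢ v
  adj-≢ {u} {v} t e = not-elim (∧-fst t) (does-intro (u ≟ v) e)

  adj-steiner : ∀ {u v} → T (adj G u v) → T (not (R u)) → T (R v)
  adj-steiner {u} {v} t s with ∨-elim {R u} (∧-snd {not (does (u ≟ v))} t)
  ... | inj₁ a = ⊥-elim (not-elim s a)
  ... | inj₂ b = b

  -- The triangle inequality extends to walks, so every edge is a shortest connection; this is the
  -- metric part of `A1` and `A2`.
  d≤walk : ∀ {u v} (P : Walk (adj G) u v) → ℕ→ℚ (d u v) ≤ℚ walkCost (c G) P
  d≤walk {u} nil = ℚₚ.≤-reflexive (cong ℕ→ℚ (d-refl u))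
  d≤walk {u} {w} (cons {v = v} _ P) = ℚₚ.≤-trans (ℕ→ℚ-mono {d u w} {d u v + d v w} (triangle u v w))
    (ℚₚ.≤-trans (ℚₚ.≤-reflexive (ℕ→ℚ-+ (d u v) (d v w))) (ℚₚ.+-monoʳ-≤ (ℕ→ℚ (d u v)) (d≤walk P)))

  a1 : A1 G R
  a1 u v ru rv ne = adj-intro ne (inj₁ ru) , d≤walk

  nbhd-trivial : ∀ {v u} → InNbhd G R v u → v ≡ u
  nbhd-trivial (_ , nil) = refl
  nbhd-trivial (_ , cons {v} {x} t _) = ⊥-elim (not-elim (∧-snd {not (R v)} (∧-snd {adj G v x} t)) (adj-steiner (∧-fst t) (∧-fst (∧-snd {adj G v x} t))))

  a2 : A2 G R
  a2 v sv u (inj₁ nb) ne = ⊥-elim (ne (sym (nbhd-trivial nb)))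
  a2 v sv u (inj₂ ru) ne = adj-intro ne (inj₁ ru) , d≤walk

  quasiBipartite : QuasiBipartite 1 G R
  quasiBipartite v sv f inj h with inj {zero} {suc zero} (trans (sym (nbhd-trivial (h zero))) (nbhd-trivial (h (suc zero))))
  ... | ()

  pairCost : Subgraph n → Fin n → Fin n → ℕ
  pairCost H u v = if H u v ∧ (toℕ u <ᵇ toℕ v) then d u v else 0

  cost : Subgraph n → ℕ
  cost H = sumℕ λ u → sumℕ (pairCost H u)

  cost≡ : ∀ H → subgraphCost G H ≡ ℕ→ℚ (cost H)
  cost≡ H = trans (sumFin-cong λ u → trans (sumFin-cong λ v → if-ℕ→ℚ (H u v ∧ (toℕ u <ᵇ toℕ v)) (d u v)) (sumFin-ℕ→ℚ (pairCost H u)))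
                  (sumFin-ℕ→ℚ (λ u → sumℕ (pairCost H u)))
    where
    if-ℕ→ℚ : ∀ b k → (if b then ℕ→ℚ k else 0ℚ) ≡ ℕ→ℚ (if b then k else 0)
    if-ℕ→ℚ true k = refl
    if-ℕ→ℚ false k = refl

  star : Fin n → Subgraph n
  star v x y = (does (x ≟ v) ∧ near v y) ∨ (does (y ≟ v) ∧ near v x)

  star-elim : ∀ v x y → T (star v x y) → (x ≡ v × T (near v y)) ⊎ (y ≡ v × T (near v x))
  star-elim v x y t with ∨-elim {does (x ≟ v) ∧ near v y} t
  ... | inj₁ a = inj₁ (does-elim (x ≟ v) (∧-fst a) , ∧-snd {does (x ≟ v)} a)
  ... | inj₂ a = inj₂ (does-elim (y ≟ v) (∧-fst a) , ∧-snd {does (y ≟ v)} a)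

  star-out : ∀ v {y} → T (near v y) → T (star v v y)
  star-out v h = ∨-left (∧-intro (does-intro (v ≟ v) refl) h)

  star-in : ∀ v {x} → T (near v x) → T (star v x v)
  star-in v {x} h = ∨-right {does (x ≟ v) ∧ near v v} (∧-intro (does-intro (v ≟ v) refl) h)

  star-symm : ∀ v → Symm (star v)
  star-symm v x y = T-ext (sw x y) (sw y x)
    where
    sw : ∀ x y → T (star v x y) → T (star v y x)
    sw x y t with star-elim v x y t
    ... | inj₁ (refl , h) = star-in v h
    ... | inj₂ (refl , h) = star-out v h

  -- The combinatorics of the design enters only through these finite properties, so the bounds are
  -- proved abstractly and evaluation is confined to small checks.
  module _ (steiner-first : ∀ v t → T (not (R v)) → T (R t) → toℕ v < toℕ t)
           (near-terminal : ∀ v t → T (near v t) → T (R t))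
           (d-terminals : ∀ s t → T (R s) → T (R t) → s ≢ t → 2 ≤ d s t)
           (d-pos : ∀ v t → T (not (R v)) → T (R t) → 1 ≤ d v t)
           (d-far : ∀ v t → T (not (R v)) → T (R t) → ¬ T (near v t) → 3 ≤ d v t)
           (pair : ∀ s t → T (R s) → T (R t) → ∃ λ v → T (not (R v)) × T (near v s) × T (near v t))
           (root : Fin n) (root-terminal : T (R root)) (root-near : ∀ v → T (not (R v)) → T (near v root))
           (missed : ∀ v w → T (not (R v)) → T (not (R w)) → ∃ λ x → T (R x) × ¬ T (near v x) × ¬ T (near w x))
           (eight : countFin R ≡ 8) (five : ∀ v → T (not (R v)) → countFin (near v) ≡ 5)
           (star-cost : ∀ v → T (not (R v)) → cost (star v) ≤ 5)
           (vs : List (Fin n)) (vs-steiner : All (λ v → T (not (R v))) vs) (vs-length : length vs ≡ 7)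
           (four : ∀ t → T (R t) → 4 ≤ sumOver vs (λ v → bit (near v t))) where

    size : Subgraph n → ℕ
    size H = countFin (termSet R H)

    Near : Subgraph n → Set
    Near H = ∃ λ v → T (not (R v)) × (∀ t → T (termSet R H t) → T (near v t))

    edge≤cost : ∀ H u v → T (H u v) → toℕ u < toℕ v → d u v ≤ cost H
    edge≤cost H u v t lt = ℕₚ.≤-trans
      (ℕₚ.≤-trans (ℕₚ.≤-reflexive (sym (cong (λ b → if b then d u v else 0) (T⇒≡ (∧-intro t (ℕₚ.<⇒<ᵇ lt))))))
        (term≤sumℕ (pairCost H u) v))
      (term≤sumℕ (λ u → sumℕ (pairCost H u)) u)

    -- A full component is a single edge or a star, as Steiner vertices are pairwise non-adjacent.
    profile : ∀ H → IsFullComponent G R H → 2 ≤ size H → size H ≤ cost H × (Near H ⊎ size H + 2 ≤ cost H)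
    profile H ((sub , sy , con , _) , internal , _) two
      with countFin-two⁻ (termSet R H) two
    ... | t , _ , _ , tt′ , _ with countFin-pos⁻ (H t) (T-<ᵇ⁻ (∧-snd {R t} tt′))
    ...   | v , tv with T? (R v)
    -- Two adjacent terminals both have degree one, so `H` is a single edge, and `pair` gives a star
    -- containing both ends.
    ...     | yes rv = ℕₚ.≤-trans small big , inj₁ (let w , sw , nt , nv = pair t v (∧-fst tt′) rv in
                w , sw , λ s st → near-cases w nt nv (only s st))
      where
      rt = ∧-fst tt′
      degree-one : ∀ {x y z} → T (R x) → T (H x y) → T (H x z) → y ≡ z
      degree-one {x} {y} {z} rx xy xz with y ≟ z
      ... | yes e = e
      ... | no ne = ⊥-elim (not-elim (internal x (countFin-two (H x) y z ne xy xz)) rx)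
      closed : ∀ {x y} → x ≡ t ⊎ x ≡ v → Walk H x y → y ≡ t ⊎ y ≡ v
      closed h nil = h
      closed (inj₁ refl) (cons e P) = closed (inj₂ (degree-one rt e tv)) P
      closed (inj₂ refl) (cons e P) = closed (inj₁ (degree-one rv e (flip sy tv))) P
      only : ∀ s → T (termSet R H s) → s ≡ t ⊎ s ≡ v
      only s st = closed (inj₁ refl) (con t s (countFin-pos (H t) v tv) (T-<ᵇ⁻ (∧-snd {R s} st)))
      near-cases : ∀ w → T (near w t) → T (near w v) → ∀ {s} → s ≡ t ⊎ s ≡ v → T (near w s)
      near-cases w a b (inj₁ refl) = a
      near-cases w a b (inj₂ refl) = b
      small : size H ≤ 2
      small = begin
          size H
            ≡⟨ countFin-split (termSet R H) t ⟩
          bit (termSet R H t) + countFin (λ i → termSet R H i ∧ not (does (i ≟ t)))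
            ≤⟨ ℕₚ.+-mono-≤ (bit≤1 (termSet R H t)) (ℕₚ.≮⇒≥ λ two′ → let i , j , ne , hi , hj = countFin-two⁻ _ two′ in
                 ne (trans (other i hi) (sym (other j hj)))) ⟩
          2 ∎
        where
        open ℕₚ.≤-Reasoning
        other : ∀ i → T (termSet R H i ∧ not (does (i ≟ t))) → i ≡ v
        other i h with only i (∧-fst h)
        ... | inj₁ e = ⊥-elim (not-elim (∧-snd {termSet R H i} h) (does-intro (i ≟ t) e))
        ... | inj₂ e = e
      big : 2 ≤ cost H
      big with ℕₚ.<-cmp (toℕ t) (toℕ v)
      ... | tri< lt _ _ = ℕₚ.≤-trans (d-terminals t v rt rv (adj-≢ (sub t v tv))) (edge≤cost H t v tv lt)
      ... | tri≈ _ e _ = ⊥-elim (adj-≢ (sub t v tv) (Finₚ.toℕ-injective e))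
      ... | tri> _ _ gt = ℕₚ.≤-trans (d-terminals v t rv rt λ e → adj-≢ (sub t v tv) (sym e)) (edge≤cost H v t (flip sy tv) gt)
    -- All neighbours of the Steiner vertex `v` are terminals of degree one, so `H` is a star at
    -- `v`. Each spoke costs at least 1, and one to a terminal not near `v` at least 3, a surplus of
    -- 2.
    ...     | no nrv = ℕₚ.≤-trans (countFin≤sumℕ (termSet R H) row row-pos) row≤ , far
      where
      sv : T (not (R v))
      sv = not-intro nrv
      closed : ∀ {x y} → x ≡ v ⊎ T (H v x) → Walk H x y → y ≡ v ⊎ T (H v y)
      closed h nil = h
      closed (inj₁ refl) (cons e P) = closed (inj₂ e) P
      closed (inj₂ vx) (cons {x} {y} e P) with v ≟ y
      ... | yes refl = closed (inj₁ refl) P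
      ... | no ne = ⊥-elim (not-elim (internal x (countFin-two (H x) v y ne (flip sy vx) e)) (adj-steiner (sub v x vx) sv))
      spoke : ∀ s → T (termSet R H s) → T (H v s)
      spoke s st with closed (inj₁ refl) (con v s (countFin-pos (H v) t (flip sy tv)) (T-<ᵇ⁻ (∧-snd {R s} st)))
      ... | inj₁ refl = ⊥-elim (nrv (∧-fst st))
      ... | inj₂ vs = vs
      row : Fin n → ℕ
      row = pairCost H v
      row≤ : sumℕ row ≤ cost H
      row≤ = term≤sumℕ (λ u → sumℕ (pairCost H u)) v
      row≡ : ∀ s → T (termSet R H s) → row s ≡ d v s
      row≡ s st = cong (λ b → if b then d v s else 0) (T⇒≡ (∧-intro (spoke s st) (ℕₚ.<⇒<ᵇ (steiner-first v s sv (∧-fst st)))))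
      row-pos : ∀ s → T (termSet R H s) → 1 ≤ row s
      row-pos s st = subst (1 ≤_) (sym (row≡ s st)) (d-pos v s sv (∧-fst st))
      far : Near H ⊎ size H + 2 ≤ cost H
      far with Finₚ.any? (λ s → T? (termSet R H s ∧ not (near v s)))
      ... | yes (s , h) = inj₂ (ℕₚ.≤-trans (countFin+2≤sumℕ (termSet R H) row row-pos s
              (subst (3 ≤_) (sym (row≡ s (∧-fst h))) (d-far v s sv (∧-fst (∧-fst h)) (not-elim (∧-snd {termSet R H s} h))))) row≤)
      ... | no none = inj₁ (v , sv , λ s st → is-near s st)
        where
        is-near : ∀ s → T (termSet R H s) → T (near v s)
        is-near s st with T? (near v s)
        ... | yes t = t
        ... | no nt = ⊥-elim (none (s , ∧-intro st (not-intro nt)))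

    totalCost : IntSol n → ℕ
    totalCost ys = sumOver ys cost

    intCost≡ : ∀ ys → intCost G ys ≡ ℕ→ℚ (totalCost ys)
    intCost≡ [] = refl
    intCost≡ (H ∷ ys) = trans (cong₂ _+ℚ_ (cost≡ H) (intCost≡ ys)) (sym (ℕ→ℚ-+ (cost H) (totalCost ys)))

    hits-id : ∀ (S : Fin n → Bool) → hits id S ≡ countFin S
    hits-id S = countFin-cong (hit id S) S λ ℓ → T-ext (λ t → let u , s , e = hit-elim id S ℓ t in subst (λ x → T (S x)) e s) (λ s → hit-intro id S ℓ s refl)

    Profile : Subgraph n → Set
    Profile H = 2 ≤ size H × size H ≤ cost H × (Near H ⊎ size H + 2 ≤ cost H)

    rc-id : ∀ H → 2 ≤ size H → rc R id H + 1 ≡ size H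
    rc-id H two = trans (cong (λ k → (k ∸ 1) + 1) (hits-id (termSet R H))) (ℕₚ.m∸n+n≡m (ℕₚ.≤-trans (s≤s z≤n) two))

    shuffle : ∀ a b l → (a + l) + suc b ≡ (a + 1) + (l + b)
    shuffle a b l = trans (ℕₚ.+-assoc a l (suc b)) (trans (cong (λ z → a + z) (ℕₚ.+-suc l b)) (sym (ℕₚ.+-assoc a 1 (l + b))))

    -- For the finest partition, the labeling `id`, the rank of a component is its size minus one,
    -- so a component costs at least its rank plus one.
    cost-bound : ∀ ys → All Profile ys → intLHS R id ys + length ys ≤ totalCost ys
    cost-bound [] [] = z≤n
    cost-bound (H ∷ ys) ((two , le , _) ∷ ps) =
      ℕₚ.≤-trans (ℕₚ.≤-reflexive (trans (shuffle (rc R id H) (length ys) (intLHS R id ys)) (cong (_+ (intLHS R id ys + length ys)) (rc-id H two))))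
        (ℕₚ.+-mono-≤ le (cost-bound ys ps))

    near-or-costly : ∀ ys → All Profile ys → All Near ys ⊎ (1 ≤ length ys × intLHS R id ys + length ys + 2 ≤ totalCost ys)
    near-or-costly [] [] = inj₁ []
    near-or-costly (H ∷ ys) ((two , le , inj₂ far) ∷ ps) = inj₂ (s≤s z≤n ,
      ℕₚ.≤-trans (ℕₚ.≤-reflexive (trans (cong (_+ 2) (trans (shuffle (rc R id H) (length ys) (intLHS R id ys)) (cong (_+ rest) (rc-id H two))))
          (trans (ℕₚ.+-assoc (size H) rest 2) (trans (cong (λ z → size H + z) (ℕₚ.+-comm rest 2)) (sym (ℕₚ.+-assoc (size H) 2 rest))))))
        (ℕₚ.+-mono-≤ far (cost-bound ys ps)))
      where rest = intLHS R id ys + length ys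
    near-or-costly (H ∷ ys) ((two , le , inj₁ nr) ∷ ps) with near-or-costly ys ps
    ... | inj₁ nrs = inj₁ (nr ∷ nrs)
    ... | inj₂ (_ , more) = inj₂ (s≤s z≤n ,
      ℕₚ.≤-trans (ℕₚ.≤-reflexive (trans (cong (_+ 2) (trans (shuffle (rc R id H) (length ys) (intLHS R id ys)) (cong (_+ rest) (rc-id H two))))
          (ℕₚ.+-assoc (size H) rest 2)))
        (ℕₚ.+-mono-≤ le more))
      where rest = intLHS R id ys + length ys

    isolate : Fin n → Fin n → Fin n
    isolate x u = if does (u ≟ x) then x else root

    isolate-root : ∀ x u → u ≢ x → isolate x u ≡ root
    isolate-root x u ne with u ≟ x
    ... | yes e = ⊥-elim (ne e)
    ... | no _ = refl

    isolate-self : ∀ x → isolate x x ≡ x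
    isolate-self x with x ≟ x
    ... | yes _ = refl
    ... | no ne = ⊥-elim (ne refl)

    Avoids : Fin n → Subgraph n → Set
    Avoids x H = ∀ t → T (termSet R H t) → t ≢ x

    avoided : ∀ x ys → All (Avoids x) ys → intLHS R (isolate x) ys ≡ 0
    avoided x [] [] = refl
    avoided x (H ∷ ys) (a ∷ as) = cong₂ _+_ (ℕₚ.m≤n⇒m∸n≡0 (constant⇒hits≤1 (isolate x) (termSet R H)
      λ u v tu tv → trans (isolate-root x u (a u tu)) (sym (isolate-root x v (a v tv))))) (avoided x ys as)

    -- The partition that isolates `x` has two parts, but components avoiding `x` lie within one of
    -- them and contribute nothing.
    infeasible : ∀ x → T (R x) → x ≢ root → ∀ ys → All (Avoids x) ys → ¬ (∀ p → numParts R p ∸ 1 ≤ intLHS R p ys)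
    infeasible x rx ne ys as feas = ℕₚ.<⇒≱ {0} {1} (s≤s z≤n) (ℕₚ.≤-trans (ℕₚ.∸-monoˡ-≤ 1 two) (subst (numParts R (isolate x) ∸ 1 ≤_) (avoided x ys as) (feas (isolate x))))
      where
      two : 2 ≤ numParts R (isolate x)
      two = countFin-two (hit (isolate x) R) x root ne (hit-intro (isolate x) R x rx (isolate-self x))
              (hit-intro (isolate x) R root root-terminal (isolate-root x root λ e → ne (sym e)))

    rank≥7 : ∀ ys → (∀ p → numParts R p ∸ 1 ≤ intLHS R p ys) → 7 ≤ intLHS R id ys
    rank≥7 ys feas = subst (λ k → k ∸ 1 ≤ intLHS R id ys) (trans (hits-id R) eight) (feas id)

    -- The total rank is at least 7. If some component fits in no star, its surplus gives
    -- `7 + 1 + 2`. Otherwise one or two components leave out a terminal by `missed`, so there are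
    -- at least three and the cost is at least `7 + 3`.
    ten≤ : ∀ ys → All Profile ys → (∀ p → numParts R p ∸ 1 ≤ intLHS R p ys) → 10 ≤ totalCost ys
    ten≤ ys ps feas with near-or-costly ys ps
    ... | inj₂ (pos , le) = ℕₚ.≤-trans (ℕₚ.+-monoˡ-≤ 2 (ℕₚ.+-mono-≤ (rank≥7 ys feas) pos)) le
    ... | inj₁ nrs = go ys ps nrs feas
      where
      avoid : ∀ {x v} → ¬ T (near v x) → ∀ {H} → (∀ t → T (termSet R H t) → T (near v t)) → Avoids x H
      avoid nx h t tt′ refl = nx (h t tt′)
      go : ∀ ys → All Profile ys → All Near ys → (∀ p → numParts R p ∸ 1 ≤ intLHS R p ys) → 10 ≤ totalCost ys
      go [] _ [] feas with rank≥7 [] feas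
      ... | ()
      go (H ∷ []) _ ((v , sv , h) ∷ []) feas with missed v v sv sv
      ... | x , rx , nx , _ = ⊥-elim (infeasible x rx (λ { refl → nx (root-near v sv) }) (H ∷ []) (avoid {x} {v} nx {H} h ∷ []) feas)
      go (H ∷ K ∷ []) _ ((v , sv , h) ∷ (w , sw , k) ∷ []) feas with missed v w sv sw
      ... | x , rx , nx , nx′ = ⊥-elim (infeasible x rx (λ { refl → nx (root-near v sv) }) (H ∷ K ∷ []) (avoid {x} {v} nx {H} h ∷ avoid {x} {w} nx′ {K} k ∷ []) feas)
      go ys@(_ ∷ _ ∷ _ ∷ zs) ps _ feas = ℕₚ.≤-trans (ℕₚ.+-mono-≤ (rank≥7 ys feas) (s≤s (s≤s (s≤s (z≤n {length zs}))))) (cost-bound ys ps)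

    module _ (v : Fin n) (sv : T (not (R v))) where

      near-≢ : ∀ {t} → T (near v t) → t ≢ v
      near-≢ {t} h refl = not-elim sv (near-terminal v t h)

      -- Every edge contains the centre, but a cycle visits it at most once and has at least three
      -- vertices, so some edge avoids it.
      star-acyclic : ¬ Cycle (star v)
      star-acyclic (_ , _ ∷ [] , s≤s () , _)
      star-acyclic (a , y₁ ∷ y₂ ∷ ys , _ , ((a≢y₁ ∷ a≢y₂ ∷ _) ∷ (y₁≢y₂ ∷ y₁∉ys) ∷ _) , (e₁ ∷ e₂ ∷ lk)) with star-elim v a y₁ e₁
      ... | inj₁ (refl , _) with star-elim v y₁ y₂ e₂
      ...   | inj₁ (e , _) = a≢y₁ (sym e)
      ...   | inj₂ (e , _) = a≢y₂ (sym e)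
      star-acyclic (a , y₁ ∷ y₂ ∷ [] , _ , ((a≢y₁ ∷ a≢y₂ ∷ _) ∷ (y₁≢y₂ ∷ y₁∉ys) ∷ _) , (e₁ ∷ e₂ ∷ e₃ ∷ _)) | inj₂ (refl , _) with star-elim v y₂ a e₃
      ...   | inj₁ (e , _) = y₁≢y₂ (sym e)
      ...   | inj₂ (e , _) = a≢y₁ e
      star-acyclic (a , y₁ ∷ y₂ ∷ y₃ ∷ ys , _ , ((a≢y₁ ∷ a≢y₂ ∷ _) ∷ (y₁≢y₂ ∷ y₁≢y₃ ∷ _) ∷ _) , (e₁ ∷ e₂ ∷ e₃ ∷ _)) | inj₂ (refl , _) with star-elim v y₂ y₃ e₃
      ...   | inj₁ (e , _) = y₁≢y₂ (sym e)
      ...   | inj₂ (e , _) = y₁≢y₃ (sym e)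

      to-centre : ∀ x → 1 ≤ deg (star v) x → Walk (star v) x v
      to-centre x p with countFin-pos⁻ (star v x) p
      ... | y , t with star-elim v x y t
      ...   | inj₁ (refl , _) = nil
      ...   | inj₂ (refl , _) = cons t nil

      star-full : IsFullComponent G R (star v)
      star-full = (sub , star-symm v , (λ x y px py → to-centre x px ⊕ reverse (star-symm v) (to-centre y py)) , star-acyclic) ,
          internal , leaves
        where
        sub : star v ⊑ adj G
        sub x y t with star-elim v x y t
        ... | inj₁ (refl , h) = adj-intro (λ e → near-≢ h (sym e)) (inj₂ (near-terminal v y h))
        ... | inj₂ (refl , h) = adj-intro (near-≢ h) (inj₁ (near-terminal v x h))
        internal : ∀ u → 2 ≤ deg (star v) u → T (not (R u))
        internal u p with countFin-two⁻ (star v u) p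
        ... | x , y , ne , tx , ty with star-elim v u x tx | star-elim v u y ty
        ...   | inj₁ (refl , _) | _ = sv
        ...   | inj₂ _ | inj₁ (refl , _) = sv
        ...   | inj₂ (refl , _) | inj₂ (e , _) = ⊥-elim (ne (sym e))
        leaves : ∀ u → deg (star v) u ≡ 1 → T (R u)
        leaves u e with countFin-pos⁻ (star v u) (ℕₚ.≤-reflexive (sym e))
        ... | x , tx with star-elim v u x tx
        ...   | inj₂ (_ , h) = near-terminal v u h
        ...   | inj₁ (refl , _) = ⊥-elim (ℕₚ.<⇒≱ (s≤s (s≤s z≤n)) (subst₂ _≤_ (five v sv) e (countFin-mono (near v) (star v v) λ t → star-out v)))

      star-terminals : ∀ t → termSet R (star v) t ≡ near v t
      star-terminals t = T-ext to λ h → ∧-intro (near-terminal v t h) (T-<ᵇ (countFin-pos (star v t) v (star-in v h)))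
        where
        to : T (termSet R (star v) t) → T (near v t)
        to h with countFin-pos⁻ (star v t) (T-<ᵇ⁻ (∧-snd {R t} h))
        ... | x , tx with star-elim v t x tx
        ...   | inj₁ (refl , _) = ⊥-elim (not-elim sv (∧-fst h))
        ...   | inj₂ (_ , k) = k

      star-size : size (star v) ≡ 5
      star-size = trans (countFin-cong _ _ star-terminals) (five v sv)

      -- Minimality follows from `profile`: a full component with five terminals costs at least 5.
      star-member : InKr G R 5 (star v)
      star-member = star-full , ℕₚ.≤-trans (s≤s (s≤s z≤n)) (ℕₚ.≤-reflexive (sym star-size)) , ℕₚ.≤-reflexive star-size , λ H′ f e →
        subst₂ _≤ℚ_ (sym (cost≡ (star v))) (sym (cost≡ H′)) (ℕ→ℚ-mono {cost (star v)} {cost H′} (minimal H′ f e))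
        where
        minimal : ∀ H′ → IsFullComponent G R H′ → (∀ u → termSet R H′ u ≡ termSet R (star v) u) → cost (star v) ≤ cost H′
        minimal H′ f e = ℕₚ.≤-trans (star-cost v sv) (subst (_≤ cost H′) size≡ (proj₁ (profile H′ f (ℕₚ.≤-trans (s≤s (s≤s z≤n)) (ℕₚ.≤-reflexive (sym size≡))))))
          where
          size≡ : size H′ ≡ 5
          size≡ = trans (countFin-cong _ _ e) star-size

      star-cost≡ : cost (star v) ≡ 5
      star-cost≡ = ℕₚ.≤-antisym (star-cost v sv) (subst (_≤ cost (star v)) star-size (proj₁ (profile (star v) star-full (ℕₚ.≤-trans (s≤s (s≤s z≤n)) (ℕₚ.≤-reflexive (sym star-size))))))

    quarter : ℚ
    quarter = ℚ.½ *ℚ ℚ.½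

    solution : FracSol n
    solution = map (λ v → star v , quarter) vs

    four-quarters : ∀ q → ℕ→ℚ 4 *ℚ (quarter *ℚ q) ≡ q
    four-quarters q = trans (sym (ℚₚ.*-assoc (ℕ→ℚ 4) quarter q)) (ℚₚ.*-identityˡ q)

    -- Multiplication by 4 clears the uniform weight. Here `f` stands for the cost as well as for
    -- the left-hand side of a partition inequality.
    quarter-sum : ∀ ws (f : FracSol n → ℚ) (g : Fin n → ℕ) → f [] ≡ 0ℚ →
      (∀ v xs → f ((star v , quarter) ∷ xs) ≡ quarter *ℚ ℕ→ℚ (g v) +ℚ f xs) →
      ℕ→ℚ 4 *ℚ f (map (λ v → star v , quarter) ws) ≡ ℕ→ℚ (sumOver ws g)
    quarter-sum [] f g e h = trans (cong (ℕ→ℚ 4 *ℚ_) e) (ℚₚ.*-zeroʳ (ℕ→ℚ 4))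
    quarter-sum (w ∷ ws) f g e h = trans (cong (ℕ→ℚ 4 *ℚ_) (h w _)) (trans (ℚₚ.*-distribˡ-+ (ℕ→ℚ 4) (quarter *ℚ ℕ→ℚ (g w)) (f (map (λ v → star v , quarter) ws)))
      (trans (cong₂ _+ℚ_ (four-quarters (ℕ→ℚ (g w))) (quarter-sum ws f g e h)) (sym (ℕ→ℚ-+ (g w) (sumOver ws g)))))

    solution-cost : fracCost G solution ≡ quarter *ℚ ℕ→ℚ 35
    solution-cost = begin
        fracCost G solution
          ≡⟨ sym (four-quarters (fracCost G solution)) ⟩
        ℕ→ℚ 4 *ℚ (quarter *ℚ fracCost G solution)
          ≡⟨ lemma (ℕ→ℚ 4) quarter (fracCost G solution) ⟩
        quarter *ℚ (ℕ→ℚ 4 *ℚ fracCost G solution)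
          ≡⟨ cong (quarter *ℚ_) (quarter-sum vs (fracCost G) (λ v → cost (star v)) refl λ v xs → cong (λ z → quarter *ℚ z +ℚ fracCost G xs) (cost≡ (star v))) ⟩
        quarter *ℚ ℕ→ℚ (sumOver vs (λ v → cost (star v)))
          ≡⟨ cong (λ k → quarter *ℚ ℕ→ℚ k) total ⟩
        quarter *ℚ ℕ→ℚ 35 ∎
      where
      open ≡-Reasoning
      lemma : ∀ a b x → a *ℚ (b *ℚ x) ≡ b *ℚ (a *ℚ x)
      lemma = solve-∀ ℚ-ring
      total : sumOver vs (λ v → cost (star v)) ≡ 35
      total = trans (ℕₚ.≤-antisym (sumOver-mono (All.map (λ {v} sv → ℕₚ.≤-reflexive (star-cost≡ v sv)) vs-steiner))
                (sumOver-mono (All.map (λ {v} sv → ℕₚ.≤-reflexive (sym (star-cost≡ v sv))) vs-steiner)))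
                (trans (sumOver-const vs 5) (cong (_* 5) vs-length))

    -- Every part hits at least four stars, and the part of the root hits all seven.
    covering : ∀ p → 4 * (numParts R p ∸ 1) ≤ sumOver vs (λ v → rc R p (star v))
    -- Adding 7 undoes the subtraction in `rc` once for each of the seven stars, and turns
    -- `4 (N - 1)` into `4 N + 3`.
    covering p = ℕₚ.+-cancelʳ-≤ 7 _ _ (begin
        4 * (N ∸ 1) + 7
          ≡⟨ sym (ℕₚ.+-assoc (4 * (N ∸ 1)) 4 3) ⟩
        (4 * (N ∸ 1) + 4) + 3
          ≡⟨ cong (_+ 3) (trans (sym (ℕₚ.*-distribˡ-+ 4 (N ∸ 1) 1)) (cong (4 *_) (ℕₚ.m∸n+n≡m N≥1))) ⟩
        4 * N + 3
          ≤⟨ ℕₚ.+-monoʳ-≤ (4 * N) (ℕₚ.*-monoʳ-≤ 3 (countFin-pos e (p root) (does-intro (p root ≟ p root) refl))) ⟩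
        4 * N + 3 * countFin e
          ≤⟨ sumOver-countFin vs (λ v → hit p (termSet R (star v))) (hit p R) e pointwise ⟩
        sumOver vs (λ v → hits p (termSet R (star v)))
          ≤⟨ sumOver-mono (All.universal (λ v → ℕₚ.≤-trans (ℕₚ.m≤n+m∸n (hits p (termSet R (star v))) 1) (ℕₚ.≤-reflexive (ℕₚ.+-comm 1 _))) vs) ⟩
        sumOver vs (λ v → rc R p (star v) + 1)
          ≡⟨ trans (sumOver-+ vs (λ v → rc R p (star v)) (λ _ → 1)) (cong (λ z → sumOver vs (λ v → rc R p (star v)) + z) (trans (sumOver-const vs 1) (cong (_* 1) vs-length))) ⟩
        sumOver vs (λ v → rc R p (star v)) + 7 ∎)
      where
      open ℕₚ.≤-Reasoning
      N = numParts R p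
      e : Fin n → Bool
      e ℓ = does (p root ≟ ℓ)
      N≥1 : 1 ≤ N
      N≥1 = countFin-pos (hit p R) (p root) (hit-intro p R root root-terminal refl)
      hits-near : ∀ t {v} → T (not (R v)) → T (near v t) → T (hit p (termSet R (star v)) (p t))
      hits-near t {v} sv h = hit-intro p (termSet R (star v)) t (subst T (sym (star-terminals v sv t)) h) refl
      pointwise : ∀ ℓ → 4 * bit (hit p R ℓ) + 3 * bit (e ℓ) ≤ sumOver vs (λ v → bit (hit p (termSet R (star v)) ℓ))
      pointwise ℓ with p root ≟ ℓ
      ... | yes refl = begin
          4 * bit (hit p R (p root)) + 3
            ≤⟨ ℕₚ.+-monoˡ-≤ 3 (ℕₚ.*-monoʳ-≤ 4 (bit-mono {hit p R (p root)} {true} λ _ → tt)) ⟩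
          7
            ≡⟨ sym (trans (sumOver-const vs 1) (cong (_* 1) vs-length)) ⟩
          sumOver vs (λ _ → 1)
            ≤⟨ sumOver-mono (All.map (λ {v} sv → bit-mono {true} λ _ → hits-near root sv (root-near v sv)) vs-steiner) ⟩
          sumOver vs (λ v → bit (hit p (termSet R (star v)) (p root))) ∎
      ... | no _ with T? (hit p R ℓ)
      ...   | no nh rewrite ¬T⇒≡ nh = z≤n
      ...   | yes h with hit-elim p R ℓ h
      ...     | t , rt , refl rewrite T⇒≡ h = ℕₚ.≤-trans (four t rt)
                  (sumOver-mono (All.map (λ {v} sv → bit-mono (hits-near t sv)) vs-steiner))

    solution-feasible : FracFeasible G R 5 solution
    solution-feasible = Allₚ.map⁺ (All.map (λ {v} sv → star-member v sv , ℚₚ.nonNegative⁻¹ quarter) vs-steiner) , λ p →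
      ℚₚ.*-cancelˡ-≤-pos (ℕ→ℚ 4) (subst₂ _≤ℚ_ (ℕ→ℚ-* 4 (numParts R p ∸ 1))
        (sym (quarter-sum vs (fracLHS R p) (λ v → rc R p (star v)) refl λ v xs → refl))
        (ℕ→ℚ-mono {4 * (numParts R p ∸ 1)} {sumOver vs (λ v → rc R p (star v))} (covering p)))

    -- The hypothesis says that `α` is the integral bound 10 divided by the fractional cost 35/4,
    -- which is 8/7.
    gap≥ : ∀ α → α *ℚ (quarter *ℚ ℕ→ℚ 35) ≡ ℕ→ℚ 10 → GapAtLeast G R 5 α
    gap≥ α eq = solution , solution-feasible , subst (0ℚ ℚ.<_) (sym solution-cost) (ℚₚ.positive⁻¹ (quarter *ℚ ℕ→ℚ 35)) ,
      λ ys (members , feas) → ℚₚ.≤-trans (ℚₚ.≤-reflexive (trans (cong (α *ℚ_) solution-cost) eq))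
        (ℚₚ.≤-trans (ℕ→ℚ-mono {10} {totalCost ys} (ten≤ ys (All.map prof members) feas)) (ℚₚ.≤-reflexive (sym (intCost≡ ys))))
      where
      prof : ∀ {H} → InKr G R 5 H → Profile H
      prof {H} (f , two , _) = two , profile H f two

-- The concrete instance, checked by evaluation.

allFinᵇ : ∀ {n} → (Fin n → Bool) → Bool
allFinᵇ {zero} f = true
allFinᵇ {suc n} f = f zero ∧ allFinᵇ (λ i → f (suc i))

allFinᵇ-elim : ∀ {n} (f : Fin n → Bool) → T (allFinᵇ f) → ∀ i → T (f i)
allFinᵇ-elim f t zero = ∧-fst t
allFinᵇ-elim f t (suc i) = allFinᵇ-elim (λ j → f (suc j)) (∧-snd {f zero} t) i

infixr 4 _⇒ᵇ_
_⇒ᵇ_ : Bool → Bool → Bool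
x ⇒ᵇ y = not x ∨ y

⇒ᵇ-elim : ∀ x {y} → T (x ⇒ᵇ y) → T x → T y
⇒ᵇ-elim true t _ = t

-- Skutella's instance: the Steiner vertices 0,…,6 stand for the lines {v, v+1, v+3} of the Fano plane,
-- 7 is the root and 8,…,14 are the points; v is near the root and the four points off its line.
module Skutella where

  R : Fin 15 → Bool
  R u = 7 ≤ᵇ toℕ u

  onLine : ℕ → Bool
  onLine k = (k ≡ᵇ 0) ∨ (k ≡ᵇ 1) ∨ (k ≡ᵇ 3)

  -- The point `t` has residue `t - 8`, and `t + 6 - v` is congruent to `t - 8 - v` modulo 7 while
  -- staying in `ℕ`.
  near : Fin 15 → Fin 15 → Bool
  near v t = not (R v) ∧ R t ∧ ((toℕ t ≡ᵇ 7) ∨ not (onLine ((toℕ t + 6 ∸ toℕ v) % 7)))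

  -- The distances in the bipartite graph `near`: two Steiner vertices share the root, two terminals
  -- share a near Steiner vertex, and a Steiner vertex reaches any other terminal in three steps.
  d : Fin 15 → Fin 15 → ℕ
  d u v =
    if toℕ u ≡ᵇ toℕ v then 0 else
    if near u v ∨ near v u then 1 else
    if (R u ∧ R v) ∨ (not (R u) ∧ not (R v)) then 2 else 3

  root : Fin 15
  root = # 7

  lines : List (Fin 15)
  lines = # 0 ∷ # 1 ∷ # 2 ∷ # 3 ∷ # 4 ∷ # 5 ∷ # 6 ∷ []

  -- The implicit argument has type `⊤` once the Boolean evaluates to `true`, and is then filled in
  -- automatically.
  check₁ : (f : Fin 15 → Bool) → {_ : T (allFinᵇ f)} → ∀ u → T (f u)
  check₁ f {t} = allFinᵇ-elim f t

  check₂ : (f : Fin 15 → Fin 15 → Bool) → {_ : T (allFinᵇ λ u → allFinᵇ (f u))} → ∀ u v → T (f u v)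
  check₂ f {t} u = allFinᵇ-elim (f u) (allFinᵇ-elim (λ u → allFinᵇ (f u)) t u)

  check₃ : (f : Fin 15 → Fin 15 → Fin 15 → Bool) → {_ : T (allFinᵇ λ u → allFinᵇ λ v → allFinᵇ (f u v))} → ∀ u v w → T (f u v w)
  check₃ f {t} u v = allFinᵇ-elim (f u v) (check₂ (λ u v → allFinᵇ (f u v)) {t} u v)

  d-sym : ∀ u v → d u v ≡ d v u
  d-sym u v = ℕₚ.≡ᵇ⇒≡ (d u v) (d v u) (check₂ (λ u v → d u v ≡ᵇ d v u) u v)

  d-refl : ∀ u → d u u ≡ 0
  d-refl u = ℕₚ.≡ᵇ⇒≡ (d u u) 0 (check₁ (λ u → d u u ≡ᵇ 0) u)

  triangle : ∀ u v w → d u w ≤ d u v + d v w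
  triangle u v w = ℕₚ.≤ᵇ⇒≤ (d u w) (d u v + d v w) (check₃ (λ u v w → d u w ≤ᵇ d u v + d v w) u v w)

  open Instance R near d d-sym d-refl triangle

  steiner-first : ∀ v t → T (not (R v)) → T (R t) → toℕ v < toℕ t
  steiner-first v t sv rt = ℕₚ.<ᵇ⇒< (toℕ v) (toℕ t) (⇒ᵇ-elim (R t) (⇒ᵇ-elim (not (R v))
    (check₂ (λ v t → not (R v) ⇒ᵇ R t ⇒ᵇ (toℕ v <ᵇ toℕ t)) v t) sv) rt)

  near-terminal : ∀ v t → T (near v t) → T (R t)
  near-terminal v t h = ∧-fst (∧-snd {not (R v)} h)

  d-terminals : ∀ s t → T (R s) → T (R t) → s ≢ t → 2 ≤ d s t
  d-terminals s t rs rt ne = ℕₚ.≤ᵇ⇒≤ 2 (d s t) (⇒ᵇ-elim (not (does (s ≟ t))) (⇒ᵇ-elim (R t) (⇒ᵇ-elim (R s)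
    (check₂ (λ s t → R s ⇒ᵇ R t ⇒ᵇ not (does (s ≟ t)) ⇒ᵇ (2 ≤ᵇ d s t)) s t) rs) rt) (not-intro λ e → ne (does-elim (s ≟ t) e)))

  d-pos : ∀ v t → T (not (R v)) → T (R t) → 1 ≤ d v t
  d-pos v t sv rt = ℕₚ.≤ᵇ⇒≤ 1 (d v t) (⇒ᵇ-elim (R t) (⇒ᵇ-elim (not (R v))
    (check₂ (λ v t → not (R v) ⇒ᵇ R t ⇒ᵇ (1 ≤ᵇ d v t)) v t) sv) rt)

  d-far : ∀ v t → T (not (R v)) → T (R t) → ¬ T (near v t) → 3 ≤ d v t
  d-far v t sv rt nn = ℕₚ.≤ᵇ⇒≤ 3 (d v t) (⇒ᵇ-elim (not (near v t)) (⇒ᵇ-elim (R t) (⇒ᵇ-elim (not (R v))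
    (check₂ (λ v t → not (R v) ⇒ᵇ R t ⇒ᵇ not (near v t) ⇒ᵇ (3 ≤ᵇ d v t)) v t) sv) rt) (not-intro nn))

  pair : ∀ s t → T (R s) → T (R t) → ∃ λ v → T (not (R v)) × T (near v s) × T (near v t)
  pair s t rs rt with anyFin-elim (λ v → not (R v) ∧ near v s ∧ near v t) (⇒ᵇ-elim (R t) (⇒ᵇ-elim (R s)
    (check₂ (λ s t → R s ⇒ᵇ R t ⇒ᵇ anyFin (λ v → not (R v) ∧ near v s ∧ near v t)) s t) rs) rt)
  ... | v , h = v , ∧-fst h , ∧-fst (∧-snd {not (R v)} h) , ∧-snd {near v s} (∧-snd {not (R v)} h)

  root-near : ∀ v → T (not (R v)) → T (near v root)
  root-near v sv = ⇒ᵇ-elim (not (R v)) (check₁ (λ v → not (R v) ⇒ᵇ near v root) v) sv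

  missed : ∀ v w → T (not (R v)) → T (not (R w)) → ∃ λ x → T (R x) × ¬ T (near v x) × ¬ T (near w x)
  missed v w sv sw with anyFin-elim (λ x → R x ∧ not (near v x) ∧ not (near w x)) (⇒ᵇ-elim (not (R w)) (⇒ᵇ-elim (not (R v))
    (check₂ (λ v w → not (R v) ⇒ᵇ not (R w) ⇒ᵇ anyFin (λ x → R x ∧ not (near v x) ∧ not (near w x))) v w) sv) sw)
  ... | x , h = x , ∧-fst h , not-elim (∧-fst (∧-snd {R x} h)) , not-elim (∧-snd {not (near v x)} (∧-snd {R x} h))

  five : ∀ v → T (not (R v)) → countFin (near v) ≡ 5
  five v sv = ℕₚ.≡ᵇ⇒≡ (countFin (near v)) 5 (⇒ᵇ-elim (not (R v)) (check₁ (λ v → not (R v) ⇒ᵇ (countFin (near v) ≡ᵇ 5)) v) sv)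

  star-cost : ∀ v → T (not (R v)) → cost (star v) ≤ 5
  star-cost v sv = ℕₚ.≤ᵇ⇒≤ (cost (star v)) 5 (⇒ᵇ-elim (not (R v)) (check₁ (λ v → not (R v) ⇒ᵇ (cost (star v) ≤ᵇ 5)) v) sv)

  four : ∀ t → T (R t) → 4 ≤ sumOver lines (λ v → bit (near v t))
  four t rt = ℕₚ.≤ᵇ⇒≤ 4 (sumOver lines (λ v → bit (near v t))) (⇒ᵇ-elim (R t) (check₁ (λ t → R t ⇒ᵇ (4 ≤ᵇ sumOver lines (λ v → bit (near v t)))) t) rt)

  gap-8/7 : GapAtLeast instanceGraph R 5 (+ 8 / 7)
  gap-8/7 = gap≥ steiner-first near-terminal d-terminals d-pos d-far pair root _ root-near missed refl five star-cost lines
    (_ ∷ _ ∷ _ ∷ _ ∷ _ ∷ _ ∷ _ ∷ []) refl four (+ 8 / 7) refl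

theorem2 : ∀ (b : ℕ) → 1 ≤ b →
    (∀ (r : ℕ) → 2 ≤ r → ∀ (n : ℕ) (G : Graph n) (R : Fin n → Bool) →
    A1 G R → A2 G R → QuasiBipartite b G R →
    GapAtMost G R r ((+ (2 * b + 1)) / suc b))
    ×
    (∃ λ (r : ℕ) → 2 ≤ r × ∃ λ (n : ℕ) → ∃ λ (G : Graph n) → ∃ λ (R : Fin n → Bool) →
    A1 G R × A2 G R × QuasiBipartite 1 G R × GapAtLeast G R r ((+ 8) / 7))
theorem2 b _ =
  (λ r _ n G R _ _ qb → UpperBound.gap G R r b qb) ,
  -- Each star has 5 terminals; the 15 vertices are seven lines, the root and seven points.
  5 , s≤s (s≤s z≤n) , 15 , instanceGraph , R , a1 , a2 , quasiBipartite , gap-8/7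
  where
  open Skutella
  open Instance R near d d-sym d-refl triangle
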